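{- Let $q$ be a prime power, $n\ge2$, $s\ge2$, $1\le k\le n-1$ integers, $\sigma$ a generator of $\mathrm{Gal}(\mathbb F_{q^n}/\mathbb F_q)$, and $F\in\mathbb F_q[Y]$ a monic irreducible polynomial of degree $s$. If $(n,s,F)\ne(2,2,Y^2-\nu)$ for every $\nu\in\mathbb F_q^\times$, then $$\mathrm{Aut}_{\mathbb E_F}(\mathcal S_k(F))=\mathcal A_F.$$
   Context: $R=\mathbb F_{q^n}[X;\sigma]$ is the skew polynomial ring with $X\alpha=\sigma(\alpha)X$; its center is $\mathbb F_q[X^n]$. $RF(X^n)$ is a two-sided ideal, $R_F:=R/RF(X^n)$, and $\mathbb E_F:=Z(R_F)$ is the image of $\mathbb F_q[X^n]$, a field isomorphic to $\mathbb F_q[Y]/(F)\cong\mathbb F_{q^s}$; $R_F\cong M_n(\mathbb E_F)$ as $\mathbb E_F$-algebras. Elements of $\mathbb F_{q^n}$ and $X$ are identified with their classes in $R_F$ ($X$ is a unit of $R_F$). The code is $$\mathcal S_k(F):=\Big\{\sum_{i=0}^{sk-1}\alpha_iX^i+RF(X^n):\alpha_i\in\mathbb F_{q^n}\Big\}\subseteq R_F .$$ Under $R_F\cong M_n(\mathbb E_F)$, its linear automorphism group is $$\mathrm{Aut}_{\mathbb E_F}(\mathcal S_k(F)):=\{(\bar g,\bar h)\in R_F^\times\times R_F^\times:\ \bar g\,\mathcal S_k(F)\,\bar h=\mathcal S_k(F)\}.$$ Finally, $$\mathcal G_F:=\{\bar c\,\gamma X^t:\ \bar c\in\mathbb E_F^\times,\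 \gamma\in\mathbb F_{q^n}^\times,\ t\in\{0,\dots,n-1\}\},\qquad \mathcal A_F:=\{(\bar g,\bar g^{ -1}\lambda):\ \bar g\in\mathcal G_F,\ \lambda\in\mathbb F_{q^n}^\times\}.$$ -}

module Defs where

open import Level using (Level; _⊔_)
open import Algebra.Core using (Op₁; Op₂)
open import Algebra.Bundles using (CommutativeRing)
open import Algebra.Bundles.Raw using (RawRing)
open import Algebra.Apartness.Bundles using (HeytingField; HeytingCommutativeRing)
import Algebra.Definitions
import Algebra.Definitions.RawSemiring
open import Algebra.Morphism.Structures using (IsRingMonomorphism; IsRingIsomorphism)
open import Data.Fin.Base using (Fin; toℕ)
open import Data.List.Base using (List; []; _∷_; map)
open import Data.Nat.Base as ℕ using (ℕ; zero; suc)
open import Data.Nat.GeneralisedArithmetic using (iterate)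
open import Data.Nat.Primality using (Prime)
open import Data.Product.Base using (Σ-syntax; ∃-syntax; _×_; _,_)
open import Function.Base using (id)
open import Function.Bundles using (Inverse)
open import Relation.Binary.PropositionalEquality using (_≡_; setoid)
open import Relation.Nullary.Negation using (¬_)
open import Relation.Unary using (Pred; _∈_; _≐_)

private
  variable
    c ℓ a : Level

PrimePower : ℕ → Set
PrimePower q = ∃[ p ] ∃[ e ] Prime p × 1 ℕ.≤ e × q ≡ p ℕ.^ e

------------------------------------------------------------------------
-- Finite fields and their Galois groups

-- On a finite carrier _≈_ is decidable and the apartness of a Heyting
-- field coincides with _≉_, so a Heyting field in bijection with some
-- Fin q is precisely a finite field in the usual sense.

HasCardinality : HeytingField c ℓ a → ℕ → Set (c ⊔ ℓ)
HasCardinality K q = Inverse (setoid (Fin q)) (HeytingField.setoid K)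

rawRing : HeytingField c ℓ a → RawRing c ℓ
rawRing K = CommutativeRing.rawRing
  (HeytingCommutativeRing.commutativeRing (HeytingField.heytingCommutativeRing K))

module Galois
  {c₁ ℓ₁ a₁ c₂ ℓ₂ a₂ : Level}
  (k : HeytingField c₁ ℓ₁ a₁) (K : HeytingField c₂ ℓ₂ a₂)
  (ι : HeytingField.Carrier k → HeytingField.Carrier K)
  where

  private
    module k = HeytingField k
    module K = HeytingField K

  IsFieldExtension : Set (c₁ ⊔ ℓ₁ ⊔ ℓ₂)
  IsFieldExtension = IsRingMonomorphism (rawRing k) (rawRing K) ι

  record IsGaloisAutomorphism (τ : Op₁ K.Carrier) : Set (c₁ ⊔ c₂ ⊔ ℓ₂) where
    field
      isRingIsomorphism : IsRingIsomorphism (rawRing K) (rawRing K) τ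
      fixes             : ∀ x → τ (ι x) K.≈ ι x

  -- Natural-number powers suffice to generate, the group being finite.
  record IsGaloisGenerator (σ : Op₁ K.Carrier) : Set (c₁ ⊔ c₂ ⊔ ℓ₂) where
    field
      isGaloisAutomorphism : IsGaloisAutomorphism σ
      generates            : ∀ τ → IsGaloisAutomorphism τ →
                             ∃[ m ] (∀ x → τ x K.≈ iterate σ x m)

------------------------------------------------------------------------
-- Skew polynomials A[X;σ], with X a = σ(a) X

-- The list a₀ ∷ a₁ ∷ … stands for a₀ + a₁ X + …, coefficients on the
-- left.  Trailing zeros are allowed: equality is coefficientwise.

module SkewPolynomial {c ℓ : Level} (A : RawRing c ℓ) (σ : Op₁ (RawRing.Carrier A)) where

  private
    module A = RawRing A

  Poly : Set c
  Poly = List A.Carrier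

  coeff : Poly → ℕ → A.Carrier
  coeff []      _       = A.0#
  coeff (a ∷ p) zero    = a
  coeff (a ∷ p) (suc i) = coeff p i

  infix  4 _≈_
  infixl 6 _+_
  infixl 7 _*_
  infix  8 -_

  record _≈_ (p r : Poly) : Set ℓ where
    constructor coefficientwise
    field
      coeff-≈ : ∀ i → coeff p i A.≈ coeff r i

  _+_ : Op₂ Poly
  []      + r       = r
  (a ∷ p) + []      = a ∷ p
  (a ∷ p) + (b ∷ r) = (a A.+ b) ∷ (p + r)

  -_ : Op₁ Poly
  - p = map A.-_ p

  -- (a + p X) r = a r + p (X r)  and  X (Σ bⱼ Xʲ) = Σ σ(bⱼ) Xʲ⁺¹.
  _*_ : Op₂ Poly
  []      * r = []
  (a ∷ p) * r = map (a A.*_) r + p * (A.0# ∷ map σ r)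

  const : A.Carrier → Poly
  const a = a ∷ []

  X : Poly
  X = A.0# ∷ A.1# ∷ []

  ring : RawRing c ℓ
  ring = record
    { Carrier = Poly
    ; _≈_     = _≈_
    ; _+_     = _+_
    ; _*_     = _*_
    ; -_      = -_
    ; 0#      = []
    ; 1#      = const A.1#
    }

  IsMonicOfDegree : Poly → ℕ → Set ℓ
  IsMonicOfDegree p s = coeff p s A.≈ A.1# × (∀ i → s ℕ.< i → coeff p i A.≈ A.0#)

-- K[Y], as the skew polynomial ring with trivial twist.
module Polynomial {c ℓ a : Level} (K : HeytingField c ℓ a) = SkewPolynomial (rawRing K) id

------------------------------------------------------------------------
-- Quotients and units

-- B / B m, for m generating a two-sided ideal B m = m B.
module Quotient {c ℓ : Level} (B : RawRing c ℓ) (m : RawRing.Carrier B) where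

  private
    module B = RawRing B

  infix 4 _≈_

  record _≈_ (x y : B.Carrier) : Set (c ⊔ ℓ) where
    constructor congruent
    field
      factor : B.Carrier
      x-y≈hm : x B.+ B.- y B.≈ factor B.* m

  ring : RawRing c (c ⊔ ℓ)
  ring = record
    { Carrier = B.Carrier
    ; _≈_     = _≈_
    ; _+_     = B._+_
    ; _*_     = B._*_
    ; -_      = B.-_
    ; 0#      = B.0#
    ; 1#      = B.1#
    }

module UnitsAndCenter {c ℓ : Level} (B : RawRing c ℓ) where

  open RawRing B
  open Algebra.Definitions _≈_ using (Invertible)

  Unit : Pred Carrier (c ⊔ ℓ)
  Unit = Invertible 1# _*_

  Center : Pred Carrier (c ⊔ ℓ)
  Center z = ∀ x → z * x ≈ x * z

  CenterUnit : Pred Carrier (c ⊔ ℓ)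
  CenterUnit z = z ∈ Center × ∃[ w ] (w ∈ Center × z * w ≈ 1#)

------------------------------------------------------------------------
-- The code S_k(F) in R_F = R / R F(Xⁿ), where R = K[X;σ]

module Code
  {c₁ ℓ₁ a₁ c₂ ℓ₂ a₂ : Level}
  (k : HeytingField c₁ ℓ₁ a₁) (K : HeytingField c₂ ℓ₂ a₂)
  (ι : HeytingField.Carrier k → HeytingField.Carrier K)
  (σ : Op₁ (HeytingField.Carrier K))
  (n s : ℕ)
  (F : Polynomial.Poly k)
  where

  private
    module K = HeytingField K
    module R = SkewPolynomial (rawRing K) σ

  open Algebra.Definitions.RawSemiring (RawRing.rawSemiring R.ring) using (_^_; sum)

  -- Substitution of p for Y.
  evaluate : Polynomial.Poly k → R.Poly → R.Poly
  evaluate []      p = []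
  evaluate (f ∷ G) p = R.const (ι f) R.+ evaluate G p R.* p

  -- F(Xⁿ) is central in R because σ fixes k and has order n, so the left
  -- ideal it generates is two-sided.
  module R_F = Quotient R.ring (evaluate F (R.X ^ n))

  open RawRing R_F.ring using (_*_; _≈_; 1#) public
  open UnitsAndCenter R_F.ring public

  𝒮 : ℕ → Pred R.Poly (c₂ ⊔ ℓ₂)
  𝒮 κ x = Σ[ α ∈ (Fin (s ℕ.* κ) → K.Carrier) ]
          x ≈ sum (λ i → R.const (α i) * R.X ^ toℕ i)

  _·_·_ : R.Poly → Pred R.Poly (c₂ ⊔ ℓ₂) → R.Poly → Pred R.Poly (c₂ ⊔ ℓ₂)
  (g · S · h) x = ∃[ y ] (y ∈ S × x ≈ g * y * h)

  -- Subsets of R_F × R_F are predicates on pairs of representatives in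
  -- R that respect congruence.

  Aut : ℕ → Pred (R.Poly × R.Poly) (c₂ ⊔ ℓ₂)
  Aut κ (g , h) = g ∈ Unit × h ∈ Unit × (g · 𝒮 κ · h) ≐ 𝒮 κ

  𝒢 : Pred R.Poly (c₂ ⊔ ℓ₂)
  𝒢 g = ∃[ z ] ∃[ γ ] ∃[ t ]
        (z ∈ CenterUnit × ¬ (γ K.≈ K.0#) × g ≈ z * R.const γ * R.X ^ toℕ {n} t)

  𝒜 : Pred (R.Poly × R.Poly) (c₂ ⊔ ℓ₂)
  𝒜 (g , h) = g ∈ 𝒢 × ∃[ g⁻¹ ] ∃[ μ ]
              (g⁻¹ * g ≈ 1# × g * g⁻¹ ≈ 1# × ¬ (μ K.≈ K.0#) × h ≈ g⁻¹ * R.const μ)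

{-# OPTIONS --safe #-}
module Submission where

-- Let g 𝒮 h = 𝒮 and K = 𝔽_{qⁿ}.  Comparing degrees, the left and the right
-- idealizer of 𝒮 are both K, so g and h normalise K.  Since σ has order
-- exactly n, an element normalising K is homogeneous for the ℤ/n-grading of
-- R_F by the exponents of X; so are the f_i = g Xⁱ h.  As f_i X^{jn} lies in
-- 𝒮 whenever i + jn < sk, the degree of f_i is so small that for two
-- consecutive values of i the f_i are monomials α Xʲ and β Xʲ⁺¹, unless n = 2
-- and X⁴ ∈ K, which forces F = Y² − ν.  Hence g X = c X g with c ∈ K.  A
-- nonzero coefficient γ of g then satisfies γ = c σ(γ), so that γ⁻¹ g X⁻ᵗ is
-- central for a suitable t.  Finally 𝒮 = g 𝒮 h = 𝒮 g h gives g h ∈ K.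
--
-- That σ has order n: Frobenius is a power of σ, and the polynomial with the
-- roots x, x^q, x^{q²}, … has coefficients in 𝔽_q, so that σ(x) is a
-- Frobenius conjugate of x; as σ commutes with Frobenius, σⁿ(x) = x follows.

open import Algebra.Apartness.Bundles using (HeytingField; HeytingCommutativeRing)
open import Algebra.Bundles using (CommutativeRing; Ring; AbelianGroup)
open import Algebra.Bundles.Raw using (RawRing)
import Algebra.Definitions.RawMagma
open import Algebra.Definitions.RawSemiring using (Irreducible)
import Algebra.Morphism.Construct.Identity as Identity
open import Algebra.Morphism.Structures using (IsRingHomomorphism; IsRingMonomorphism; IsRingIsomorphism)
open import Algebra.Structures using (IsAbelianGroup; IsRing)
open import Data.Empty using (⊥; ⊥-elim)
open import Data.Fin.Base as Fin using (Fin; zero; suc; toℕ)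
import Data.Fin.Properties as Fin
open import Data.List.Base as List using (List; []; _∷_)
open import Data.Maybe.Base using (nothing)
open import Data.Nat.Base as ℕ using (ℕ; zero; suc; s≤s; z≤n)
import Data.Nat.DivMod as ℕ
open import Data.Nat.GeneralisedArithmetic using (fold; fold-+; iterate-is-fold)
import Data.Nat.Properties as ℕ
open import Data.Product.Base using (∃-syntax; _×_; _,_; proj₁; proj₂)
open import Data.Sum.Base using (_⊎_; inj₁; inj₂)
open import Data.Vec.Base as Vec using (Vec; []; _∷_)
import Data.Vec.Properties as Vec
open import Function.Base using (_∘_; id)
open import Function.Bundles using (Inverse)
open import Level using (Level; _⊔_)
open import Relation.Binary.Definitions using (Decidable)
open import Relation.Binary.PropositionalEquality as ≡ using (_≡_)
open import Relation.Nullary using (¬_; Dec; yes; no)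
open import Defs

-- Finite fields

-- The bound on degrees is a counting argument. Write m = sk = b + an with b < n. Below m, a class
-- of exponents modulo n has a + 1 members if its representative is less than b, and a members
-- otherwise. As Xⁿ is central, all f_i X^{jn} with i + jn < m lie in 𝒮. If there are as many of
-- them as the class of f_i has members, f_i has the least possible degree; if there are more, that
-- is absurd. Hence, for r the total degree of g and h modulo n, no long class may be carried to a
-- short one, which leaves r = 0 or b = 0. The comparison needs degrees below sn, where
-- representatives are unique. Long classes are therefore useless if a + 1 = s; then the two highest
-- classes, short because m + 2 ≤ sn, replace the two lowest.
--
-- Two consecutive monomials are wanted because h cancels from them: g X g⁻¹ = f_{i+1} f_i⁻¹ = β X
-- α⁻¹ ∈ K X. For b = 0 and r ≠ 0 the pair must not wrap around modulo n, which cannot be avoided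
-- only if n = 2 and r = 1.

record IsDiscreteField {c ℓ} (A : CommutativeRing c ℓ) : Set (c ⊔ ℓ) where
  open CommutativeRing A hiding (zero)
  infix 4 _≟_
  field
    _≟_     : Decidable _≈_
    1≉0     : ¬ (1# ≈ 0#)
    inverse : ∀ x → ¬ (x ≈ 0#) → ∃[ y ] (x * y ≈ 1#)

module DiscreteField {c ℓ} (A : CommutativeRing c ℓ) (isField : IsDiscreteField A) where

  open CommutativeRing A hiding (zero)
  open IsDiscreteField isField public
  open import Algebra.Properties.Ring ring public
  open import Algebra.Properties.Semiring.Exp semiring public
  open import Relation.Binary.Reasoning.Setoid setoid
  open import Tactic.RingSolver.Core.AlmostCommutativeRing using (fromCommutativeRing)
  open import Tactic.RingSolver.NonReflective (fromCommutativeRing A (λ _ → nothing))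
    using (solve; _⊕_; _⊗_; _⊜_)

  x-y+y≈x : ∀ x y → x - y + y ≈ x
  x-y+y≈x x y = trans (+-assoc _ _ _) (trans (+-congˡ (-‿inverseˡ y)) (+-identityʳ x))

  x-y≈0⇒x≈y : ∀ {x y} → x - y ≈ 0# → x ≈ y
  x-y≈0⇒x≈y {x} {y} eq = begin
    x              ≈⟨ x-y+y≈x x y ⟨
    x - y + y      ≈⟨ +-congʳ eq ⟩
    0# + y         ≈⟨ +-identityˡ y ⟩
    y              ∎

  x≈y⇒x-y≈0 : ∀ {x y} → x ≈ y → x - y ≈ 0#
  x≈y⇒x-y≈0 {x} {y} eq = trans (+-congʳ eq) (-‿inverseʳ y)

  *-cancelˡ-≉0 : ∀ {x y z} → ¬ (x ≈ 0#) → x * y ≈ x * z → y ≈ z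
  *-cancelˡ-≉0 {x} {y} {z} x≉0 eq = begin
    y              ≈⟨ *-identityˡ y ⟨
    1# * y         ≈⟨ *-congʳ (trans (*-comm x⁻¹ x) xx⁻¹) ⟨
    x⁻¹ * x * y    ≈⟨ *-assoc _ _ _ ⟩
    x⁻¹ * (x * y)  ≈⟨ *-congˡ eq ⟩
    x⁻¹ * (x * z)  ≈⟨ *-assoc _ _ _ ⟨
    x⁻¹ * x * z    ≈⟨ *-congʳ (trans (*-comm x⁻¹ x) xx⁻¹) ⟩
    1# * z         ≈⟨ *-identityˡ z ⟩
    z              ∎
    where
    x⁻¹ = proj₁ (inverse x x≉0)
    xx⁻¹ = proj₂ (inverse x x≉0)

  xy≈0⇒y≈0 : ∀ {x y} → ¬ (x ≈ 0#) → x * y ≈ 0# → y ≈ 0#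
  xy≈0⇒y≈0 {x} x≉0 eq = *-cancelˡ-≉0 x≉0 (trans eq (sym (zeroʳ x)))

  *-≉0 : ∀ {x y} → ¬ (x ≈ 0#) → ¬ (y ≈ 0#) → ¬ (x * y ≈ 0#)
  *-≉0 x≉0 y≉0 eq = y≉0 (xy≈0⇒y≈0 x≉0 eq)

  xy≈1⇒x≉0 : ∀ {x y} → x * y ≈ 1# → ¬ (x ≈ 0#)
  xy≈1⇒x≉0 {x} {y} xy≈1 x≈0 = 1≉0 (trans (sym xy≈1) (trans (*-congʳ x≈0) (zeroˡ y)))

  x^n≈0⇒x≈0 : ∀ x n → x ^ n ≈ 0# → x ≈ 0#
  x^n≈0⇒x≈0 x zero    eq = ⊥-elim (1≉0 eq)
  x^n≈0⇒x≈0 x (suc n) eq with x ≟ 0#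
  ... | yes x≈0 = x≈0
  ... | no  x≉0 = x^n≈0⇒x≈0 x n (xy≈0⇒y≈0 x≉0 eq)

  Distinct : ∀ {d} → (Fin d → Carrier) → Set ℓ
  Distinct f = ∀ {i j} → f i ≈ f j → i ≡ j

  -- The vector a₀ ∷ … ∷ a_{d-1} stands for a₀ + … + a_{d-1} x^{d-1} + x^d.
  monic : ∀ {d} → Vec Carrier d → Carrier → Carrier
  monic []      x = 1#
  monic (a ∷ v) x = a + x * monic v x

  -- Synthetic division by x - r: the entries are the values at r of the tails, that is, the
  -- intermediate results of Horner's scheme.
  divide : ∀ {d} → Carrier → Vec Carrier (suc d) → Vec Carrier d
  divide r (a ∷ [])        = []
  divide r (a ∷ v@(_ ∷ _)) = monic v r ∷ divide r v

  -- V(x) − V(r) = (x − r) W(x), rearranged so that no subtraction occurs.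
  monic-divide : ∀ {d} (v : Vec Carrier (suc d)) r x →
                 monic v x + r * monic (divide r v) x ≈ monic v r + x * monic (divide r v) x
  monic-divide (a ∷ []) r x =
    solve 4 (λ a r x o → ((a ⊕ (x ⊗ o)) ⊕ (r ⊗ o)) ⊜ ((a ⊕ (r ⊗ o)) ⊕ (x ⊗ o))) refl a r x 1#
  monic-divide (a ∷ v@(_ ∷ _)) r x = begin
    (a + x * V x) + r * (V r + x * W)    ≈⟨ solve 6 (λ a r x p q w → ((a ⊕ (x ⊗ p)) ⊕ (r ⊗ (q ⊕ (x ⊗ w)))) ⊜ ((a ⊕ (r ⊗ q)) ⊕ (x ⊗ (p ⊕ (r ⊗ w))))) refl a r x (V x) (V r) W ⟩
    (a + r * V r) + x * (V x + r * W)    ≈⟨ +-congˡ (*-congˡ (monic-divide v r x)) ⟩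
    (a + r * V r) + x * (V r + x * W)    ∎
    where
    V = monic v
    W = monic (divide r v) x

  quotient-cong : ∀ {d} (v w : Vec Carrier (suc d)) r x → ¬ (x ≈ r) →
                  monic v x ≈ monic w x → monic v r ≈ monic w r →
                  monic (divide r v) x ≈ monic (divide r w) x
  -- With P and Q the two quotients, (x - r) P = (x - r) Q is proved after adding V(r) + rP + rQ to
  -- both sides, so that the subtraction-free `monic-divide` applies to each.
  quotient-cong v w r x x≉r eqx eqr = *-cancelˡ-≉0 (x≉r ∘ x-y≈0⇒x≈y) (+-cancelˡ (monic v r + r * P + r * Q) _ _ (begin
    monic v r + r * P + r * Q + (x - r) * P    ≈⟨ shuffle (monic v r) r x P Q ⟩
    (monic v r + x * P) + r * Q                ≈⟨ +-congʳ (monic-divide v r x) ⟨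
    (monic v x + r * P) + r * Q                ≈⟨ +-congʳ (+-congʳ eqx) ⟩
    (monic w x + r * P) + r * Q                ≈⟨ solve 3 (λ a b c → ((a ⊕ b) ⊕ c) ⊜ ((a ⊕ c) ⊕ b)) refl (monic w x) (r * P) (r * Q) ⟩
    (monic w x + r * Q) + r * P                ≈⟨ +-congʳ (monic-divide w r x) ⟩
    (monic w r + x * Q) + r * P                ≈⟨ +-congʳ (+-congʳ eqr) ⟨
    (monic v r + x * Q) + r * P                ≈⟨ shuffle (monic v r) r x Q P ⟨
    monic v r + r * Q + r * P + (x - r) * Q    ≈⟨ +-congʳ (solve 3 (λ a b c → ((a ⊕ b) ⊕ c) ⊜ ((a ⊕ c) ⊕ b)) refl (monic v r) (r * Q) (r * P)) ⟩
    monic v r + r * P + r * Q + (x - r) * Q    ∎))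
    where
    P = monic (divide r v) x
    Q = monic (divide r w) x
    shuffle : ∀ a r x p q → a + r * p + r * q + (x - r) * p ≈ (a + x * p) + r * q
    shuffle a r x p q = begin
      a + r * p + r * q + (x - r) * p        ≈⟨ solve 5 (λ a r y p q → (((a ⊕ (r ⊗ p)) ⊕ (r ⊗ q)) ⊕ (y ⊗ p)) ⊜ ((a ⊕ ((y ⊕ r) ⊗ p)) ⊕ (r ⊗ q))) refl a r (x - r) p q ⟩
      (a + (x - r + r) * p) + r * q          ≈⟨ +-congʳ (+-congˡ (*-congʳ (x-y+y≈x x r))) ⟩
      (a + x * p) + r * q                    ∎

  private
    ≉-suc : ∀ {d} {f : Fin (suc d) → Carrier} → Distinct f → ∀ i → ¬ (f (suc i) ≈ f zero)
    ≉-suc f-distinct i eq with () ← f-distinct eq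

    tail-distinct : ∀ {d} {f : Fin (suc d) → Carrier} → Distinct f → Distinct (f ∘ suc)
    tail-distinct f-distinct eq = Fin.suc-injective (f-distinct eq)

  -- Induction on the degree: as r = f 0 is a root, V(x) = (x - r) W(x), and W vanishes at the
  -- remaining points because they differ from r.
  roots-bounded : ∀ {d} (v : Vec Carrier d) (f : Fin (suc d) → Carrier) → Distinct f →
                  ¬ (∀ i → monic v (f i) ≈ 0#)
  roots-bounded []        f distinct roots = 1≉0 (roots zero)
  roots-bounded v@(_ ∷ _) f distinct roots =
    roots-bounded (divide r v) (f ∘ suc) (tail-distinct distinct) λ i →
      xy≈0⇒y≈0 (≉-suc distinct i ∘ x-y≈0⇒x≈y) (begin
        (f (suc i) - r) * W (f (suc i))            ≈⟨ distribʳ _ _ _ ⟩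
        f (suc i) * W (f (suc i)) + - r * W (f (suc i))  ≈⟨ +-cong (+-cancelˡ _ _ _ (trans (sym (monic-divide v r (f (suc i)))) (+-congʳ (trans (roots (suc i)) (sym (roots zero)))))) (sym (-‿distribˡ-* _ _)) ⟩
        r * W (f (suc i)) - r * W (f (suc i))      ≈⟨ -‿inverseʳ _ ⟩
        0#                                         ∎)
    where
    r = f zero
    W = monic (divide r v)

  monic-cong : ∀ {d} (v : Vec Carrier d) {x y} → x ≈ y → monic v x ≈ monic v y
  monic-cong []      x≈y = refl
  monic-cong (a ∷ v) x≈y = +-congˡ (*-cong x≈y (monic-cong v x≈y))

  infix 4 _≋_
  _≋_ : ∀ {d} → Vec Carrier d → Vec Carrier d → Set ℓ
  v ≋ w = ∀ i → Vec.lookup v i ≈ Vec.lookup w i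

  monic-≋ : ∀ {d} (v w : Vec Carrier d) → v ≋ w → ∀ x → monic v x ≈ monic w x
  monic-≋ []      []      eq x = refl
  monic-≋ (a ∷ v) (b ∷ w) eq x = +-cong (eq zero) (*-congˡ (monic-≋ v w (eq ∘ suc) x))

  -- Horner's scheme run backwards: the value at r and the entries of the quotient give back the
  -- coefficients one by one.
  divide-injective : ∀ {d} r (v w : Vec Carrier (suc d)) → monic v r ≈ monic w r →
                     divide r v ≋ divide r w → v ≋ w
  divide-injective r (a ∷ []) (b ∷ []) eq _ zero = +-cancelʳ _ _ _ eq
  divide-injective r (a ∷ v@(_ ∷ _)) (b ∷ w@(_ ∷ _)) eq eqs zero =
    +-cancelʳ _ _ _ (trans eq (+-congˡ (*-congˡ (sym (eqs zero)))))
  divide-injective r (a ∷ v@(_ ∷ _)) (b ∷ w@(_ ∷ _)) eq eqs (suc i) =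
    divide-injective r v w (eqs zero) (eqs ∘ suc) i

  -- Since the leading coefficients agree, d points suffice for degree d. Dividing both polynomials
  -- by x - f 0 keeps them monic, so no difference of polynomials has to be formed.
  monic-unique : ∀ {d} (v w : Vec Carrier d) (f : Fin d → Carrier) → Distinct f →
                 (∀ i → monic v (f i) ≈ monic w (f i)) → v ≋ w
  monic-unique v@(_ ∷ _) w@(_ ∷ _) f distinct eq =
    divide-injective r v w (eq zero)
      (monic-unique (divide r v) (divide r w) (f ∘ suc) (tail-distinct distinct) λ i →
        quotient-cong v w r (f (suc i)) (≉-suc distinct i) (eq (suc i)) (eq zero))
    where r = f zero
  monic-unique [] [] f distinct eq ()

  ∏ : ℕ → (ℕ → Carrier) → Carrier
  ∏ zero    f = 1#
  ∏ (suc n) f = ∏ n f * f n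

  ∏-cong : ∀ n {f g} → (∀ i → f i ≈ g i) → ∏ n f ≈ ∏ n g
  ∏-cong zero    eq = refl
  ∏-cong (suc n) eq = *-cong (∏-cong n eq) (eq n)

  ∏-suc : ∀ n f → f 0 * ∏ n (f ∘ suc) ≈ ∏ n f * f n
  ∏-suc zero    f = *-comm _ _
  ∏-suc (suc n) f = trans (sym (*-assoc _ _ _)) (*-congʳ (∏-suc n f))

  ∏≈0 : ∀ n f → ∏ n f ≈ 0# → ∃[ i ] (f i ≈ 0#)
  ∏≈0 zero    f eq = ⊥-elim (1≉0 eq)
  ∏≈0 (suc n) f eq with f n ≟ 0#
  ... | yes fn≈0 = n , fn≈0
  ... | no  fn≉0 = ∏≈0 n f (xy≈0⇒y≈0 fn≉0 (trans (*-comm _ _) eq))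

  private
    addHead : ∀ {d} → Carrier → Vec Carrier (suc d) → Vec Carrier (suc d)
    addHead a (b ∷ v) = (a + b) ∷ v

    monic-addHead : ∀ {d} a (v : Vec Carrier (suc d)) x → monic (addHead a v) x ≈ a + monic v x
    monic-addHead a (b ∷ v) x = +-assoc _ _ _

  -- Multiplication by x - r, from (a + x V)(x - r) = -ra + x (a + V (x - r)).
  mulRoot : ∀ {d} → Carrier → Vec Carrier d → Vec Carrier (suc d)
  mulRoot r []      = (- r) ∷ []
  mulRoot r (a ∷ v) = (- (r * a)) ∷ addHead a (mulRoot r v)

  monic-mulRoot : ∀ {d} r (v : Vec Carrier d) x → monic (mulRoot r v) x ≈ monic v x * (x - r)
  monic-mulRoot r []      x = begin
    - r + x * 1#     ≈⟨ +-congˡ (*-identityʳ x) ⟩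
    - r + x          ≈⟨ +-comm _ _ ⟩
    x - r            ≈⟨ *-identityˡ _ ⟨
    1# * (x - r)     ∎
  monic-mulRoot r (a ∷ v) x = begin
    - (r * a) + x * monic (addHead a (mulRoot r v)) x  ≈⟨ +-congˡ (*-congˡ (trans (monic-addHead a (mulRoot r v) x) (+-congˡ (monic-mulRoot r v x)))) ⟩
    - (r * a) + x * (a + monic v x * (x - r))          ≈⟨ solve 5 (λ n a y x p → (n ⊕ (x ⊗ (a ⊕ (p ⊗ y)))) ⊜ (((x ⊗ a) ⊕ n) ⊕ ((x ⊗ p) ⊗ y))) refl (- (r * a)) a (x - r) x (monic v x) ⟩
    (x * a - r * a) + x * monic v x * (x - r)          ≈⟨ +-congʳ (trans (+-congˡ (-‿distribˡ-* r a)) (trans (sym (distribʳ _ _ _)) (*-comm _ _))) ⟩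
    a * (x - r) + x * monic v x * (x - r)              ≈⟨ distribʳ _ _ _ ⟨
    (a + x * monic v x) * (x - r)                      ∎

  withRoots : ∀ n → (ℕ → Carrier) → Vec Carrier n
  withRoots zero    f = []
  withRoots (suc n) f = mulRoot (f n) (withRoots n f)

  monic-withRoots : ∀ n f x → monic (withRoots n f) x ≈ ∏ n (λ i → x - f i)
  monic-withRoots zero    f x = refl
  monic-withRoots (suc n) f x = trans (monic-mulRoot (f n) (withRoots n f) x) (*-congʳ (monic-withRoots n f x))

  monic-replicate : ∀ n x → monic (Vec.replicate n 0#) x ≈ x ^ n
  monic-replicate zero    x = refl
  monic-replicate (suc n) x = trans (+-identityˡ _) (*-congˡ (monic-replicate n x))

  -- The vector below encodes x^N - x; N ≥ 2 places the term -x under the leading one. The case N =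
  -- q singles out the subfield, the case N = qⁱ shows that a small power of σ is not the identity.
  x^N-x-roots-bounded : ∀ N → 2 ℕ.≤ N → (f : Fin (suc N) → Carrier) → Distinct f →
                        ¬ (∀ i → f i ^ N ≈ f i)
  x^N-x-roots-bounded (suc (suc N)) (s≤s (s≤s _)) f distinct eq =
    roots-bounded (0# ∷ (- 1#) ∷ Vec.replicate N 0#) f distinct λ i → begin
      0# + f i * (- 1# + f i * monic (Vec.replicate N 0#) (f i))  ≈⟨ +-identityˡ _ ⟩
      f i * (- 1# + f i * monic (Vec.replicate N 0#) (f i))       ≈⟨ *-congˡ (+-congˡ (*-congˡ (monic-replicate N (f i)))) ⟩
      f i * (- 1# + f i * f i ^ N)                                ≈⟨ distribˡ _ _ _ ⟩
      f i * - 1# + f i ^ suc (suc N)                              ≈⟨ +-cong (trans (sym (-‿distribʳ-* _ _)) (-‿cong (*-identityʳ _))) (eq i) ⟩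
      - f i + f i                                                 ≈⟨ -‿inverseˡ _ ⟩
      0#                                                          ∎

-- Divisibility of binomial coefficients

module _ where

  open import Data.Nat.Combinatorics using (_C_; nCk+nC[k+1]≡[n+1]C[k+1]; nC1≡n; k>n⇒nCk≡0)
  open import Data.Nat.Divisibility using (_∣_; ∣⇒≤; m∣m*n)
  open import Data.Nat.Primality using (Prime; euclidsLemma)
  open ≡.≡-Reasoning

  -- Induction with Pascal's rule, which avoids the division in the formula with factorials.
  C-absorption : ∀ n k → suc k ℕ.* (suc n C suc k) ≡ suc n ℕ.* (n C k)
  C-absorption zero    zero    = ≡.refl
  C-absorption zero    (suc k) = begin
    suc (suc k) ℕ.* (1 C suc (suc k))  ≡⟨ ≡.cong (suc (suc k) ℕ.*_) (k>n⇒nCk≡0 {1} {suc (suc k)} (s≤s (s≤s z≤n))) ⟩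
    suc (suc k) ℕ.* 0                  ≡⟨ ℕ.*-zeroʳ (suc (suc k)) ⟩
    0                                  ≡⟨ ≡.cong (1 ℕ.*_) (k>n⇒nCk≡0 {0} {suc k} (s≤s z≤n)) ⟨
    1 ℕ.* (0 C suc k)                  ∎
  C-absorption (suc n) zero    = ≡.trans (ℕ.*-identityˡ _) (≡.trans (nC1≡n (suc (suc n))) (≡.sym (ℕ.*-identityʳ _)))
  C-absorption (suc n) (suc k) = begin
    suc (suc k) ℕ.* (suc (suc n) C suc (suc k))
      ≡⟨ ≡.cong (suc (suc k) ℕ.*_) (nCk+nC[k+1]≡[n+1]C[k+1] (suc n) (suc k)) ⟨
    suc (suc k) ℕ.* (a ℕ.+ (suc n C suc (suc k)))
      ≡⟨ ℕ.*-distribˡ-+ (suc (suc k)) a _ ⟩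
    a ℕ.+ suc k ℕ.* a ℕ.+ suc (suc k) ℕ.* (suc n C suc (suc k))
      ≡⟨ ≡.cong₂ (λ u v → a ℕ.+ u ℕ.+ v) (C-absorption n k) (C-absorption n (suc k)) ⟩
    a ℕ.+ suc n ℕ.* (n C k) ℕ.+ suc n ℕ.* (n C suc k)
      ≡⟨ ℕ.+-assoc a _ _ ⟩
    a ℕ.+ (suc n ℕ.* (n C k) ℕ.+ suc n ℕ.* (n C suc k))
      ≡⟨ ≡.cong (a ℕ.+_) (ℕ.*-distribˡ-+ (suc n) (n C k) (n C suc k)) ⟨
    a ℕ.+ suc n ℕ.* ((n C k) ℕ.+ (n C suc k))
      ≡⟨ ≡.cong (λ u → a ℕ.+ suc n ℕ.* u) (nCk+nC[k+1]≡[n+1]C[k+1] n k) ⟩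
    suc (suc n) ℕ.* a
      ∎
    where a = suc n C suc k

  -- By absorption p divides k times the binomial coefficient, and a prime p does not divide a
  -- positive k < p.
  p∣pCk : ∀ {p k} → Prime p → 0 ℕ.< k → k ℕ.< p → p ∣ p C k
  p∣pCk {suc p} {suc k} p-prime _ k<p
    with euclidsLemma (suc k) (suc p C suc k) p-prime
           (≡.subst (suc p ∣_) (≡.sym (C-absorption p k)) (m∣m*n (p C k)))
  ... | inj₁ p∣k = ⊥-elim (ℕ.<⇒≱ k<p (∣⇒≤ p∣k))
  ... | inj₂ p∣C = p∣C

-- Additivity of the Frobenius map

module FrobeniusMap {c ℓ} (A : CommutativeRing c ℓ) where

  open CommutativeRing A hiding (zero)
  open import Algebra.Properties.CommutativeSemiring.Exp commutativeSemiring
  open import Algebra.Properties.CommutativeSemiring.Binomial commutativeSemiring using (binomialTerm; theorem)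
  open import Algebra.Properties.Semiring.Mult semiring renaming (_×_ to infixr 8 _·_)
  open import Algebra.Properties.Monoid.Sum +-monoid using (sum; sum-cong-≋; sum-init-last; sum-replicate-zero)
  open import Relation.Binary.Reasoning.Setoid setoid
  open import Data.Nat.Combinatorics using (nCn≡1)
  open import Data.Nat.Divisibility using (_∣_; divides)
  open import Data.Nat.Primality using (Prime)

  m∣n⇒n×x≈0 : ∀ {m n} → m · 1# ≈ 0# → m ∣ n → ∀ x → n · x ≈ 0#
  m∣n⇒n×x≈0 {m} m×1≈0 (divides d ≡.refl) x = begin
    (d ℕ.* m) · x          ≈⟨ ×-congʳ (d ℕ.* m) (*-identityˡ x) ⟨
    (d ℕ.* m) · (1# * x)   ≈⟨ ×-assoc-* (d ℕ.* m) 1# x ⟨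
    ((d ℕ.* m) · 1#) * x   ≈⟨ *-congʳ (×1-homo-* d m) ⟩
    (d · 1#) * (m · 1#) * x ≈⟨ *-congʳ (trans (*-congˡ m×1≈0) (zeroʳ _)) ⟩
    0# * x                 ≈⟨ zeroˡ x ⟩
    0#                     ∎

  freshman : ∀ {p} → Prime p → p · 1# ≈ 0# → ∀ x y → (x + y) ^ p ≈ x ^ p + y ^ p
  freshman {suc p} p-prime p×1≈0 x y = begin
    (x + y) ^ suc p                          ≈⟨ theorem (suc p) x y ⟩
    t zero + sum (λ i → t (suc i))           ≈⟨ +-congˡ (sum-init-last (λ i → t (suc i))) ⟩
    t zero + (sum (λ i → t (suc (Fin.inject₁ i))) + t (suc (Fin.fromℕ p)))
                                             ≈⟨ +-cong first (+-cong middle last′) ⟩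
    y ^ suc p + (0# + x ^ suc p)             ≈⟨ +-congˡ (+-identityˡ _) ⟩
    y ^ suc p + x ^ suc p                    ≈⟨ +-comm _ _ ⟩
    x ^ suc p + y ^ suc p                    ∎
    where
    t = binomialTerm x y (suc p)

    first : t zero ≈ y ^ suc p
    first = trans (×-homo-1 _) (*-identityˡ _)

    middle : sum (λ i → t (suc (Fin.inject₁ i))) ≈ 0#
    middle = trans
      (sum-cong-≋ λ i → m∣n⇒n×x≈0 p×1≈0 (p∣pCk p-prime (s≤s z≤n)
        (s≤s (≡.subst (ℕ._< p) (≡.sym (Fin.toℕ-inject₁ i)) (Fin.toℕ<n i)))) _)
      (sum-replicate-zero p)

    last′ : t (suc (Fin.fromℕ p)) ≈ x ^ suc p
    last′ rewrite Fin.toℕ-fromℕ p | nCn≡1 (suc p) | ℕ.n∸n≡0 p =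
      trans (×-homo-1 _) (*-identityʳ _)

  frobenius-+ : ∀ {p} → Prime p → p · 1# ≈ 0# → ∀ e x y →
                (x + y) ^ (p ℕ.^ e) ≈ x ^ (p ℕ.^ e) + y ^ (p ℕ.^ e)
  frobenius-+ {p} p-prime p×1≈0 zero    x y =
    trans (*-identityʳ _) (+-cong (sym (*-identityʳ _)) (sym (*-identityʳ _)))
  frobenius-+ {p} p-prime p×1≈0 (suc e) x y = begin
    (x + y) ^ (p ℕ.* p ℕ.^ e)                     ≈⟨ ^-assocʳ (x + y) p (p ℕ.^ e) ⟨
    ((x + y) ^ p) ^ (p ℕ.^ e)                     ≈⟨ ^-congˡ (p ℕ.^ e) (freshman p-prime p×1≈0 x y) ⟩
    (x ^ p + y ^ p) ^ (p ℕ.^ e)                   ≈⟨ frobenius-+ p-prime p×1≈0 e _ _ ⟩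
    (x ^ p) ^ (p ℕ.^ e) + (y ^ p) ^ (p ℕ.^ e)     ≈⟨ +-cong (^-assocʳ x p (p ℕ.^ e)) (^-assocʳ y p (p ℕ.^ e)) ⟩
    x ^ (p ℕ.* p ℕ.^ e) + y ^ (p ℕ.* p ℕ.^ e)     ∎

-- Counting in a finite field: the characteristic and Fermat's theorem

module FiniteField {c ℓ} (A : CommutativeRing c ℓ) (isField : IsDiscreteField A)
  (Q : ℕ) (card : Inverse (≡.setoid (Fin Q)) (CommutativeRing.setoid A)) where

  open CommutativeRing A hiding (zero)
  open DiscreteField A isField hiding (_^_; ^-congˡ)
  open import Algebra.Properties.CommutativeSemiring.Exp commutativeSemiring
  open import Algebra.Properties.Semiring.Mult semiring renaming (_×_ to infixr 8 _·_)
  open import Relation.Binary.Reasoning.Setoid setoid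
  open import Data.Fin.Permutation using (Permutation; permutation)
  import Algebra.Properties.CommutativeMonoid.Sum as Sum
  open import Data.Vec.Functional using (replicate; removeAt)

  element : Fin Q → Carrier
  element = Inverse.to card

  index : Carrier → Fin Q
  index = Inverse.from card

  element-index : ∀ x → element (index x) ≈ x
  element-index x = Inverse.strictlyInverseˡ card x

  index-element : ∀ i → index (element i) ≡ i
  index-element = Inverse.strictlyInverseʳ card

  index-cong : ∀ {x y} → x ≈ y → index x ≡ index y
  index-cong = Inverse.from-cong card

  element-distinct : Distinct element
  element-distinct {i} {j} eq = ≡.trans (≡.sym (index-element i)) (≡.trans (index-cong eq) (index-element j))

  module _ (φ ψ : Carrier → Carrier)
    (φ-cong : ∀ {x y} → x ≈ y → φ x ≈ φ y) (ψ-cong : ∀ {x y} → x ≈ y → ψ x ≈ ψ y)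
    (φψ : ∀ x → φ (ψ x) ≈ x) (ψφ : ∀ x → ψ (φ x) ≈ x) where

    -- Turns a bijection of the field into a permutation of the indices, so that sums and products
    -- over all elements are invariant under it.
    reindexing : Permutation Q Q
    reindexing = permutation (index ∘ φ ∘ element) (index ∘ ψ ∘ element)
      (λ i → ≡.trans (index-cong (trans (φ-cong (element-index _)) (φψ _))) (index-element i))
      (λ i → ≡.trans (index-cong (trans (ψ-cong (element-index _)) (ψφ _))) (index-element i))

  -- Translation by 1 permutes the elements; their sum therefore equals itself plus Q times 1.
  card×1≈0 : Q · 1# ≈ 0#
  card×1≈0 = +-cancelˡ (sum element) _ _ (begin
    sum element + Q · 1#                       ≈⟨ +-congˡ (sum-replicate Q) ⟨
    sum element + sum (replicate Q 1#)         ≈⟨ ∑-distrib-+ element (replicate Q 1#) ⟨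
    sum (λ i → element i + 1#)                 ≈⟨ sum-cong-≋ (λ i → element-index (element i + 1#)) ⟨
    sum (λ i → element (index (element i + 1#))) ≈⟨ sum-permute element shift ⟨
    sum element                                ≈⟨ +-identityʳ _ ⟨
    sum element + 0#                           ∎)
    where
    open Sum +-commutativeMonoid
    shift = reindexing (_+ 1#) (_- 1#) +-congʳ +-congʳ
      (λ x → x-y+y≈x x 1#)
      (λ x → trans (+-assoc _ _ _) (trans (+-congˡ (-‿inverseʳ 1#)) (+-identityʳ x)))

  -- Multiplication by x ≠ 0 permutes the nonzero elements; 0 contributes the
  -- factor 1 to the products below.
  fermat : ∀ x → x ^ Q ≈ x
  fermat x with x ≟ 0#
  ... | yes x≈0 = zero-power Q (index 0#)
    where
    zero-power : ∀ N → Fin N → x ^ N ≈ x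
    zero-power (suc N) _ = trans (*-congʳ x≈0) (trans (zeroˡ _) (sym x≈0))
  ... | no  x≉0 = trans (count Q element (index 0#) (element-index 0#)
                           (λ i eq → ≡.trans (≡.sym (index-element i)) (index-cong eq)))
                        (trans (*-congˡ quotient≈1) (*-identityʳ x))
    where
    open Sum *-commutativeMonoid renaming (sum to prod)
    x⁻¹ = proj₁ (inverse x x≉0)
    xx⁻¹≈1 = proj₂ (inverse x x≉0)

    nz : Carrier → Carrier → Carrier
    nz a y with y ≟ 0#
    ... | yes _ = 1#
    ... | no  _ = a

    nz-zero : ∀ a {y} → y ≈ 0# → nz a y ≈ 1#
    nz-zero a {y} y≈0 with y ≟ 0#
    ... | yes _   = refl
    ... | no  y≉0 = ⊥-elim (y≉0 y≈0)

    nz-nonzero : ∀ a {y} → ¬ (y ≈ 0#) → nz a y ≈ a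
    nz-nonzero a {y} y≉0 with y ≟ 0#
    ... | yes y≈0 = ⊥-elim (y≉0 y≈0)
    ... | no  _   = refl

    nz≉0 : ∀ {a y} → (¬ (y ≈ 0#) → ¬ (a ≈ 0#)) → ¬ (nz a y ≈ 0#)
    nz≉0 {a} {y} h with y ≟ 0#
    ... | yes _   = 1≉0
    ... | no  y≉0 = h y≉0

    nz-cong : ∀ {y z} → y ≈ z → nz y y ≈ nz z z
    nz-cong {y} {z} y≈z with y ≟ 0# | z ≟ 0#
    ... | yes _   | yes _   = refl
    ... | yes y≈0 | no  z≉0 = ⊥-elim (z≉0 (trans (sym y≈z) y≈0))
    ... | no  y≉0 | yes z≈0 = ⊥-elim (y≉0 (trans y≈z z≈0))
    ... | no  _   | no  _   = y≈z

    nz-* : ∀ y → nz (x * y) (x * y) ≈ nz x y * nz y y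
    nz-* y with y ≟ 0#
    ... | yes y≈0 = trans (nz-zero (x * y) (trans (*-congˡ y≈0) (zeroʳ x))) (sym (*-identityˡ 1#))
    ... | no  y≉0 = nz-nonzero (x * y) (*-≉0 x≉0 y≉0)

    prod≉0 : ∀ N (f : Fin N → Carrier) → (∀ i → ¬ (f i ≈ 0#)) → ¬ (prod f ≈ 0#)
    prod≉0 zero    f f≉0 = 1≉0
    prod≉0 (suc N) f f≉0 = *-≉0 (f≉0 zero) (prod≉0 N (f ∘ suc) (f≉0 ∘ suc))

    scale = reindexing (x *_) (x⁻¹ *_) *-congˡ *-congˡ
      (λ y → trans (sym (*-assoc _ _ _)) (trans (*-congʳ xx⁻¹≈1) (*-identityˡ y)))
      (λ y → trans (sym (*-assoc _ _ _)) (trans (*-congʳ (trans (*-comm _ _) xx⁻¹≈1)) (*-identityˡ y)))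

    -- Scaling by x permutes the nonzero elements, so their product Π satisfies Π x^(Q-1) = Π, and Π
    -- is not 0.
    quotient≈1 : prod (λ i → nz x (element i)) ≈ 1#
    quotient≈1 = *-cancelˡ-≉0 (prod≉0 Q (λ i → nz (element i) (element i)) (λ i → nz≉0 (λ h → h))) (begin
      prod (λ i → nz (element i) (element i)) * prod (λ i → nz x (element i))
        ≈⟨ *-comm _ _ ⟩
      prod (λ i → nz x (element i)) * prod (λ i → nz (element i) (element i))
        ≈⟨ ∑-distrib-+ (λ i → nz x (element i)) (λ i → nz (element i) (element i)) ⟨
      prod (λ i → nz x (element i) * nz (element i) (element i))
        ≈⟨ sum-cong-≋ (λ i → trans (nz-cong (element-index (x * element i))) (nz-* (element i))) ⟨
      prod (λ i → nz (element (index (x * element i))) (element (index (x * element i))))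
        ≈⟨ sum-permute (λ i → nz (element i) (element i)) scale ⟨
      prod (λ i → nz (element i) (element i))
        ≈⟨ *-identityʳ _ ⟨
      prod (λ i → nz (element i) (element i)) * 1#
        ∎)

    -- Exactly one of the N indices belongs to 0 and contributes the factor 1; the factor x in front
    -- makes up for it.
    count : ∀ N (f : Fin N → Carrier) i₀ → f i₀ ≈ 0# → (∀ i → f i ≈ 0# → i ≡ i₀) →
            x ^ N ≈ x * prod (λ i → nz x (f i))
    count (suc N) f i₀ fi₀≈0 only = *-congˡ (sym (begin
      prod (λ i → nz x (f i))                            ≈⟨ sum-remove {i = i₀} (λ i → nz x (f i)) ⟩
      nz x (f i₀) * prod (removeAt (λ i → nz x (f i)) i₀) ≈⟨ *-congʳ (nz-zero x fi₀≈0) ⟩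
      1# * prod (removeAt (λ i → nz x (f i)) i₀)         ≈⟨ *-identityˡ _ ⟩
      prod (removeAt (λ i → nz x (f i)) i₀)              ≈⟨ sum-cong-≋ (λ j → nz-nonzero x (λ eq → Fin.punchInᵢ≢i i₀ j (only _ eq))) ⟩
      prod (replicate N x)                               ≈⟨ sum-replicate N ⟩
      x ^ N                                              ∎))

-- Iterates and ring endomorphisms

infixl 8 _^∘_
_^∘_ : ∀ {a} {S : Set a} → (S → S) → ℕ → S → S
(f ^∘ n) x = fold x f n

^∘-+ : ∀ {a} {S : Set a} (f : S → S) i j x → (f ^∘ (i ℕ.+ j)) x ≡ (f ^∘ i) ((f ^∘ j) x)
^∘-+ f i j x = fold-+ x f i

^∘-* : ∀ {a} {S : Set a} (f : S → S) i j x → (f ^∘ (i ℕ.* j)) x ≡ ((f ^∘ j) ^∘ i) x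
^∘-* f zero    j x = ≡.refl
^∘-* f (suc i) j x = ≡.trans (^∘-+ f j (i ℕ.* j) x) (≡.cong (f ^∘ j) (^∘-* f i j x))

module RingEndomorphism {c ℓ} (A : CommutativeRing c ℓ)
  (φ : CommutativeRing.Carrier A → CommutativeRing.Carrier A)
  (isHom : IsRingHomomorphism (CommutativeRing.rawRing A) (CommutativeRing.rawRing A) φ) where

  open CommutativeRing A hiding (zero)
  open IsRingHomomorphism isHom
  open import Algebra.Properties.CommutativeSemiring.Exp commutativeSemiring

  homo-- : ∀ x y → φ (x - y) ≈ φ x - φ y
  homo-- x y = trans (+-homo x (- y)) (+-congˡ (-‿homo y))

  homo-^ : ∀ x n → φ (x ^ n) ≈ φ x ^ n
  homo-^ x zero    = 1#-homo
  homo-^ x (suc n) = trans (*-homo x (x ^ n)) (*-congˡ (homo-^ x n))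

  ^∘-cong : ∀ i {x y} → x ≈ y → (φ ^∘ i) x ≈ (φ ^∘ i) y
  ^∘-cong zero    x≈y = x≈y
  ^∘-cong (suc i) x≈y = ⟦⟧-cong (^∘-cong i x≈y)

  module _ (isField : IsDiscreteField A) where
    open DiscreteField A isField hiding (_^_; ^-congˡ)

    homo-monic : ∀ {d} (v : Vec Carrier d) y → φ (monic v y) ≈ monic (Vec.map φ v) (φ y)
    homo-monic []      y = 1#-homo
    homo-monic (a ∷ v) y = trans (+-homo _ _) (+-congˡ (trans (*-homo _ _) (*-congˡ (homo-monic v y))))

    homo-∏ : ∀ n f → φ (∏ n f) ≈ ∏ n (φ ∘ f)
    homo-∏ zero    f = 1#-homo
    homo-∏ (suc n) f = trans (*-homo _ _) (*-congʳ (homo-∏ n f))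

-- Finite Heyting fields as discrete fields

module HeytingFieldProperties {c ℓ a} (K : HeytingField c ℓ a) (Q : ℕ) (card : HasCardinality K Q) where

  open HeytingField K hiding (zero)

  commutativeRing : CommutativeRing c ℓ
  commutativeRing = HeytingCommutativeRing.commutativeRing heytingCommutativeRing

  private
    element = Inverse.to card
    index   = Inverse.from card

    module A = CommutativeRing commutativeRing
    open import Algebra.Properties.Ring A.ring using (-0#≈0#)

    _≟′_ : Decidable _≈_
    x ≟′ y with index x Fin.≟ index y
    ... | yes eq = yes (trans (sym (Inverse.strictlyInverseˡ card x))
                         (trans (reflexive (≡.cong element eq)) (Inverse.strictlyInverseˡ card y)))
    ... | no neq = no (neq ∘ Inverse.from-cong card)

    x-0≈x : ∀ x → x - 0# ≈ x
    x-0≈x x = trans (+-congˡ -0#≈0#) (+-identityʳ x)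

  isDiscreteField : IsDiscreteField commutativeRing
  isDiscreteField = record
    { _≟_     = _≟′_
    ; 1≉0     = λ 1≈0 → proj₂ (tight 1# 0#) 1≈0
                  (invertible⇒# (1# , trans (*-identityˡ _) (x-0≈x 1#) , trans (*-identityʳ _) (x-0≈x 1#)))
    ; inverse = inv
    }
    where
    -- From x ≉ 0 tightness yields only the double negation of x # 0. The inverse is therefore
    -- searched among the finitely many elements, and an unsuccessful search refutes x # 0.
    inv : ∀ x → ¬ (x ≈ 0#) → ∃[ y ] (x * y ≈ 1#)
    inv x x≉0 with Fin.any? (λ i → (x * element i) ≟′ 1#)
    ... | yes (i , eq) = element i , eq
    ... | no  none     = ⊥-elim (x≉0 (proj₁ (tight x 0#) λ x#0 →
      let y , _ , xy≈1 = #⇒invertible x#0 in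
      none (index y , trans (*-cong (sym (x-0≈x x)) (Inverse.strictlyInverseˡ card y)) xy≈1)))

  2≤card : 2 ℕ.≤ Q
  2≤card = go Q (index 0#) (index 1#) (λ eq → IsDiscreteField.1≉0 isDiscreteField
    (trans (sym (Inverse.strictlyInverseˡ card 1#))
      (trans (reflexive (≡.cong element (≡.sym eq))) (Inverse.strictlyInverseˡ card 0#))))
    where
    go : ∀ N (i j : Fin N) → ¬ (i ≡ j) → 2 ℕ.≤ N
    go (suc zero)    zero zero i≢j = ⊥-elim (i≢j ≡.refl)
    go (suc (suc N)) i    j    i≢j = s≤s (s≤s z≤n)

-- The Galois group: σ has order exactly n

m<n^m : ∀ n m → 2 ℕ.≤ n → m ℕ.< n ℕ.^ m
m<n^m n zero    2≤n = s≤s z≤n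
m<n^m n (suc m) 2≤n = begin
  suc (suc m)              ≤⟨ ℕ.+-mono-≤ (ℕ.≤-trans (s≤s z≤n) m<nm) m<nm ⟩
  n ℕ.^ m ℕ.+ n ℕ.^ m      ≡⟨ ≡.cong (n ℕ.^ m ℕ.+_) (ℕ.+-identityʳ _) ⟨
  2 ℕ.* n ℕ.^ m            ≤⟨ ℕ.*-monoˡ-≤ (n ℕ.^ m) 2≤n ⟩
  n ℕ.* n ℕ.^ m            ∎
  where
  open ℕ.≤-Reasoning
  m<nm = m<n^m n m 2≤n

module GaloisGroup {c₁ ℓ₁ a₁ c₂ ℓ₂ a₂}
  (q n : ℕ) (q-primePower : PrimePower q) (0<n : 0 ℕ.< n)
  (k : HeytingField c₁ ℓ₁ a₁) (K : HeytingField c₂ ℓ₂ a₂)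
  (card-k : HasCardinality k q) (card-K : HasCardinality K (q ℕ.^ n))
  (ι : HeytingField.Carrier k → HeytingField.Carrier K)
  (isExtension : Galois.IsFieldExtension k K ι)
  (σ : HeytingField.Carrier K → HeytingField.Carrier K)
  (isGenerator : Galois.IsGaloisGenerator k K ι σ) where

  open HeytingFieldProperties
  private
    module k = CommutativeRing (commutativeRing k q card-k)
    module FK = FiniteField (commutativeRing K (q ℕ.^ n) card-K) (isDiscreteField K (q ℕ.^ n) card-K) (q ℕ.^ n) card-K
    module Fk = FiniteField (commutativeRing k q card-k) (isDiscreteField k q card-k) q card-k
    open Galois k K ι

  open CommutativeRing (commutativeRing K (q ℕ.^ n) card-K) hiding (zero; rawRing)
  open import Algebra.Properties.CommutativeSemiring.Exp commutativeSemiring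
  open import Algebra.Properties.Semiring.Exp k.semiring using () renaming (_^_ to _^ₖ_)
  open import Algebra.Properties.Semiring.Mult semiring renaming (_×_ to infixr 8 _·_)
  open DiscreteField (commutativeRing K (q ℕ.^ n) card-K) (isDiscreteField K (q ℕ.^ n) card-K)
    hiding (_^_; ^-congˡ; ^-assocʳ; ^-congʳ)
  open FrobeniusMap (commutativeRing K (q ℕ.^ n) card-K)
  open IsGaloisGenerator isGenerator
  open import Relation.Binary.Reasoning.Setoid setoid

  isHomomorphism : IsRingHomomorphism (rawRing K) (rawRing K) σ
  isHomomorphism = IsRingIsomorphism.isRingHomomorphism (IsGaloisAutomorphism.isRingIsomorphism isGaloisAutomorphism)

  private
    module ι = IsRingMonomorphism isExtension
    module σ where
      open IsRingHomomorphism isHomomorphism public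
      open RingEndomorphism (commutativeRing K (q ℕ.^ n) card-K) σ isHomomorphism public

    2≤q = 2≤card k q card-k

    frobenius : Carrier → Carrier
    frobenius x = x ^ q

    frobenius-homo-+ : ∀ x y → frobenius (x + y) ≈ frobenius x + frobenius y
    frobenius-homo-+ = ≡.subst (λ N → ∀ x y → (x + y) ^ N ≈ x ^ N + y ^ N) (≡.sym q≡pᵉ) (frobenius-+ p-prime p·1≈0 e)
      where
      p = proj₁ q-primePower
      e = proj₁ (proj₂ q-primePower)
      p-prime = proj₁ (proj₂ (proj₂ q-primePower))
      q≡pᵉ = proj₂ (proj₂ (proj₂ (proj₂ q-primePower)))
      p·1^ : ∀ N → (p ℕ.^ N) · 1# ≈ (p · 1#) ^ N
      p·1^ zero    = +-identityʳ _
      p·1^ (suc N) = trans (×1-homo-* p (p ℕ.^ N)) (*-congˡ (p·1^ N))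
      -- K has qⁿ = p^{en} elements, so (p · 1)^{en} = 0, and a field has no nilpotent elements.
      p·1≈0 : p · 1# ≈ 0#
      p·1≈0 = x^n≈0⇒x≈0 (p · 1#) (e ℕ.* n) (begin
        (p · 1#) ^ (e ℕ.* n)        ≈⟨ p·1^ (e ℕ.* n) ⟨
        (p ℕ.^ (e ℕ.* n)) · 1#      ≈⟨ ×-congˡ (≡.trans (≡.sym (ℕ.^-*-assoc p e n)) (≡.cong (ℕ._^ n) (≡.sym q≡pᵉ))) ⟩
        (q ℕ.^ n) · 1#              ≈⟨ FK.card×1≈0 ⟩
        0#                          ∎)

    0^q≈0 : frobenius 0# ≈ 0#
    0^q≈0 = 0^ q (ℕ.≤-trans (s≤s z≤n) 2≤q)
      where
      0^ : ∀ N → 0 ℕ.< N → 0# ^ N ≈ 0#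
      0^ (suc N) _ = zeroˡ _

    frobenius-homo-neg : ∀ x → frobenius (- x) ≈ - frobenius x
    frobenius-homo-neg x = +-cancelʳ _ _ _ (begin
      frobenius (- x) + frobenius x   ≈⟨ frobenius-homo-+ (- x) x ⟨
      frobenius (- x + x)             ≈⟨ ^-congˡ q (-‿inverseˡ x) ⟩
      frobenius 0#                    ≈⟨ 0^q≈0 ⟩
      0#                              ≈⟨ -‿inverseˡ _ ⟨
      - frobenius x + frobenius x     ∎)

    1^ : ∀ N → 1# ^ N ≈ 1#
    1^ zero    = refl
    1^ (suc N) = trans (*-identityˡ _) (1^ N)

    frobenius-isHomomorphism : IsRingHomomorphism (rawRing K) (rawRing K) frobenius
    frobenius-isHomomorphism = record
      { isSemiringHomomorphism = record
        { isNearSemiringHomomorphism = record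
          { +-isMonoidHomomorphism = record
            { isMagmaHomomorphism = record
              { isRelHomomorphism = record { cong = ^-congˡ q }
              ; homo = frobenius-homo-+
              }
            ; ε-homo = 0^q≈0
            }
          ; *-homo = λ x y → ^-distrib-* x y q
          }
        ; 1#-homo = 1^ q
        }
      ; -‿homo = frobenius-homo-neg
      }

    module Φ = RingEndomorphism (commutativeRing K (q ℕ.^ n) card-K) frobenius frobenius-isHomomorphism

    frobenius-^∘ : ∀ i x → (frobenius ^∘ i) x ≈ x ^ (q ℕ.^ i)
    frobenius-^∘ zero    x = sym (*-identityʳ x)
    frobenius-^∘ (suc i) x = begin
      ((frobenius ^∘ i) x) ^ q   ≈⟨ ^-congˡ q (frobenius-^∘ i x) ⟩
      (x ^ (q ℕ.^ i)) ^ q        ≈⟨ ^-assocʳ x (q ℕ.^ i) q ⟩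
      x ^ (q ℕ.^ i ℕ.* q)        ≈⟨ ^-congʳ x (ℕ.*-comm (q ℕ.^ i) q) ⟩
      x ^ (q ℕ.* q ℕ.^ i)        ∎

    frobenius-order : ∀ x → (frobenius ^∘ n) x ≈ x
    frobenius-order x = trans (frobenius-^∘ n x) (FK.fermat x)

    frobenius-onto : ∀ y → frobenius ((frobenius ^∘ ℕ.pred n) y) ≈ y
    frobenius-onto y = ≡.subst (λ N → (frobenius ^∘ N) y ≈ y) (≡.sym (ℕ.suc-pred n {{ℕ.>-nonZero 0<n}})) (frobenius-order y)

    ι-^ : ∀ x N → ι (x ^ₖ N) ≈ ι x ^ N
    ι-^ x zero    = ι.1#-homo
    ι-^ x (suc N) = trans (ι.*-homo x (x ^ₖ N)) (*-congˡ (ι-^ x N))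

    frobenius-ι : ∀ x → frobenius (ι x) ≈ ι x
    frobenius-ι x = trans (sym (ι-^ x q)) (ι.⟦⟧-cong (Fk.fermat x))

    -- The q elements of the image of ι are already roots of x^q - x; a further fixed element would
    -- be one root too many.
    fixed⇒ι : ∀ y → frobenius y ≈ y → ∃[ x ] (y ≈ ι x)
    fixed⇒ι y y^q≈y with Fin.any? (λ i → y ≟ ι (Fk.element i))
    ... | yes (i , eq) = Fk.element i , eq
    ... | no  none     = ⊥-elim (x^N-x-roots-bounded q 2≤q points points-distinct roots)
      where
      points : Fin (suc q) → Carrier
      points zero    = y
      points (suc i) = ι (Fk.element i)
      points-distinct : Distinct points
      points-distinct {zero}  {zero}  eq = ≡.refl
      points-distinct {zero}  {suc j} eq = ⊥-elim (none (j , eq))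
      points-distinct {suc i} {zero}  eq = ⊥-elim (none (i , sym eq))
      points-distinct {suc i} {suc j} eq = ≡.cong suc (Fk.element-distinct (ι.injective eq))
      roots : ∀ i → points i ^ q ≈ points i
      roots zero    = y^q≈y
      roots (suc i) = frobenius-ι (Fk.element i)

    frobenius-isGaloisAutomorphism : IsGaloisAutomorphism frobenius
    frobenius-isGaloisAutomorphism = record
      { isRingIsomorphism = record
        { isRingMonomorphism = record
          { isRingHomomorphism = frobenius-isHomomorphism
          ; injective = λ {x} {y} eq → x-y≈0⇒x≈y (x^n≈0⇒x≈0 (x - y) q
              (trans (Φ.homo-- x y) (x≈y⇒x-y≈0 eq)))
          }
        ; surjective = λ y → (frobenius ^∘ ℕ.pred n) y ,
            λ z≈ → trans (^-congˡ q z≈) (frobenius-onto y)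
        }
      ; fixes = frobenius-ι
      }

    m = proj₁ (generates frobenius frobenius-isGaloisAutomorphism)

    frobenius≈σ^m : ∀ x → frobenius x ≈ (σ ^∘ m) x
    frobenius≈σ^m x = trans (proj₂ (generates frobenius frobenius-isGaloisAutomorphism) x)
      (reflexive (≡.sym (iterate-is-fold x σ m)))

    module _ (x : Carrier) where
      conjugates : ℕ → Carrier
      conjugates i = (frobenius ^∘ i) x

      v = withRoots n conjugates

      private
        ∏-rotate : ∀ N → conjugates N ≈ x → ∀ y →
                   ∏ N (λ i → y - conjugates (suc i)) ≈ ∏ N (λ i → y - conjugates i)
        ∏-rotate zero    _   y = refl
        ∏-rotate (suc N) x≈x y = begin
          ∏ N (λ i → y - conjugates (suc i)) * (y - conjugates (suc N))  ≈⟨ *-comm _ _ ⟩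
          (y - conjugates (suc N)) * ∏ N (λ i → y - conjugates (suc i))  ≈⟨ *-congʳ (+-congˡ (-‿cong x≈x)) ⟩
          (y - x) * ∏ N (λ i → y - conjugates (suc i))                   ≈⟨ ∏-suc N (λ i → y - conjugates i) ⟩
          ∏ (suc N) (λ i → y - conjugates i)                             ∎

        -- At y = z^q the polynomial with Frobenius applied to its coefficients takes the q-th power
        -- of the value of v at z. This only rotates the roots x, x^q, ..., since x^{qⁿ} = x. So the
        -- two polynomials agree on all of K, and K has at least n elements.
        v-frobenius-invariant : Vec.map frobenius v ≋ v
        v-frobenius-invariant = monic-unique (Vec.map frobenius v) v points
          (λ eq → Fin.inject≤-injective n≤qⁿ n≤qⁿ _ _ (FK.element-distinct eq))
          (λ i → at (points i))
          where
          n≤qⁿ = ℕ.<⇒≤ (m<n^m q n 2≤q)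
          points = λ i → FK.element (Fin.inject≤ i n≤qⁿ)
          at : ∀ y → monic (Vec.map frobenius v) y ≈ monic v y
          at y = begin
            monic (Vec.map frobenius v) y                ≈⟨ monic-cong (Vec.map frobenius v) (frobenius-onto y) ⟨
            monic (Vec.map frobenius v) (frobenius z)    ≈⟨ Φ.homo-monic (isDiscreteField K _ card-K) v z ⟨
            frobenius (monic v z)                        ≈⟨ ^-congˡ q (monic-withRoots n conjugates z) ⟩
            frobenius (∏ n (λ i → z - conjugates i))     ≈⟨ Φ.homo-∏ (isDiscreteField K _ card-K) n _ ⟩
            ∏ n (λ i → frobenius (z - conjugates i))     ≈⟨ ∏-cong n (λ i → trans (Φ.homo-- _ _) (+-congʳ (frobenius-onto y))) ⟩
            ∏ n (λ i → y - conjugates (suc i))           ≈⟨ ∏-rotate n (frobenius-order x) y ⟩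
            ∏ n (λ i → y - conjugates i)                 ≈⟨ monic-withRoots n conjugates y ⟨
            monic v y                                    ∎
            where z = (frobenius ^∘ ℕ.pred n) y

        v-σ-invariant : Vec.map σ v ≋ v
        v-σ-invariant i = begin
          Vec.lookup (Vec.map σ v) i   ≡⟨ Vec.lookup-map i σ v ⟩
          σ (Vec.lookup v i)           ≈⟨ σ.⟦⟧-cong vᵢ≈ιa ⟩
          σ (ι a)                      ≈⟨ IsGaloisAutomorphism.fixes isGaloisAutomorphism a ⟩
          ι a                          ≈⟨ vᵢ≈ιa ⟨
          Vec.lookup v i               ∎
          where
          vᵢ∈k = fixed⇒ι (Vec.lookup v i)
            (trans (reflexive (≡.sym (Vec.lookup-map i frobenius v))) (v-frobenius-invariant i))
          a = proj₁ vᵢ∈k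
          vᵢ≈ιa = proj₂ vᵢ∈k

        v-root-σx : monic v (σ x) ≈ 0#
        v-root-σx = begin
          monic v (σ x)                       ≈⟨ monic-≋ (Vec.map σ v) v v-σ-invariant (σ x) ⟨
          monic (Vec.map σ v) (σ x)           ≈⟨ σ.homo-monic (isDiscreteField K _ card-K) v x ⟨
          σ (monic v x)                       ≈⟨ σ.⟦⟧-cong (monic-withRoots n conjugates x) ⟩
          σ (∏ n (λ i → x - conjugates i))    ≈⟨ σ.⟦⟧-cong (root n 0<n) ⟩
          σ 0#                                ≈⟨ σ.0#-homo ⟩
          0#                                  ∎
          where
          root : ∀ N → 0 ℕ.< N → ∏ N (λ i → x - conjugates i) ≈ 0#
          root (suc N) _ = trans (sym (∏-suc N (λ i → x - conjugates i)))
            (trans (*-congʳ (-‿inverseʳ x)) (zeroˡ _))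

      -- The exponent i depends on x: it is not yet known that σ itself is a power of Frobenius.
      -- Hence `σ-order` works with one element at a time.
      σ-conjugate : ∃[ i ] (σ x ≈ (frobenius ^∘ i) x)
      σ-conjugate =
        let i , eq = ∏≈0 n (λ i → σ x - conjugates i) (trans (sym (monic-withRoots n conjugates (σ x))) v-root-σx)
        in i , x-y≈0⇒x≈y eq

    σ-commutes : ∀ i x → σ ((frobenius ^∘ i) x) ≈ (frobenius ^∘ i) (σ x)
    σ-commutes zero    x = refl
    σ-commutes (suc i) x = trans (σ.homo-^ _ q) (^-congˡ q (σ-commutes i x))

  σ-order : ∀ x → (σ ^∘ n) x ≈ x
  σ-order x = begin
    (σ ^∘ n) x                    ≈⟨ powers n ⟩
    (frobenius ^∘ (n ℕ.* i)) x    ≡⟨ ≡.cong (λ N → (frobenius ^∘ N) x) (ℕ.*-comm n i) ⟩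
    (frobenius ^∘ (i ℕ.* n)) x    ≡⟨ ^∘-* frobenius i n x ⟩
    ((frobenius ^∘ n) ^∘ i) x     ≈⟨ identity i ⟩
    x                             ∎
    where
    i = proj₁ (σ-conjugate x)

    powers : ∀ N → (σ ^∘ N) x ≈ (frobenius ^∘ (N ℕ.* i)) x
    powers zero    = refl
    powers (suc N) = begin
      σ ((σ ^∘ N) x)                              ≈⟨ σ.⟦⟧-cong (powers N) ⟩
      σ ((frobenius ^∘ (N ℕ.* i)) x)              ≈⟨ σ-commutes (N ℕ.* i) x ⟩
      (frobenius ^∘ (N ℕ.* i)) (σ x)              ≈⟨ Φ.^∘-cong (N ℕ.* i) (proj₂ (σ-conjugate x)) ⟩
      (frobenius ^∘ (N ℕ.* i)) ((frobenius ^∘ i) x) ≡⟨ ^∘-+ frobenius (N ℕ.* i) i x ⟨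
      (frobenius ^∘ (N ℕ.* i ℕ.+ i)) x            ≡⟨ ≡.cong (λ M → (frobenius ^∘ M) x) (ℕ.+-comm (N ℕ.* i) i) ⟩
      (frobenius ^∘ (i ℕ.+ N ℕ.* i)) x            ∎

    identity : ∀ N → ((frobenius ^∘ n) ^∘ N) x ≈ x
    identity zero    = refl
    identity (suc N) = trans (frobenius-order _) (identity N)

  -- Frobenius is σ^m. If σⁱ were the identity, so would be the i-th power of Frobenius, and all qⁿ
  -- > qⁱ elements of K would be roots of x^{qⁱ} - x.
  σ-faithful : ∀ i → 0 ℕ.< i → i ℕ.< n → ¬ (∀ x → (σ ^∘ i) x ≈ x)
  σ-faithful i 0<i i<n σⁱ≈id = x^N-x-roots-bounded (q ℕ.^ i) 2≤qⁱ points
    (λ eq → Fin.inject≤-injective qⁱ<qⁿ qⁱ<qⁿ _ _ (FK.element-distinct eq)) roots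
    where
    instance
      q≢0 : ℕ.NonTrivial q
      q≢0 = ℕ.n>1⇒nonTrivial 2≤q
    2≤qⁱ = ℕ.≤-trans (s≤s 0<i) (m<n^m q i 2≤q)
    qⁱ<qⁿ = ℕ.^-monoʳ-< q 2≤q i<n
    points = λ j → FK.element (Fin.inject≤ j qⁱ<qⁿ)

    commute : ∀ j x → (frobenius ^∘ j) x ≈ ((σ ^∘ m) ^∘ j) x
    commute zero    x = refl
    commute (suc j) x = trans (^-congˡ q (commute j x)) (frobenius≈σ^m _)

    identity : ∀ j x → ((σ ^∘ i) ^∘ j) x ≈ x
    identity zero    x = refl
    identity (suc j) x = trans (σⁱ≈id _) (identity j x)

    roots : ∀ j → points j ^ (q ℕ.^ i) ≈ points j
    roots j = begin
      x ^ (q ℕ.^ i)             ≈⟨ frobenius-^∘ i x ⟨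
      (frobenius ^∘ i) x        ≈⟨ commute i x ⟩
      ((σ ^∘ m) ^∘ i) x         ≡⟨ ^∘-* σ i m x ⟨
      (σ ^∘ (i ℕ.* m)) x        ≡⟨ ≡.cong (λ N → (σ ^∘ N) x) (ℕ.*-comm i m) ⟩
      (σ ^∘ (m ℕ.* i)) x        ≡⟨ ^∘-* σ m i x ⟩
      ((σ ^∘ i) ^∘ m) x         ≈⟨ identity m x ⟩
      x                         ∎
      where x = points j

-- Skew polynomials

^∘-suc : ∀ {a} {S : Set a} (f : S → S) i x → (f ^∘ i) (f x) ≡ f ((f ^∘ i) x)
^∘-suc f zero    x = ≡.refl
^∘-suc f (suc i) x = ≡.cong f (^∘-suc f i x)

module SkewPolynomialRing {c ℓ} (A : CommutativeRing c ℓ)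
  (σ : CommutativeRing.Carrier A → CommutativeRing.Carrier A)
  (isHom : IsRingHomomorphism (CommutativeRing.rawRing A) (CommutativeRing.rawRing A) σ) where

  private
    module A = CommutativeRing A
    module σ where
      open IsRingHomomorphism isHom public
      open RingEndomorphism A σ isHom public
    open import Algebra.Properties.Ring A.ring using (-0#≈0#)

  open SkewPolynomial A.rawRing σ public using (Poly; coeff; coefficientwise; const; X; _+_; -_; _*_; _≈_; module _≈_)
  open _≈_ public

  private
    variable
      p p′ r r′ t : Poly

  ≈-refl : p ≈ p
  ≈-refl = coefficientwise λ i → A.refl

  ≈-sym : p ≈ r → r ≈ p
  ≈-sym eq = coefficientwise λ i → A.sym (coeff-≈ eq i)

  ≈-trans : p ≈ r → r ≈ t → p ≈ t
  ≈-trans eq eq′ = coefficientwise λ i → A.trans (coeff-≈ eq i) (coeff-≈ eq′ i)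

  coeff-+ : ∀ p r i → coeff (p + r) i A.≈ coeff p i A.+ coeff r i
  coeff-+ []      r       i       = A.sym (A.+-identityˡ _)
  coeff-+ (a ∷ p) []      i       = A.sym (A.+-identityʳ _)
  coeff-+ (a ∷ p) (b ∷ r) zero    = A.refl
  coeff-+ (a ∷ p) (b ∷ r) (suc i) = coeff-+ p r i

  coeff-map : ∀ {f} → f A.0# A.≈ A.0# → ∀ p i → coeff (List.map f p) i A.≈ f (coeff p i)
  coeff-map f0≈0 []      i       = A.sym f0≈0
  coeff-map f0≈0 (a ∷ p) zero    = A.refl
  coeff-map f0≈0 (a ∷ p) (suc i) = coeff-map f0≈0 p i

  coeff-neg : ∀ p i → coeff (- p) i A.≈ A.- coeff p i
  coeff-neg = coeff-map -0#≈0#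

  infixr 8 _•_
  _•_ : A.Carrier → Poly → Poly
  a • p = List.map (a A.*_) p

  -- Left multiplication by X, twisting the coefficients; `X-*` confirms this.
  shift : Poly → Poly
  shift p = A.0# ∷ List.map σ p

  coeff-• : ∀ a p i → coeff (a • p) i A.≈ a A.* coeff p i
  coeff-• a = coeff-map (A.zeroʳ a)

  coeff-σ : ∀ p i → coeff (List.map σ p) i A.≈ σ (coeff p i)
  coeff-σ = coeff-map σ.0#-homo

  +-cong : p ≈ p′ → r ≈ r′ → p + r ≈ p′ + r′
  +-cong {p} {p′} {r} {r′} eq eq′ = coefficientwise λ i →
    A.trans (coeff-+ p r i) (A.trans (A.+-cong (coeff-≈ eq i) (coeff-≈ eq′ i)) (A.sym (coeff-+ p′ r′ i)))

  +-assoc : ∀ p r t → (p + r) + t ≈ p + (r + t)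
  +-assoc p r t = coefficientwise λ i →
    A.trans (coeff-+ (p + r) t i) (A.trans (A.+-congʳ (coeff-+ p r i)) (A.trans (A.+-assoc _ _ _)
      (A.sym (A.trans (coeff-+ p (r + t) i) (A.+-congˡ (coeff-+ r t i))))))

  +-comm : ∀ p r → p + r ≈ r + p
  +-comm p r = coefficientwise λ i →
    A.trans (coeff-+ p r i) (A.trans (A.+-comm _ _) (A.sym (coeff-+ r p i)))

  +-identityʳ : ∀ p → p + [] ≈ p
  +-identityʳ p = coefficientwise λ i → A.trans (coeff-+ p [] i) (A.+-identityʳ _)

  -‿cong : p ≈ r → - p ≈ - r
  -‿cong {p} {r} eq = coefficientwise λ i →
    A.trans (coeff-neg p i) (A.trans (A.-‿cong (coeff-≈ eq i)) (A.sym (coeff-neg r i)))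

  -‿inverseˡ : ∀ p → - p + p ≈ []
  -‿inverseˡ p = coefficientwise λ i →
    A.trans (coeff-+ (- p) p i) (A.trans (A.+-congʳ (coeff-neg p i)) (A.-‿inverseˡ _))

  +-isAbelianGroup : IsAbelianGroup _≈_ _+_ [] -_
  +-isAbelianGroup = record
    { isGroup = record
      { isMonoid = record
        { isSemigroup = record
          { isMagma = record
            { isEquivalence = record { refl = ≈-refl ; sym = ≈-sym ; trans = ≈-trans }
            ; ∙-cong = +-cong }
          ; assoc = +-assoc }
        ; identity = (λ p → ≈-refl) , +-identityʳ }
      ; inverse = -‿inverseˡ , λ p → ≈-trans (+-comm p (- p)) (-‿inverseˡ p)
      ; ⁻¹-cong = -‿cong }
    ; comm = +-comm }

  private
    +-abelianGroup : AbelianGroup c ℓ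
    +-abelianGroup = record { isAbelianGroup = +-isAbelianGroup }
    module + = AbelianGroup +-abelianGroup
    open import Algebra.Properties.CommutativeSemigroup +.commutativeSemigroup using (interchange)
    open import Relation.Binary.Reasoning.Setoid +.setoid

  ∷-cong : ∀ {a b} → a A.≈ b → p ≈ r → (a ∷ p) ≈ (b ∷ r)
  ∷-cong eq eqs = coefficientwise λ { zero → eq ; (suc i) → coeff-≈ eqs i }

  0∷[] : (A.0# ∷ []) ≈ []
  0∷[] = coefficientwise λ { zero → A.refl ; (suc i) → A.refl }

  •-cong : ∀ {a b} → a A.≈ b → p ≈ r → a • p ≈ b • r
  •-cong {p} {r} {a} {b} eq eqs = coefficientwise λ i →
    A.trans (coeff-• a p i) (A.trans (A.*-cong eq (coeff-≈ eqs i)) (A.sym (coeff-• b r i)))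

  •-distribˡ : ∀ a p r → a • (p + r) ≈ a • p + a • r
  •-distribˡ a p r = coefficientwise λ i → A.trans (coeff-• a (p + r) i) (A.trans (A.*-congˡ (coeff-+ p r i))
    (A.trans (A.distribˡ _ _ _) (A.sym (A.trans (coeff-+ (a • p) (a • r) i) (A.+-cong (coeff-• a p i) (coeff-• a r i))))))

  •-distribʳ : ∀ a b p → (a A.+ b) • p ≈ a • p + b • p
  •-distribʳ a b p = coefficientwise λ i → A.trans (coeff-• (a A.+ b) p i)
    (A.trans (A.distribʳ _ _ _) (A.sym (A.trans (coeff-+ (a • p) (b • p) i) (A.+-cong (coeff-• a p i) (coeff-• b p i)))))

  •-assoc : ∀ a b p → (a A.* b) • p ≈ a • (b • p)
  •-assoc a b p = coefficientwise λ i → A.trans (coeff-• (a A.* b) p i)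
    (A.trans (A.*-assoc _ _ _) (A.sym (A.trans (coeff-• a (b • p) i) (A.*-congˡ (coeff-• b p i)))))

  0•p≈0 : ∀ p → A.0# • p ≈ []
  0•p≈0 p = coefficientwise λ i → A.trans (coeff-• A.0# p i) (A.zeroˡ _)

  1•p≈p : ∀ p → A.1# • p ≈ p
  1•p≈p p = coefficientwise λ i → A.trans (coeff-• A.1# p i) (A.*-identityˡ _)

  map-σ-cong : p ≈ r → List.map σ p ≈ List.map σ r
  map-σ-cong {p} {r} eq = coefficientwise λ i →
    A.trans (coeff-σ p i) (A.trans (σ.⟦⟧-cong (coeff-≈ eq i)) (A.sym (coeff-σ r i)))

  shift-cong : p ≈ r → shift p ≈ shift r
  shift-cong eq = ∷-cong A.refl (map-σ-cong eq)

  shift-+ : ∀ p r → shift (p + r) ≈ shift p + shift r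
  shift-+ p r = ∷-cong (A.sym (A.+-identityˡ _)) (coefficientwise λ i →
    A.trans (coeff-σ (p + r) i) (A.trans (σ.⟦⟧-cong (coeff-+ p r i)) (A.trans (σ.+-homo _ _)
      (A.sym (A.trans (coeff-+ (List.map σ p) (List.map σ r) i) (A.+-cong (coeff-σ p i) (coeff-σ r i)))))))

  shift-• : ∀ a p → shift (a • p) ≈ σ a • shift p
  shift-• a p = ∷-cong (A.sym (A.zeroʳ _)) (coefficientwise λ i →
    A.trans (coeff-σ (a • p) i) (A.trans (σ.⟦⟧-cong (coeff-• a p i)) (A.trans (σ.*-homo _ _)
      (A.sym (A.trans (coeff-• (σ a) (List.map σ p) i) (A.*-congˡ (coeff-σ p i)))))))

  -- The product recurses on the list of the left factor, and 0 is represented by every list of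
  -- zeros; compatibility with ≈ on the left starts from this case.
  *-zeroˡ : ∀ p r → p ≈ [] → p * r ≈ []
  *-zeroˡ []      r eq = ≈-refl
  *-zeroˡ (a ∷ p) r eq = +-cong {r′ = []} (≈-trans (•-cong {r} (coeff-≈ eq 0) ≈-refl) (0•p≈0 r))
    (*-zeroˡ p (shift r) (coefficientwise λ i → coeff-≈ eq (suc i)))

  *-congʳ : ∀ p p′ r → p ≈ p′ → p * r ≈ p′ * r
  *-congʳ []      p′       r eq = ≈-sym (*-zeroˡ p′ r (≈-sym eq))
  *-congʳ (a ∷ p) []       r eq = *-zeroˡ (a ∷ p) r eq
  *-congʳ (a ∷ p) (b ∷ p′) r eq = +-cong (•-cong {r} (coeff-≈ eq 0) ≈-refl)
    (*-congʳ p p′ (shift r) (coefficientwise λ i → coeff-≈ eq (suc i)))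

  *-congˡ : ∀ p → r ≈ r′ → p * r ≈ p * r′
  *-congˡ []      eq = ≈-refl
  *-congˡ (a ∷ p) eq = +-cong (•-cong A.refl eq) (*-congˡ p (shift-cong eq))

  *-distribˡ-+ : ∀ p r t → p * (r + t) ≈ p * r + p * t
  *-distribˡ-+ []      r t = ≈-refl
  *-distribˡ-+ (a ∷ p) r t = begin
    a • (r + t) + p * shift (r + t)                    ≈⟨ +-cong (•-distribˡ a r t) (≈-trans (*-congˡ p (shift-+ r t)) (*-distribˡ-+ p (shift r) (shift t))) ⟩
    (a • r + a • t) + (p * shift r + p * shift t)      ≈⟨ interchange (a • r) (a • t) (p * shift r) (p * shift t) ⟩
    (a • r + p * shift r) + (a • t + p * shift t)      ∎

  *-distribʳ-+ : ∀ r p t → (p + t) * r ≈ p * r + t * r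
  *-distribʳ-+ r []      t       = ≈-refl
  *-distribʳ-+ r (a ∷ p) []      = ≈-sym (+-identityʳ _)
  *-distribʳ-+ r (a ∷ p) (b ∷ t) = begin
    (a A.+ b) • r + (p + t) * shift r                  ≈⟨ +-cong (•-distribʳ a b r) (*-distribʳ-+ (shift r) p t) ⟩
    (a • r + b • r) + (p * shift r + t * shift r)      ≈⟨ interchange (a • r) (b • r) (p * shift r) (t * shift r) ⟩
    (a • r + p * shift r) + (b • r + t * shift r)      ∎

  •-*-assoc : ∀ a p r → (a • p) * r ≈ a • (p * r)
  •-*-assoc a []      r = ≈-refl
  •-*-assoc a (b ∷ p) r = ≈-trans (+-cong (•-assoc a b r) (•-*-assoc a p (shift r))) (≈-sym (•-distribˡ a (b • r) (p * shift r)))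

  map-σ-*-shift : ∀ p r → List.map σ p * shift r ≈ shift (p * r)
  map-σ-*-shift []      r = ≈-sym 0∷[]
  map-σ-*-shift (b ∷ p) r = begin
    σ b • shift r + List.map σ p * shift (shift r)     ≈⟨ +-cong (≈-sym (shift-• b r)) (map-σ-*-shift p (shift r)) ⟩
    shift (b • r) + shift (p * shift r)                ≈⟨ shift-+ (b • r) (p * shift r) ⟨
    shift (b • r + p * shift r)                        ∎

  shift-* : ∀ p r → shift p * r ≈ shift (p * r)
  shift-* p r = ≈-trans (+-cong (0•p≈0 r) ≈-refl) (map-σ-*-shift p r)

  -- Induction on the left factor. The twist is confined to `shift-*`, which says (X r) t = X (r t).
  *-assoc : ∀ p r t → (p * r) * t ≈ p * (r * t)
  *-assoc []      r t = ≈-refl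
  *-assoc (a ∷ p) r t = begin
    (a • r + p * shift r) * t                          ≈⟨ *-distribʳ-+ t (a • r) (p * shift r) ⟩
    (a • r) * t + (p * shift r) * t                    ≈⟨ +-cong (•-*-assoc a r t) (*-assoc p (shift r) t) ⟩
    a • (r * t) + p * (shift r * t)                    ≈⟨ +-cong (≈-refl {a • (r * t)}) (*-congˡ p (shift-* r t)) ⟩
    a • (r * t) + p * shift (r * t)                    ∎

  -- With coefficients on the left, `0# ∷ r` is r X; so this is p (r X) = (p r) X. Multiplying by X
  -- on the right causes no twist.
  *-0∷ : ∀ p r → p * (A.0# ∷ r) ≈ (A.0# ∷ p * r)
  *-0∷ []      r = ≈-sym 0∷[]
  *-0∷ (b ∷ p) r = begin
    (b A.* A.0# ∷ b • r) + p * (A.0# ∷ σ A.0# ∷ List.map σ r)  ≈⟨ +-cong (∷-cong (A.zeroʳ b) ≈-refl) (*-0∷ p (σ A.0# ∷ List.map σ r)) ⟩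
    (A.0# ∷ b • r) + (A.0# ∷ p * (σ A.0# ∷ List.map σ r))      ≈⟨ ∷-cong (A.+-identityˡ _) (+-cong (≈-refl {b • r}) (*-congˡ p (∷-cong σ.0#-homo ≈-refl))) ⟩
    (A.0# ∷ b • r + p * shift r)                               ∎

  const-* : ∀ a p → const a * p ≈ a • p
  const-* a p = +-identityʳ (a • p)

  *-identityʳ : ∀ p → p * const A.1# ≈ p
  *-identityʳ []      = ≈-refl
  *-identityʳ (a ∷ p) = begin
    (a A.* A.1# ∷ []) + p * (A.0# ∷ σ A.1# ∷ [])   ≈⟨ +-cong (∷-cong {r = []} (A.*-identityʳ a) ≈-refl) (*-0∷ p (σ A.1# ∷ [])) ⟩
    (a A.+ A.0# ∷ p * (σ A.1# ∷ []))               ≈⟨ ∷-cong (A.+-identityʳ a) (≈-trans (*-congˡ p (∷-cong {r = []} σ.1#-homo ≈-refl)) (*-identityʳ p)) ⟩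
    a ∷ p                                          ∎

  isRing : IsRing _≈_ _+_ _*_ -_ [] (const A.1#)
  isRing = record
    { +-isAbelianGroup = +-isAbelianGroup
    ; *-cong = λ {p} {p′} {r} eq eq′ → ≈-trans (*-congʳ p p′ r eq) (*-congˡ p′ eq′)
    ; *-assoc = *-assoc
    ; *-identity = (λ p → ≈-trans (const-* A.1# p) (1•p≈p p)) , *-identityʳ
    ; distrib = *-distribˡ-+ , *-distribʳ-+
    }

  ring : Ring c ℓ
  ring = record { isRing = isRing }

  open import Algebra.Properties.Semiring.Exp (Ring.semiring ring) public using (_^_; ^-homo-*; ^-congʳ)

  *-X : ∀ p → p * X ≈ (A.0# ∷ p)
  *-X p = ≈-trans (*-0∷ p (A.1# ∷ [])) (∷-cong A.refl (*-identityʳ p))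

  X-* : ∀ p → X * p ≈ shift p
  X-* p = ≈-trans (+-cong (0•p≈0 p) (const-* A.1# (shift p))) (1•p≈p (shift p))

  ∷≈const+*X : ∀ a p → (a ∷ p) ≈ const a + p * X
  ∷≈const+*X a p = ≈-sym (≈-trans (+-cong (≈-refl {const a}) (*-X p)) (∷-cong (A.+-identityʳ a) ≈-refl))

  X-const : ∀ a → X * const a ≈ const (σ a) * X
  X-const a = ≈-trans (X-* (const a)) (≈-sym (*-X (const (σ a))))

  const-*-const : ∀ a b → const (a A.* b) ≈ const a * const b
  const-*-const a b = ≈-sym (const-* a (const b))

  const-cong : ∀ {a b} → a A.≈ b → const a ≈ const b
  const-cong eq = ∷-cong eq ≈-refl

  X^-comm : ∀ j → X ^ j * X ≈ X ^ suc j
  X^-comm j = ≈-trans (*-congˡ (X ^ j) (≈-sym (*-identityʳ X)))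
    (≈-trans (≈-sym (^-homo-* X j 1)) (^-congʳ X (ℕ.+-comm j 1)))

  coeff-*-X^ : ∀ p j i → coeff (p * X ^ j) (j ℕ.+ i) A.≈ coeff p i
  coeff-*-X^ p zero    i = coeff-≈ (*-identityʳ p) i
  coeff-*-X^ p (suc j) i = A.trans (coeff-≈ (≈-trans (≈-sym (*-assoc p X (X ^ j))) (*-congʳ _ _ (X ^ j) (*-X p))) (suc j ℕ.+ i))
    (A.trans (A.reflexive (≡.cong (coeff ((A.0# ∷ p) * X ^ j)) (≡.sym (ℕ.+-suc j i)))) (coeff-*-X^ (A.0# ∷ p) j (suc i)))

  coeff-X^-* : ∀ p j i → coeff (X ^ j * p) (j ℕ.+ i) A.≈ (σ ^∘ j) (coeff p i)
  coeff-X^-* p zero    i = coeff-≈ (≈-trans (const-* A.1# p) (1•p≈p p)) i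
  coeff-X^-* p (suc j) i = A.trans (coeff-≈ (≈-trans (*-assoc X (X ^ j) p) (X-* (X ^ j * p))) (suc j ℕ.+ i))
    (A.trans (coeff-σ (X ^ j * p) (j ℕ.+ i)) (σ.⟦⟧-cong (coeff-X^-* p j i)))

  -- Moving a to the left past Xⁱ turns it into σⁱ(a). This twist lets commutation with K detect
  -- exponents modulo the order of σ.
  coeff-*-const : ∀ p a i → coeff (p * const a) i A.≈ coeff p i A.* (σ ^∘ i) a
  coeff-*-const []      a i       = A.sym (A.zeroˡ _)
  coeff-*-const (b ∷ p) a zero    = A.trans (coeff-+ (b • const a) (p * shift (const a)) 0)
    (A.trans (A.+-congˡ (coeff-≈ (*-0∷ p (const (σ a))) 0)) (A.+-identityʳ _))
  coeff-*-const (b ∷ p) a (suc i) = A.trans (coeff-+ (b • const a) (p * shift (const a)) (suc i))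
    (A.trans (A.+-identityˡ _) (A.trans (coeff-≈ (*-0∷ p (const (σ a))) (suc i)) (A.trans (coeff-*-const p (σ a) i)
      (A.*-congˡ (A.reflexive (^∘-suc σ i a))))))

  -- Degree less than m. Unlike a degree, this makes sense for 0 as well and does not see trailing
  -- zeros of the list.
  Below : ℕ → Poly → Set ℓ
  Below m p = ∀ i → m ℕ.≤ i → coeff p i A.≈ A.0#

  Below-mono : ∀ p {m m′} → m ℕ.≤ m′ → Below m p → Below m′ p
  Below-mono p m≤m′ p<m i m′≤i = p<m i (ℕ.≤-trans m≤m′ m′≤i)

  Below-cong : ∀ {m} → p ≈ r → Below m p → Below m r
  Below-cong eq p<m i m≤i = A.trans (A.sym (coeff-≈ eq i)) (p<m i m≤i)

  Below-0 : Below 0 p → p ≈ []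
  Below-0 p<0 = coefficientwise λ i → p<0 i z≤n

  Below-+ : ∀ {m} p r → Below m p → Below m r → Below m (p + r)
  Below-+ p r p<m r<m i m≤i =
    A.trans (coeff-+ p r i) (A.trans (A.+-cong (p<m i m≤i) (r<m i m≤i)) (A.+-identityʳ _))

  Below-neg : ∀ {m} p → Below m p → Below m (- p)
  Below-neg p p<m i m≤i = A.trans (coeff-neg p i) (A.trans (A.-‿cong (p<m i m≤i)) -0#≈0#)

  Below-• : ∀ {m} a p → Below m p → Below m (a • p)
  Below-• a p p<m i m≤i = A.trans (coeff-• a p i) (A.trans (A.*-congˡ (p<m i m≤i)) (A.zeroʳ a))

  Below-shift : ∀ {m} p → Below m p → Below (suc m) (shift p)
  Below-shift p p<m (suc i) (s≤s m≤i) = A.trans (coeff-σ p i) (A.trans (σ.⟦⟧-cong (p<m i m≤i)) σ.0#-homo)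

  Below-∷ : ∀ {m a} → Below m p → Below (suc m) (a ∷ p)
  Below-∷ p<m (suc i) (s≤s m≤i) = p<m i m≤i

  Below-∷⁻ : ∀ {m a} → Below (suc m) (a ∷ p) → Below m p
  Below-∷⁻ p<m i m≤i = p<m (suc i) (s≤s m≤i)

  Below-const : ∀ a → Below 1 (const a)
  Below-const a (suc i) _ = A.refl

  Below-*-const : ∀ {m} p a → Below m p → Below m (p * const a)
  Below-*-const p a p<m i m≤i = A.trans (coeff-*-const p a i) (A.trans (A.*-congʳ (p<m i m≤i)) (A.zeroˡ _))

  private
    split : ∀ {j m i} → j ℕ.+ m ℕ.≤ i → ∃[ i′ ] (i ≡ j ℕ.+ i′ × m ℕ.≤ i′)
    split {j} {m} {i} j+m≤i = i ℕ.∸ j ,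
      ≡.sym (ℕ.m+[n∸m]≡n (ℕ.≤-trans (ℕ.m≤m+n j m) j+m≤i)) ,
      ℕ.≤-trans (ℕ.≤-reflexive (≡.sym (ℕ.m+n∸m≡n j m))) (ℕ.∸-monoˡ-≤ j j+m≤i)

  Below-*-X^ : ∀ {m} p j → Below m p → Below (j ℕ.+ m) (p * X ^ j)
  Below-*-X^ {m} p j p<m i le with split {j} le
  ... | i′ , ≡.refl , m≤i′ = A.trans (coeff-*-X^ p j i′) (p<m i′ m≤i′)

  Below-X^-* : ∀ {m} p j → Below m p → Below (j ℕ.+ m) (X ^ j * p)
  Below-X^-* {m} p j p<m i le with split {j} le
  ... | i′ , ≡.refl , m≤i′ = A.trans (coeff-X^-* p j i′)
    (A.trans (σ.^∘-cong j (p<m i′ m≤i′)) (σ^0≈0 j))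
    where
    σ^0≈0 : ∀ j → (σ ^∘ j) A.0# A.≈ A.0#
    σ^0≈0 zero    = A.refl
    σ^0≈0 (suc j) = A.trans (σ.⟦⟧-cong (σ^0≈0 j)) σ.0#-homo

  -- Only the two top coefficients meet at X^{d+e}, that of r being twisted on its way past X^d.
  -- Here d and e merely bound the degrees, so the product may vanish.
  coeff-*-top : ∀ {d e} p r → Below (suc d) p → Below (suc e) r →
                coeff (p * r) (d ℕ.+ e) A.≈ coeff p d A.* (σ ^∘ d) (coeff r e)
  coeff-*-top []      r _   _   = A.sym (A.zeroˡ _)
  coeff-*-top {zero} {e} (a ∷ p) r p≤d r≤e = A.trans (coeff-+ (a • r) (p * shift r) e)
    (A.trans (A.+-cong (coeff-• a r e) (coeff-≈ (*-zeroˡ p (shift r) (Below-0 (Below-∷⁻ p≤d))) e)) (A.+-identityʳ _))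
  coeff-*-top {suc d} {e} (a ∷ p) r p≤d r≤e = A.trans (coeff-+ (a • r) (p * shift r) (suc d ℕ.+ e))
    (A.trans (A.+-cong
      (Below-• a r r≤e (suc d ℕ.+ e) (s≤s (ℕ.m≤n+m e d)))
      (A.trans (A.reflexive (≡.cong (coeff (p * shift r)) (≡.sym (ℕ.+-suc d e))))
        (A.trans (coeff-*-top p (shift r) (Below-∷⁻ p≤d) (Below-shift r r≤e))
          (A.*-congˡ (A.trans (σ.^∘-cong d (coeff-σ r e)) (A.reflexive (^∘-suc σ d _)))))))
      (A.+-identityˡ _))

  coeff-*-X^-low : ∀ p j i → i ℕ.< j → coeff (p * X ^ j) i A.≈ A.0#
  coeff-*-X^-low p (suc j) i (s≤s i≤j) = A.trans
    (coeff-≈ (≈-trans (≈-sym (*-assoc p X (X ^ j))) (*-congʳ _ _ (X ^ j) (*-X p))) i) (go (ℕ.m≤n⇒m<n∨m≡n i≤j))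
    where
    go : i ℕ.< j ⊎ i ≡ j → coeff ((A.0# ∷ p) * X ^ j) i A.≈ A.0#
    go (inj₁ i<j)    = coeff-*-X^-low (A.0# ∷ p) j i i<j
    go (inj₂ ≡.refl) = A.trans (A.reflexive (≡.cong (coeff ((A.0# ∷ p) * X ^ j)) (≡.sym (ℕ.+-identityʳ j)))) (coeff-*-X^ (A.0# ∷ p) j 0)

  coeff-X^-*-low : ∀ p j i → i ℕ.< j → coeff (X ^ j * p) i A.≈ A.0#
  coeff-X^-*-low p (suc j) zero    _         = coeff-≈ (≈-trans (*-assoc X (X ^ j) p) (X-* (X ^ j * p))) 0
  coeff-X^-*-low p (suc j) (suc i) (s≤s i<j) = A.trans (coeff-≈ (≈-trans (*-assoc X (X ^ j) p) (X-* (X ^ j * p))) (suc i))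
    (A.trans (coeff-σ (X ^ j * p) i) (A.trans (σ.⟦⟧-cong (coeff-X^-*-low p j i i<j)) σ.0#-homo))

  open import Algebra.Properties.Semiring.Sum (Ring.semiring ring) public using (sum; sum-cong-≋; *-distribʳ-sum)

  sum-below : ∀ {m} N (f : Fin N → Poly) → (∀ i → Below m (f i)) → Below m (sum f)
  sum-below zero    f f<m = λ _ _ → A.refl
  sum-below (suc N) f f<m = Below-+ (f zero) (sum (f ∘ suc)) (f<m zero) (sum-below N (f ∘ suc) (f<m ∘ suc))

  monomials-below : ∀ {m} (α : Fin m → A.Carrier) → Below m (sum (λ i → const (α i) * X ^ toℕ i))
  monomials-below {m} α = sum-below m _ λ i → Below-mono (const (α i) * X ^ toℕ i)
    (ℕ.≤-trans (ℕ.≤-reflexive (ℕ.+-comm (toℕ i) 1)) (Fin.toℕ<n i)) (Below-*-X^ (const (α i)) (toℕ i) (Below-const (α i)))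

  monomial-expansion : ∀ m p → Below m p → p ≈ sum {m} (λ i → const (coeff p (toℕ i)) * X ^ toℕ i)
  monomial-expansion zero    p p<0 = Below-0 p<0
  monomial-expansion (suc m) p p<m =
    ≈-trans (head∷tail p) (≈-trans (∷≈const+*X (coeff p 0) (tail p))
      (+-cong (≈-sym (*-identityʳ (const (coeff p 0))))
        (≈-trans (*-congʳ (tail p) (sum v) X (monomial-expansion m (tail p) tail<m))
        (≈-trans (*-distribʳ-sum {m} X v) (sum-cong-≋ {m} {λ i → v i * X} {w} step)))))
    where
    tail : Poly → Poly
    tail []      = []
    tail (a ∷ p) = p
    coeff-tail : ∀ p i → coeff (tail p) i ≡ coeff p (suc i)
    coeff-tail []      i = ≡.refl
    coeff-tail (a ∷ p) i = ≡.refl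
    head∷tail : ∀ p → p ≈ (coeff p 0 ∷ tail p)
    head∷tail []      = ≈-sym 0∷[]
    head∷tail (a ∷ p) = ≈-refl
    tail<m : Below m (tail p)
    tail<m i m≤i = A.trans (A.reflexive (coeff-tail p i)) (p<m (suc i) (s≤s m≤i))
    v w : Fin m → Poly
    v i = const (coeff (tail p) (toℕ i)) * X ^ toℕ i
    w i = const (coeff p (suc (toℕ i))) * X ^ suc (toℕ i)
    step : ∀ i → v i * X ≈ w i
    step i = ≈-trans (*-assoc (const (coeff (tail p) (toℕ i))) (X ^ toℕ i) X) (≈-trans
      (*-congʳ (const (coeff (tail p) (toℕ i))) (const (coeff p (suc (toℕ i)))) (X ^ toℕ i * X) (const-cong (A.reflexive (coeff-tail p (toℕ i)))))
      (*-congˡ (const (coeff p (suc (toℕ i)))) (X^-comm (toℕ i))))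

  record HasDegree (p : Poly) (d : ℕ) : Set ℓ where
    constructor hasDegree
    field
      leading≉0 : ¬ (coeff p d A.≈ A.0#)
      bounded   : Below (suc d) p

  module _ (isField : IsDiscreteField A) where
    open IsDiscreteField isField

    degree? : ∀ p → p ≈ [] ⊎ ∃[ d ] HasDegree p d
    degree? []      = inj₁ ≈-refl
    degree? (a ∷ p) with degree? p
    ... | inj₂ (d , hasDegree p_d≉0 p≤d) = inj₂ (suc d , hasDegree p_d≉0 (Below-∷ p≤d))
    ... | inj₁ p≈0 with a ≟ A.0#
    ...   | yes a≈0 = inj₁ (≈-trans (∷-cong a≈0 p≈0) 0∷[])
    ...   | no  a≉0 = inj₂ (0 , hasDegree a≉0 (Below-∷ (λ i _ → coeff-≈ p≈0 i)))

    HasDegree-< : ∀ {d m} → HasDegree p d → Below m p → d ℕ.< m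
    HasDegree-< {d = d} {m} (hasDegree p_d≉0 _) p<m with d ℕ.<? m
    ... | yes d<m = d<m
    ... | no  d≮m = ⊥-elim (p_d≉0 (p<m d (ℕ.≮⇒≥ d≮m)))

    -- If h had degree d, then h M would have the coefficient h_d σ^d(1) = h_d ≠ 0 at X^{d+D}.
    monic-multiple-small : ∀ {D} h M → coeff M D A.≈ A.1# → Below (suc D) M → Below D (h * M) → h ≈ []
    monic-multiple-small {D} h M M_D≈1 M≤D hM<D with degree? h
    ... | inj₁ h≈0 = h≈0
    ... | inj₂ (d , hasDegree h_d≉0 h≤d) = ⊥-elim (h_d≉0 (
      A.trans (A.sym (A.*-identityʳ _)) (A.trans (A.*-congˡ (A.sym (A.trans (σ.^∘-cong d M_D≈1) (σ^1≈1 d))))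
        (A.trans (A.sym (coeff-*-top h M h≤d M≤D)) (hM<D (d ℕ.+ D) (ℕ.m≤n+m D d))))))
      where
      σ^1≈1 : ∀ j → (σ ^∘ j) A.1# A.≈ A.1#
      σ^1≈1 zero    = A.refl
      σ^1≈1 (suc j) = A.trans (σ.⟦⟧-cong (σ^1≈1 j)) σ.1#-homo

-- The quotient R_F

module QuotientRing {c ℓ} (B : Ring c ℓ) (M : Ring.Carrier B)
  (central : ∀ x → Ring._≈_ B (Ring._*_ B M x) (Ring._*_ B x M)) where

  open Ring B hiding (zero; rawRing)
  open import Algebra.Properties.Ring B using (-‿distribˡ-*; -‿distribʳ-*; -‿+-comm; -‿involutive)
  open import Algebra.Properties.CommutativeSemigroup +-commutativeSemigroup using (interchange)
  open import Relation.Binary.Reasoning.Setoid setoid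
  private
    module Q = Quotient (Ring.rawRing B) M
    open Q using (congruent) renaming (_≈_ to _≋_)

  ≈⇒≋ : ∀ {x y} → x ≈ y → x ≋ y
  ≈⇒≋ {x} {y} eq = congruent 0# (trans (trans (+-congʳ eq) (-‿inverseʳ y)) (sym (zeroˡ M)))

  private
    ≋-sym : ∀ {x y} → x ≋ y → y ≋ x
    ≋-sym {x} {y} (congruent h eq) = congruent (- h) (begin
      y - x          ≈⟨ +-comm _ _ ⟩
      - x + y        ≈⟨ +-congˡ (-‿involutive y) ⟨
      - x - - y      ≈⟨ -‿+-comm x (- y) ⟩
      - (x - y)      ≈⟨ -‿cong eq ⟩
      - (h * M)      ≈⟨ -‿distribˡ-* h M ⟩
      - h * M        ∎)

    ≋-trans : ∀ {x y z} → x ≋ y → y ≋ z → x ≋ z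
    ≋-trans {x} {y} {z} (congruent h eq) (congruent h′ eq′) = congruent (h + h′) (begin
      x - z                  ≈⟨ +-congʳ (+-identityʳ x) ⟨
      x + 0# - z             ≈⟨ +-congʳ (+-congˡ (-‿inverseˡ y)) ⟨
      x + (- y + y) - z      ≈⟨ +-congʳ (+-assoc _ _ _) ⟨
      (x - y + y) - z        ≈⟨ +-assoc _ _ _ ⟩
      (x - y) + (y - z)      ≈⟨ +-cong eq eq′ ⟩
      h * M + h′ * M         ≈⟨ distribʳ M h h′ ⟨
      (h + h′) * M           ∎)

    +-cong-≋ : ∀ {x y u v} → x ≋ y → u ≋ v → x + u ≋ y + v
    +-cong-≋ {x} {y} {u} {v} (congruent h eq) (congruent h′ eq′) = congruent (h + h′) (begin
      x + u - (y + v)        ≈⟨ +-congˡ (-‿+-comm y v) ⟨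
      x + u + (- y - v)      ≈⟨ interchange x u (- y) (- v) ⟩
      (x - y) + (u - v)      ≈⟨ +-cong eq eq′ ⟩
      h * M + h′ * M         ≈⟨ distribʳ M h h′ ⟨
      (h + h′) * M           ∎)

    -‿cong-≋ : ∀ {x y} → x ≋ y → - x ≋ - y
    -‿cong-≋ {x} {y} (congruent h eq) = congruent (- h) (begin
      - x - - y      ≈⟨ -‿+-comm x (- y) ⟩
      - (x - y)      ≈⟨ -‿cong eq ⟩
      - (h * M)      ≈⟨ -‿distribˡ-* h M ⟩
      - h * M        ∎)

    -- Congruence is defined by left multiples h M; after multiplication by z on the right,
    -- centrality brings M back to the right end.
    *-congʳ-≋ : ∀ {x y} z → x ≋ y → x * z ≋ y * z
    *-congʳ-≋ {x} {y} z (congruent h eq) = congruent (h * z) (begin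
      x * z - y * z          ≈⟨ +-congˡ (-‿distribˡ-* y z) ⟩
      x * z + - y * z        ≈⟨ distribʳ z x (- y) ⟨
      (x - y) * z            ≈⟨ *-congʳ eq ⟩
      h * M * z              ≈⟨ *-assoc h M z ⟩
      h * (M * z)            ≈⟨ *-congˡ (central z) ⟩
      h * (z * M)            ≈⟨ *-assoc h z M ⟨
      h * z * M              ∎)

    *-congˡ-≋ : ∀ {x y} z → x ≋ y → z * x ≋ z * y
    *-congˡ-≋ {x} {y} z (congruent h eq) = congruent (z * h) (begin
      z * x - z * y          ≈⟨ +-congˡ (-‿distribʳ-* z y) ⟩
      z * x + z * - y        ≈⟨ distribˡ z x (- y) ⟨
      z * (x - y)            ≈⟨ *-congˡ eq ⟩
      z * (h * M)            ≈⟨ *-assoc z h M ⟨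
      z * h * M              ∎)

  quotientRing : Ring c (c ⊔ ℓ)
  quotientRing = record
    { isRing = record
      { +-isAbelianGroup = record
        { isGroup = record
          { isMonoid = record
            { isSemigroup = record
              { isMagma = record
                { isEquivalence = record { refl = ≈⇒≋ refl ; sym = ≋-sym ; trans = ≋-trans }
                ; ∙-cong = +-cong-≋ }
              ; assoc = λ x y z → ≈⇒≋ (+-assoc x y z) }
            ; identity = (λ x → ≈⇒≋ (+-identityˡ x)) , (λ x → ≈⇒≋ (+-identityʳ x)) }
          ; inverse = (λ x → ≈⇒≋ (-‿inverseˡ x)) , (λ x → ≈⇒≋ (-‿inverseʳ x))
          ; ⁻¹-cong = -‿cong-≋ }
        ; comm = λ x y → ≈⇒≋ (+-comm x y) }
      ; *-cong = λ {x} {y} {u} {v} eq eq′ → ≋-trans (*-congʳ-≋ u eq) (*-congˡ-≋ y eq′)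
      ; *-assoc = λ x y z → ≈⇒≋ (*-assoc x y z)
      ; *-identity = (λ x → ≈⇒≋ (*-identityˡ x)) , (λ x → ≈⇒≋ (*-identityʳ x))
      ; distrib = (λ x y z → ≈⇒≋ (distribˡ x y z)) , (λ x y z → ≈⇒≋ (distribʳ x y z))
      }
    }

module SkewQuotient {c ℓ} (A : CommutativeRing c ℓ) (isField : IsDiscreteField A)
  (σ : CommutativeRing.Carrier A → CommutativeRing.Carrier A)
  (isHom : IsRingHomomorphism (CommutativeRing.rawRing A) (CommutativeRing.rawRing A) σ)
  (M : List (CommutativeRing.Carrier A)) (D : ℕ)
  (central : ∀ p → SkewPolynomial._≈_ (CommutativeRing.rawRing A) σ
    (SkewPolynomial._*_ (CommutativeRing.rawRing A) σ M p) (SkewPolynomial._*_ (CommutativeRing.rawRing A) σ p M))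
  (M-monic : CommutativeRing._≈_ A (SkewPolynomial.coeff (CommutativeRing.rawRing A) σ M D) (CommutativeRing.1# A))
  (M-degree : SkewPolynomialRing.Below A σ isHom (suc D) M)
  where

  module K where
    open CommutativeRing A public
    open DiscreteField A isField public using (_≟_; 1≉0; inverse; *-cancelˡ-≉0; xy≈1⇒x≉0; x-y≈0⇒x≈y)
  module σ where
    open IsRingHomomorphism isHom public
    open RingEndomorphism A σ isHom public
  module P where
    open SkewPolynomialRing A σ isHom public
    open QuotientRing ring M central public using (≈⇒≋)
  open P using (Poly; coeff; const; X; Below; _•_; _^_; HasDegree; hasDegree; ≈⇒≋)

  Q : Ring c (c ⊔ ℓ)
  Q = QuotientRing.quotientRing P.ring M central

  open Ring Q public hiding (zero; rawRing; +-congˡ; +-congʳ; *-congˡ; *-congʳ)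
  open import Relation.Binary.Reasoning.Setoid setoid

  +-congˡ : ∀ x {y z} → y ≈ z → x + y ≈ x + z
  +-congˡ x eq = +-cong {x} {x} refl eq

  +-congʳ : ∀ x {y z} → y ≈ z → y + x ≈ z + x
  +-congʳ x eq = +-cong {u = x} {x} eq refl

  *-congˡ : ∀ x {y z} → y ≈ z → x * y ≈ x * z
  *-congˡ x eq = *-cong {x} {x} refl eq

  *-congʳ : ∀ x {y z} → y ≈ z → y * x ≈ z * x
  *-congʳ x eq = *-cong {u = x} {x} eq refl

  σ≉0 : ∀ {x} → ¬ (x K.≈ K.0#) → ¬ (σ x K.≈ K.0#)
  σ≉0 {x} x≉0 = K.xy≈1⇒x≉0 (K.trans (K.sym (σ.*-homo x x⁻¹)) (K.trans (σ.⟦⟧-cong xx⁻¹≈1) σ.1#-homo))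
    where
    x⁻¹ = proj₁ (K.inverse x x≉0)
    xx⁻¹≈1 = proj₂ (K.inverse x x≉0)

  σ^≉0 : ∀ i {x} → ¬ (x K.≈ K.0#) → ¬ ((σ ^∘ i) x K.≈ K.0#)
  σ^≉0 zero    x≉0 = x≉0
  σ^≉0 (suc i) x≉0 = σ≉0 (σ^≉0 i x≉0)

  const-cong : ∀ {a b} → a K.≈ b → const a ≈ const b
  const-cong eq = ≈⇒≋ (P.const-cong eq)

  const-*-const : ∀ a b → const (a K.* b) ≈ const a * const b
  const-*-const a b = ≈⇒≋ (P.const-*-const a b)

  -- A multiple of M of degree below D = deg M vanishes. Hence a class has only one representative
  -- of degree below D, which gives coefficients and degrees a meaning in the quotient.
  unique₀ : ∀ p → Below D p → p ≈ 0# → p P.≈ []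
  unique₀ p p<D (Quotient.congruent h eq) = P.≈-trans p≈hM (P.*-zeroˡ h M
    (P.monic-multiple-small isField h M M-monic M-degree (P.Below-cong p≈hM p<D)))
    where p≈hM = P.≈-trans (P.≈-sym (P.+-identityʳ p)) eq

  unique : ∀ p r → Below D p → Below D r → p ≈ r → p P.≈ r
  unique p r p<D r<D p≈r = P.coefficientwise λ i → K.x-y≈0⇒x≈y
    (K.trans (K.+-congˡ (K.sym (P.coeff-neg r i))) (K.trans (K.sym (P.coeff-+ p (- r) i))
      (P.coeff-≈ (unique₀ (p + - r) (P.Below-+ p (- r) p<D (P.Below-neg r r<D))
        (trans (+-congʳ (- r) p≈r) (-‿inverseʳ r))) i)))

  reduce : ∀ x → ∃[ p ] (Below D p × x ≈ p)
  reduce []      = [] , (λ i _ → K.refl) , refl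
  reduce (a ∷ x) = let p , p<D , x≈p = reduce x in step p p<D x≈p
    where
    step : ∀ p → Below D p → x ≈ p → ∃[ p ] (Below D p × (a ∷ x) ≈ p)
    step p p<D x≈p = r , r<D , eq
      where
      -- Prepending a to p multiplies by X, so only the coefficient at X^D can be too high;
      -- subtracting t M cancels it because M is monic.
      t = coeff (a ∷ p) D
      r = (a ∷ p) + - (t • M)
      M≈0 : M ≈ 0#
      M≈0 = Quotient.congruent (const K.1#)
        (P.≈-trans (P.+-identityʳ M) (P.≈-sym (P.≈-trans (P.const-* K.1# M) (P.1•p≈p M))))
      r<D : Below D r
      r<D i D≤i with D ℕ.≟ i
      ... | yes ≡.refl = K.trans (P.coeff-+ (a ∷ p) (- (t • M)) D) (K.trans
              (K.+-congˡ (K.trans (P.coeff-neg (t • M) D) (K.-‿cong (K.trans (P.coeff-• t M D)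
                (K.trans (K.*-congˡ M-monic) (K.*-identityʳ t))))))
              (K.-‿inverseʳ t))
      ... | no D≢i = P.Below-+ (a ∷ p) (- (t • M)) (P.Below-∷ p<D)
              (P.Below-neg (t • M) (P.Below-• t M M-degree)) i (ℕ.≤∧≢⇒< D≤i D≢i)
      eq : (a ∷ x) ≈ r
      eq = begin
        a ∷ x                        ≈⟨ ≈⇒≋ (P.∷≈const+*X a x) ⟩
        const a + x * X              ≈⟨ +-congˡ (const a) (*-congʳ X x≈p) ⟩
        const a + p * X              ≈⟨ ≈⇒≋ (P.∷≈const+*X a p) ⟨
        (a ∷ p)                      ≈⟨ +-identityʳ (a ∷ p) ⟨
        (a ∷ p) + 0#                 ≈⟨ +-congˡ (a ∷ p) (-‿cong (zeroʳ (const t))) ⟨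
        (a ∷ p) + - (const t * 0#)   ≈⟨ +-congˡ (a ∷ p) (-‿cong (*-congˡ (const t) M≈0)) ⟨
        (a ∷ p) + - (const t * M)    ≈⟨ +-congˡ (a ∷ p) (-‿cong (≈⇒≋ (P.const-* t M))) ⟩
        (a ∷ p) + - (t • M)          ∎

  S : ℕ → Poly → Set (c ⊔ ℓ)
  S m x = ∃[ p ] (Below m p × x ≈ p)

  S-resp : ∀ {m x y} → x ≈ y → S m x → S m y
  S-resp x≈y (p , p<m , x≈p) = p , p<m , trans (sym x≈y) x≈p

  S-const-* : ∀ {m x} a → S m x → S m (const a * x)
  S-const-* a (p , p<m , x≈p) = a • p , P.Below-• a p p<m , trans (*-congˡ (const a) x≈p) (≈⇒≋ (P.const-* a p))

  S-*-const : ∀ {m x} a → S m x → S m (x * const a)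
  S-*-const a (p , p<m , x≈p) = p * const a , P.Below-*-const p a p<m , *-congʳ (const a) x≈p

  S-X^ : ∀ {m} i → i ℕ.< m → S m (X ^ i)
  S-X^ i i<m = const K.1# * X ^ i ,
    P.Below-mono (const K.1# * X ^ i) (ℕ.≤-trans (ℕ.≤-reflexive (ℕ.+-comm i 1)) i<m) (P.Below-*-X^ (const K.1#) i (P.Below-const K.1#)) ,
    sym (*-identityˡ (X ^ i))

  S-below : ∀ {m x} p → m ℕ.≤ D → S m x → x ≈ p → Below D p → Below m p
  S-below p m≤D (r , r<m , x≈r) x≈p p<D =
    P.Below-cong (unique r p (P.Below-mono r m≤D r<m) p<D (trans (sym x≈r) x≈p)) r<m

  coeff-const : ∀ p → Below 1 p → p P.≈ const (coeff p 0)
  coeff-const p p<1 = P.coefficientwise λ { zero → K.refl ; (suc i) → p<1 (suc i) (s≤s z≤n) }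

  S1⇒const : ∀ {x} → S 1 x → ∃[ a ] (x ≈ const a)
  S1⇒const (p , p<1 , x≈p) = coeff p 0 , trans x≈p (≈⇒≋ (coeff-const p p<1))

  -- Because j + d < D, the product p X^j is itself the reduced representative of its class, and
  -- membership in S m can be read off from its degree.
  degree-shift : ∀ {m d y} p j → m ℕ.≤ D → y ≈ p → HasDegree p d → S m (y * X ^ j) → j ℕ.+ d ℕ.< D → j ℕ.+ d ℕ.< m
  degree-shift {m} {d} p j m≤D y≈p (hasDegree p_d≉0 p≤d) yXʲ∈S j+d<D =
    P.HasDegree-< isField {p = p * X ^ j}
      (hasDegree (p_d≉0 ∘ K.trans (K.sym (P.coeff-*-X^ p j d))) (P.Below-mono (p * X ^ j) (ℕ.≤-reflexive (ℕ.+-suc j d)) below))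
      (S-below (p * X ^ j) m≤D yXʲ∈S (*-congʳ (X ^ j) y≈p) (P.Below-mono (p * X ^ j) (ℕ.≤-trans (ℕ.≤-reflexive (ℕ.+-suc j d)) j+d<D) below))
    where below = P.Below-*-X^ p j p≤d

  degree-shiftˡ : ∀ {m d y} p j → m ℕ.≤ D → y ≈ p → HasDegree p d → S m (X ^ j * y) → j ℕ.+ d ℕ.< D → j ℕ.+ d ℕ.< m
  degree-shiftˡ {m} {d} p j m≤D y≈p (hasDegree p_d≉0 p≤d) Xʲy∈S j+d<D =
    P.HasDegree-< isField {p = X ^ j * p}
      (hasDegree (σ^≉0 j p_d≉0 ∘ K.trans (K.sym (P.coeff-X^-* p j d))) (P.Below-mono (X ^ j * p) (ℕ.≤-reflexive (ℕ.+-suc j d)) below))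
      (S-below (X ^ j * p) m≤D Xʲy∈S (*-congˡ (X ^ j) y≈p) (P.Below-mono (X ^ j * p) (ℕ.≤-trans (ℕ.≤-reflexive (ℕ.+-suc j d)) j+d<D) below))
    where below = P.Below-X^-* p j p≤d

  module _ {m} (1≤m : 1 ℕ.≤ m) (m<D : m ℕ.< D) where

    private
      -- A member of degree d > 0 leaves S m once multiplied by X^(m-d).
      constant : ∀ {y} → S m y → (∀ p d → y ≈ p → HasDegree p (suc d) → ∀ j → j ℕ.< m → j ℕ.+ suc d ℕ.< D → j ℕ.+ suc d ℕ.< m) → ∃[ a ] (y ≈ const a)
      constant (p , p<m , y≈p) shifts with P.degree? isField p
      ... | inj₁ p≈0                 = S1⇒const (p , (λ i _ → P.coeff-≈ p≈0 i) , y≈p)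
      ... | inj₂ (zero  , hasDegree _ p<1) = S1⇒const (p , p<1 , y≈p)
      ... | inj₂ (suc d , deg)       = ⊥-elim (ℕ.<-irrefl m≡ (shifts p d y≈p deg (m ℕ.∸ suc d)
              (ℕ.∸-monoʳ-< (s≤s z≤n) d<m) (ℕ.≤-trans (s≤s (ℕ.≤-reflexive m≡)) m<D)))
        where
        d<m = ℕ.<⇒≤ (P.HasDegree-< isField {p = p} deg p<m)
        m≡ = ℕ.m∸n+n≡m d<m

    -- Since 1 lies in S m, so does y. The hypothesis m < D ensures that the product of degree m
    -- formed in `constant` is still reduced.
    idealizerˡ : ∀ y → (∀ x → S m x → S m (y * x)) → ∃[ a ] (y ≈ const a)
    idealizerˡ y yS⊆S = constant (S-resp {x = y * const K.1#} (*-identityʳ y) (yS⊆S (const K.1#) (S-X^ 0 1≤m)))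
      λ p d y≈p deg j j<m → degree-shift p j (ℕ.<⇒≤ m<D) y≈p deg (yS⊆S (X ^ j) (S-X^ j j<m))

    idealizerʳ : ∀ y → (∀ x → S m x → S m (x * y)) → ∃[ a ] (y ≈ const a)
    idealizerʳ y Sy⊆S = constant (S-resp {x = const K.1# * y} (*-identityˡ y) (Sy⊆S (const K.1#) (S-X^ 0 1≤m)))
      λ p d y≈p deg j j<m → degree-shiftˡ p j (ℕ.<⇒≤ m<D) y≈p deg (Sy⊆S (X ^ j) (S-X^ j j<m))

  -- The component of degree i of the grading, expressed through commutation with K rather than
  -- through exponents, so that products are handled at once; `homogeneous-support` leads back to
  -- exponents.
  Homogeneous : ℕ → Poly → Set (c ⊔ ℓ)
  Homogeneous i f = ∀ a → f * const a ≈ const ((σ ^∘ i) a) * f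

  X-homogeneous : Homogeneous 1 X
  X-homogeneous a = ≈⇒≋ (P.X-const a)

  -- At the degree d of y, the equation y a = b y reads p_d σ^d(a) = b p_d. So b = σ^d(a) for every
  -- a, with the same d.
  normalizes⇒homogeneous : ∀ y → ¬ (y ≈ 0#) → (∀ a → ∃[ b ] (y * const a ≈ const b * y)) → ∃[ d ] Homogeneous d y
  normalizes⇒homogeneous y y≉0 normalizes with reduce y
  ... | p , p<D , y≈p with P.degree? isField p
  ...   | inj₁ p≈0 = ⊥-elim (y≉0 (trans y≈p (≈⇒≋ p≈0)))
  ...   | inj₂ (d , hasDegree p_d≉0 _) = d , λ a → let b , eq = normalizes a in
          trans eq (*-congʳ y (const-cong (K.*-cancelˡ-≉0 p_d≉0 (K.trans (K.*-comm _ _) (K.trans (K.sym (P.coeff-• b p d))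
            (K.trans (K.sym (P.coeff-≈ (same a b eq) d)) (P.coeff-*-const p a d)))))))
    where
    same : ∀ a b → y * const a ≈ const b * y → p * const a P.≈ b • p
    same a b eq = unique (p * const a) (b • p) (P.Below-*-const p a p<D) (P.Below-• b p p<D)
      (trans (*-congʳ (const a) (sym y≈p)) (trans eq (trans (*-congˡ (const b) y≈p) (≈⇒≋ (P.const-* b p)))))

  -- The coefficients of f a = σⁱ(a) f at X^j give p_j σ^j(a) = σⁱ(a) p_j.
  homogeneous-support : ∀ {i f} p → Homogeneous i f → f ≈ p → Below D p →
                        ∀ j → ¬ (coeff p j K.≈ K.0#) → ∀ a → (σ ^∘ j) a K.≈ (σ ^∘ i) a
  homogeneous-support {i} p hom f≈p p<D j p_j≉0 a = K.*-cancelˡ-≉0 p_j≉0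
    (K.trans (K.sym (P.coeff-*-const p a j)) (K.trans (P.coeff-≈ same j) (K.trans (P.coeff-• _ p j) (K.*-comm _ _))))
    where
    b = (σ ^∘ i) a
    same = unique (p * const a) (b • p) (P.Below-*-const p a p<D) (P.Below-• b p p<D)
      (trans (*-congʳ (const a) (sym f≈p)) (trans (hom a) (trans (*-congˡ (const b) f≈p) (≈⇒≋ (P.const-* b p)))))

  monomial : ∀ i p → (∀ j → ¬ (j ≡ i) → coeff p j K.≈ K.0#) → p P.≈ const (coeff p i) * X ^ i
  monomial zero    p       vanish = P.≈-trans (coeff-const p (λ { (suc i) _ → vanish (suc i) λ () })) (P.≈-sym (P.*-identityʳ _))
  monomial (suc i) []      vanish = P.≈-sym (P.*-zeroˡ (const K.0#) (X ^ suc i) P.0∷[])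
  monomial (suc i) (a ∷ p) vanish = P.≈-trans
    (P.≈-trans (P.∷-cong (vanish 0 λ ()) (monomial i p (λ j j≢i → vanish (suc j) (j≢i ∘ ℕ.suc-injective)))) (P.≈-sym (P.*-X _)))
    (P.≈-trans (P.*-assoc (const (coeff p i)) (X ^ i) X) (P.*-congˡ (const (coeff p i)) (P.X^-comm i)))

  commutesWithGenerators⇒central : ∀ z → (∀ a → z * const a ≈ const a * z) → z * X ≈ X * z → ∀ x → z * x ≈ x * z
  commutesWithGenerators⇒central z za zX []      = trans (zeroʳ z) (sym (zeroˡ z))
  commutesWithGenerators⇒central z za zX (a ∷ x) = begin
    z * (a ∷ x)                  ≈⟨ *-congˡ z (≈⇒≋ (P.∷≈const+*X a x)) ⟩
    z * (const a + x * X)        ≈⟨ distribˡ z (const a) (x * X) ⟩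
    z * const a + z * (x * X)    ≈⟨ +-cong (za a) (sym (*-assoc z x X)) ⟩
    const a * z + z * x * X      ≈⟨ +-congˡ (const a * z) (*-congʳ X (commutesWithGenerators⇒central z za zX x)) ⟩
    const a * z + x * z * X      ≈⟨ +-congˡ (const a * z) (trans (*-assoc x z X) (trans (*-congˡ x zX) (sym (*-assoc x X z)))) ⟩
    const a * z + x * X * z      ≈⟨ distribʳ z (const a) (x * X) ⟨
    (const a + x * X) * z        ≈⟨ *-congʳ z (≈⇒≋ (P.∷≈const+*X a x)) ⟨
    (a ∷ x) * z                  ∎

-- Powers of σ modulo n

module CyclicPowers {c ℓ} (A : CommutativeRing c ℓ)
  (σ : CommutativeRing.Carrier A → CommutativeRing.Carrier A)
  (isHom : IsRingHomomorphism (CommutativeRing.rawRing A) (CommutativeRing.rawRing A) σ)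
  (n : ℕ) .{{_ : ℕ.NonZero n}}
  (σ-order : ∀ x → CommutativeRing._≈_ A ((σ ^∘ n) x) x) where

  open CommutativeRing A hiding (zero)
  open RingEndomorphism A σ isHom
  open import Relation.Binary.Reasoning.Setoid setoid

  σ^-multiple : ∀ i x → (σ ^∘ (i ℕ.* n)) x ≈ x
  σ^-multiple i x = trans (reflexive (^∘-* σ i n x)) (go i)
    where
    go : ∀ i → ((σ ^∘ n) ^∘ i) x ≈ x
    go zero    = refl
    go (suc i) = trans (σ-order _) (go i)

  σ^-mod : ∀ i x → (σ ^∘ i) x ≈ (σ ^∘ (i ℕ.% n)) x
  σ^-mod i x = begin
    (σ ^∘ i) x                                            ≡⟨ ≡.cong (λ j → (σ ^∘ j) x) (ℕ.m≡m%n+[m/n]*n i n) ⟩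
    (σ ^∘ (i ℕ.% n ℕ.+ i ℕ./ n ℕ.* n)) x                  ≡⟨ ^∘-+ σ (i ℕ.% n) (i ℕ./ n ℕ.* n) x ⟩
    (σ ^∘ (i ℕ.% n)) ((σ ^∘ (i ℕ./ n ℕ.* n)) x)           ≈⟨ ^∘-cong (i ℕ.% n) (σ^-multiple (i ℕ./ n) x) ⟩
    (σ ^∘ (i ℕ.% n)) x                                    ∎

  σ^-inverseˡ : ∀ i → i ℕ.≤ n → ∀ x → (σ ^∘ (n ℕ.∸ i)) ((σ ^∘ i) x) ≈ x
  σ^-inverseˡ i i≤n x = begin
    (σ ^∘ (n ℕ.∸ i)) ((σ ^∘ i) x)   ≡⟨ ^∘-+ σ (n ℕ.∸ i) i x ⟨
    (σ ^∘ (n ℕ.∸ i ℕ.+ i)) x        ≡⟨ ≡.cong (λ j → (σ ^∘ j) x) (ℕ.m∸n+n≡m i≤n) ⟩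
    (σ ^∘ n) x                      ≈⟨ σ-order x ⟩
    x                               ∎

  σ^-inverseʳ : ∀ i → i ℕ.≤ n → ∀ x → (σ ^∘ i) ((σ ^∘ (n ℕ.∸ i)) x) ≈ x
  σ^-inverseʳ i i≤n x = begin
    (σ ^∘ i) ((σ ^∘ (n ℕ.∸ i)) x)   ≡⟨ ^∘-+ σ i (n ℕ.∸ i) x ⟨
    (σ ^∘ (i ℕ.+ (n ℕ.∸ i))) x      ≡⟨ ≡.cong (λ j → (σ ^∘ j) x) (ℕ.m+[n∸m]≡n i≤n) ⟩
    (σ ^∘ n) x                      ≈⟨ σ-order x ⟩
    x                               ∎

  module _ (σ-faithful : ∀ i → 0 ℕ.< i → i ℕ.< n → ¬ (∀ x → (σ ^∘ i) x ≈ x)) where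

    private
      -- Cancelling σⁱ from σⁱ = σ^j leaves σ^{j-i} = id with j - i < n.
      injective-≤ : ∀ i j → i ℕ.≤ j → j ℕ.< n → (∀ x → (σ ^∘ i) x ≈ (σ ^∘ j) x) → i ≡ j
      injective-≤ i j i≤j j<n eq with j ℕ.∸ i in j-i
      ... | zero  = ℕ.≤-antisym i≤j (ℕ.m∸n≡0⇒m≤n j-i)
      ... | suc d = ⊥-elim (σ-faithful (suc d) (s≤s z≤n)
        (ℕ.≤-<-trans (≡.subst (ℕ._≤ j) j-i (ℕ.m∸n≤m j i)) j<n) λ x → begin
          (σ ^∘ suc d) x                                    ≈⟨ σ^-inverseˡ i i≤n _ ⟨
          (σ ^∘ (n ℕ.∸ i)) ((σ ^∘ i) ((σ ^∘ suc d) x))      ≡⟨ ≡.cong (σ ^∘ (n ℕ.∸ i)) (^∘-+ σ i (suc d) x) ⟨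
          (σ ^∘ (n ℕ.∸ i)) ((σ ^∘ (i ℕ.+ suc d)) x)         ≡⟨ ≡.cong (λ N → (σ ^∘ (n ℕ.∸ i)) ((σ ^∘ N) x)) (≡.trans (≡.cong (i ℕ.+_) (≡.sym j-i)) (ℕ.m+[n∸m]≡n i≤j)) ⟩
          (σ ^∘ (n ℕ.∸ i)) ((σ ^∘ j) x)                     ≈⟨ ^∘-cong (n ℕ.∸ i) (eq x) ⟨
          (σ ^∘ (n ℕ.∸ i)) ((σ ^∘ i) x)                     ≈⟨ σ^-inverseˡ i i≤n x ⟩
          x                                                 ∎)
        where i≤n = ℕ.<⇒≤ (ℕ.≤-<-trans i≤j j<n)

    σ^-injective : ∀ i j → (∀ x → (σ ^∘ i) x ≈ (σ ^∘ j) x) → i ℕ.% n ≡ j ℕ.% n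
    σ^-injective i j eq with ℕ.≤-total (i ℕ.% n) (j ℕ.% n)
    ... | inj₁ le = injective-≤ (i ℕ.% n) (j ℕ.% n) le (ℕ.m%n<n j n) λ x →
      trans (sym (σ^-mod i x)) (trans (eq x) (σ^-mod j x))
    ... | inj₂ le = ≡.sym (injective-≤ (j ℕ.% n) (i ℕ.% n) le (ℕ.m%n<n i n) λ x →
      trans (sym (σ^-mod j x)) (trans (sym (eq x)) (σ^-mod i x)))

-- Degrees of homogeneous elements of R_F

module CyclicQuotient {c ℓ} (A : CommutativeRing c ℓ) (isField : IsDiscreteField A)
  (σ : CommutativeRing.Carrier A → CommutativeRing.Carrier A)
  (isHom : IsRingHomomorphism (CommutativeRing.rawRing A) (CommutativeRing.rawRing A) σ)
  (n s : ℕ) .{{_ : ℕ.NonZero n}}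
  (σ-order : ∀ x → CommutativeRing._≈_ A ((σ ^∘ n) x) x)
  (σ-faithful : ∀ i → 0 ℕ.< i → i ℕ.< n → ¬ (∀ x → CommutativeRing._≈_ A ((σ ^∘ i) x) x))
  (M : List (CommutativeRing.Carrier A))
  (central : ∀ p → SkewPolynomial._≈_ (CommutativeRing.rawRing A) σ
    (SkewPolynomial._*_ (CommutativeRing.rawRing A) σ M p) (SkewPolynomial._*_ (CommutativeRing.rawRing A) σ p M))
  (M-monic : CommutativeRing._≈_ A (SkewPolynomial.coeff (CommutativeRing.rawRing A) σ M (s ℕ.* n)) (CommutativeRing.1# A))
  (M-degree : SkewPolynomialRing.Below A σ isHom (suc (s ℕ.* n)) M)
  where

  open SkewQuotient A isField σ isHom M (s ℕ.* n) central M-monic M-degree public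
  open P using (coeff; const; X; Below; _•_; _^_; HasDegree; hasDegree; ≈⇒≋)
  open CyclicPowers A σ isHom n σ-order
  open import Relation.Binary.Reasoning.Setoid setoid

  private
    D = s ℕ.* n

  X^≉0 : ∀ i → i ℕ.< D → ¬ (X ^ i ≈ 0#)
  X^≉0 i i<D Xⁱ≈0 = K.1≉0 (K.trans (K.sym (P.coeff-*-X^ (const K.1#) i 0))
    (P.coeff-≈ (unique₀ (const K.1# * X ^ i)
      (P.Below-mono (const K.1# * X ^ i) (ℕ.≤-trans (ℕ.≤-reflexive (ℕ.+-comm i 1)) i<D) (P.Below-*-X^ (const K.1#) i (P.Below-const K.1#)))
      (trans (*-identityˡ (X ^ i)) Xⁱ≈0)) (i ℕ.+ 0)))

  -- If d = i + d′n is the degree of f, then f X^((b-d′)n) has degree i + bn,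
  -- hence does not belong to S m.
  homogeneous-degree : ∀ {m i f} μ b → i ℕ.< n → Homogeneous i f → ¬ (f ≈ 0#) →
    1 ℕ.≤ μ → (∀ j → j ℕ.< μ → S m (f * X ^ (j ℕ.* n))) → m ℕ.≤ i ℕ.+ b ℕ.* n → i ℕ.+ b ℕ.* n ℕ.< D →
    ∃[ p ] ∃[ d′ ] (Below D p × f ≈ p × HasDegree p (i ℕ.+ d′ ℕ.* n) × μ ℕ.+ d′ ℕ.≤ b)
  homogeneous-degree {m} {i} {f} μ b i<n hom f≉0 1≤μ fX∈S m≤ <D with reduce f
  ... | p , p<D , f≈p with P.degree? isField p
  ...   | inj₁ p≈0 = ⊥-elim (f≉0 (trans f≈p (≈⇒≋ p≈0)))
  ...   | inj₂ (d , deg) = p , d′ , p<D , f≈p , ≡.subst (HasDegree p) d≡ deg , conclusion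
    where
    d′ = d ℕ./ n
    -- The leading exponent belongs to the support, so σ^d = σⁱ and d is congruent to i modulo n.
    d≡ : d ≡ i ℕ.+ d′ ℕ.* n
    d≡ = ≡.trans (ℕ.m≡m%n+[m/n]*n d n) (≡.cong (ℕ._+ d′ ℕ.* n)
      (≡.trans (σ^-injective σ-faithful d i (homogeneous-support {i} {f} p hom f≈p p<D d (HasDegree.leading≉0 deg))) (ℕ.m<n⇒m%n≡m i<n)))
    m≤D = ℕ.≤-trans m≤ (ℕ.<⇒≤ <D)
    d<m : d ℕ.< m
    d<m = P.HasDegree-< isField {p = p} deg (S-below p m≤D (S-resp {x = f * X ^ 0} (*-identityʳ f) (fX∈S 0 1≤μ)) f≈p p<D)
    d′<b : d′ ℕ.< b
    d′<b = ℕ.*-cancelʳ-< n d′ b (ℕ.+-cancelˡ-< i _ _ (≡.subst (ℕ._< i ℕ.+ b ℕ.* n) d≡ (ℕ.<-≤-trans d<m m≤)))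
    j = b ℕ.∸ d′
    jn+d≡ : j ℕ.* n ℕ.+ d ≡ i ℕ.+ b ℕ.* n
    jn+d≡ = ≡R.begin
      j ℕ.* n ℕ.+ d                      ≡R.≡⟨ ≡.cong (j ℕ.* n ℕ.+_) (≡.trans d≡ (ℕ.+-comm i (d′ ℕ.* n))) ⟩
      j ℕ.* n ℕ.+ (d′ ℕ.* n ℕ.+ i)       ≡R.≡⟨ ℕ.+-assoc (j ℕ.* n) (d′ ℕ.* n) i ⟨
      j ℕ.* n ℕ.+ d′ ℕ.* n ℕ.+ i         ≡R.≡⟨ ≡.cong (ℕ._+ i) (ℕ.*-distribʳ-+ n j d′) ⟨
      (j ℕ.+ d′) ℕ.* n ℕ.+ i             ≡R.≡⟨ ≡.cong (λ e → e ℕ.* n ℕ.+ i) (ℕ.m∸n+n≡m (ℕ.<⇒≤ d′<b)) ⟩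
      b ℕ.* n ℕ.+ i                      ≡R.≡⟨ ℕ.+-comm (b ℕ.* n) i ⟩
      i ℕ.+ b ℕ.* n                      ≡R.∎
      where module ≡R = ≡.≡-Reasoning
    -- Otherwise j = b - d′ < μ, and f X^{jn} would lie in S m although its degree i + bn is at
    -- least m.
    conclusion : μ ℕ.+ d′ ℕ.≤ b
    conclusion with μ ℕ.+ d′ ℕ.≤? b
    ... | yes le = le
    ... | no  nle = ⊥-elim (ℕ.<⇒≱ (degree-shift p (j ℕ.* n) m≤D f≈p deg
            (fX∈S j (ℕ.+-cancelʳ-< d′ j μ (≡.subst (ℕ._< μ ℕ.+ d′) (≡.sym (ℕ.m∸n+n≡m (ℕ.<⇒≤ d′<b))) (ℕ.≰⇒> nle))))
            (≡.subst (ℕ._< D) (≡.sym jn+d≡) <D))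
          (≡.subst (m ℕ.≤_) (≡.sym jn+d≡) m≤))

  -- With b = μ the bound μ + d′ ≤ b forces d′ = 0, so f has degree i < n; no other exponent up to i
  -- is congruent to i.
  homogeneous-monomial : ∀ {m i f} μ → i ℕ.< n → Homogeneous i f → ¬ (f ≈ 0#) →
    1 ℕ.≤ μ → (∀ j → j ℕ.< μ → S m (f * X ^ (j ℕ.* n))) → m ℕ.≤ i ℕ.+ μ ℕ.* n → i ℕ.+ μ ℕ.* n ℕ.< D →
    ∃[ a ] (¬ (a K.≈ K.0#) × f ≈ const a * X ^ i)
  homogeneous-monomial {m} {i} {f} μ i<n hom f≉0 1≤μ fX∈S m≤ <D
    with homogeneous-degree μ μ i<n hom f≉0 1≤μ fX∈S m≤ <D
  ... | p , suc d′ , p<D , f≈p , deg , le = ⊥-elim (ℕ.<-irrefl ≡.refl (ℕ.≤-trans (ℕ.≤-trans (ℕ.m≤m+n (suc μ) d′) (ℕ.≤-reflexive (≡.sym (ℕ.+-suc μ d′)))) le))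
  ... | p , zero  , p<D , f≈p , deg , le =
    coeff p i , HasDegree.leading≉0 deg′ , trans f≈p (≈⇒≋ (monomial i p vanish))
    where
    deg′ : HasDegree p i
    deg′ = ≡.subst (HasDegree p) (ℕ.+-identityʳ i) deg
    vanish : ∀ j → ¬ (j ≡ i) → coeff p j K.≈ K.0#
    vanish j j≢i with coeff p j K.≟ K.0#
    ... | yes eq = eq
    ... | no p_j≉0 with j ℕ.≤? i
    ...   | no  j≰i = HasDegree.bounded deg′ j (ℕ.≰⇒> j≰i)
    ...   | yes j≤i = ⊥-elim (j≢i (≡.trans (≡.sym (ℕ.m<n⇒m%n≡m (ℕ.≤-<-trans j≤i i<n)))
              (≡.trans (σ^-injective σ-faithful j i (homogeneous-support {i} {f} p hom f≈p p<D j p_j≉0)) (ℕ.m<n⇒m%n≡m i<n))))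

  -- One multiple more than the class has room for: with μ = b + 1 the bound μ + d′ ≤ b is absurd.
  homogeneous-no-room : ∀ {m i f} b → i ℕ.< n → Homogeneous i f → ¬ (f ≈ 0#) →
    (∀ j → j ℕ.< suc b → S m (f * X ^ (j ℕ.* n))) → m ℕ.≤ i ℕ.+ b ℕ.* n → i ℕ.+ b ℕ.* n ℕ.< D → ⊥
  homogeneous-no-room b i<n hom f≉0 fX∈S m≤ <D
    with homogeneous-degree (suc b) b i<n hom f≉0 (s≤s z≤n) fX∈S m≤ <D
  ... | _ , d′ , _ , _ , _ , le = ℕ.<-irrefl ≡.refl (ℕ.≤-trans (ℕ.m≤m+n (suc b) d′) le)

  -- Multiplication by X may raise the degree to D, where representatives are no longer unique.
  -- Since X p = σ(p) X with σ applied to the coefficients, X is first cancelled on the right; then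
  -- p = c σ(p) is compared coefficient by coefficient.
  eigenvector : ∀ X⁻¹ → X * X⁻¹ ≈ 1# → ∀ g c → ¬ (g ≈ 0#) → g * X ≈ const c * (X * g) →
                ∃[ γ ] (¬ (γ K.≈ K.0#) × γ K.≈ c K.* σ γ)
  eigenvector X⁻¹ XX⁻¹≈1 g c g≉0 gX≈cXg with reduce g
  ... | p , p<D , g≈p with P.degree? isField p
  ...   | inj₁ p≈0 = ⊥-elim (g≉0 (trans g≈p (≈⇒≋ p≈0)))
  ...   | inj₂ (d , hasDegree p_d≉0 _) = coeff p d , p_d≉0 ,
          K.trans (P.coeff-≈ p≈cσp d) (K.trans (P.coeff-• c σp d) (K.*-congˡ (P.coeff-σ p d)))
    where
    σp = List.map σ p
    σp<D : Below D σp
    σp<D i D≤i = K.trans (P.coeff-σ p i) (K.trans (σ.⟦⟧-cong (p<D i D≤i)) σ.0#-homo)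
    pX≈ : p * X ≈ (c • σp) * X
    pX≈ = begin
      p * X                      ≈⟨ *-congʳ X g≈p ⟨
      g * X                      ≈⟨ gX≈cXg ⟩
      const c * (X * g)          ≈⟨ *-congˡ (const c) (*-congˡ X g≈p) ⟩
      const c * (X * p)          ≈⟨ *-congˡ (const c) (≈⇒≋ (P.≈-trans (P.X-* p) (P.≈-sym (P.*-X σp)))) ⟩
      const c * (σp * X)         ≈⟨ *-assoc (const c) σp X ⟨
      const c * σp * X           ≈⟨ *-congʳ X (≈⇒≋ (P.const-* c σp)) ⟩
      (c • σp) * X               ∎
    cancel : ∀ u v → u * X ≈ v * X → u ≈ v
    cancel u v eq = begin
      u                          ≈⟨ *-identityʳ u ⟨
      u * 1#                     ≈⟨ *-congˡ u XX⁻¹≈1 ⟨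
      u * (X * X⁻¹)              ≈⟨ *-assoc u X X⁻¹ ⟨
      u * X * X⁻¹                ≈⟨ *-congʳ X⁻¹ eq ⟩
      v * X * X⁻¹                ≈⟨ *-assoc v X X⁻¹ ⟩
      v * (X * X⁻¹)              ≈⟨ *-congˡ v XX⁻¹≈1 ⟩
      v * 1#                     ≈⟨ *-identityʳ v ⟩
      v                          ∎
    p≈cσp : p P.≈ c • σp
    p≈cσp = unique p (c • σp) p<D (P.Below-• c σp σp<D) (cancel p (c • σp) pX≈)

  -- Conjugation is additive and multiplicative, so a + p X goes to b + r c X, where r represents
  -- the image of p: bounds on the degree are preserved.
  S-conjugate : ∀ {m} g g′ → g′ * g ≈ 1# → (∀ a → ∃[ b ] (g * const a * g′ ≈ const b)) →
                ∃[ c ] (g * X * g′ ≈ const c * X) → ∀ x → S m x → S m (g * x * g′)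
  S-conjugate g g′ g′g≈1 conj-const (c , conj-X) x (p , p<m , x≈p) =
    S-resp {x = g * p * g′} (*-congʳ g′ (*-congˡ g (sym x≈p))) (go p p<m)
    where
    conj-zero : ∀ p → p P.≈ [] → g * p * g′ ≈ 0#
    conj-zero p p≈0 = trans (*-congʳ g′ (trans (*-congˡ g (≈⇒≋ p≈0)) (zeroʳ g))) (zeroˡ g′)

    conj-* : ∀ u v → g * (u * v) * g′ ≈ (g * u * g′) * (g * v * g′)
    conj-* u v = begin
      g * (u * v) * g′                   ≈⟨ *-congʳ g′ (*-assoc g u v) ⟨
      g * u * v * g′                     ≈⟨ *-congʳ g′ (*-congʳ v (trans (*-congˡ (g * u) g′g≈1) (*-identityʳ (g * u)))) ⟨
      g * u * (g′ * g) * v * g′          ≈⟨ *-congʳ g′ (*-congʳ v (*-assoc (g * u) g′ g)) ⟨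
      g * u * g′ * g * v * g′            ≈⟨ *-congʳ g′ (*-assoc (g * u * g′) g v) ⟩
      g * u * g′ * (g * v) * g′          ≈⟨ *-assoc (g * u * g′) (g * v) g′ ⟩
      (g * u * g′) * (g * v * g′)        ∎

    go : ∀ {m} p → Below m p → S m (g * p * g′)
    go         []      p<m = [] , (λ _ _ → K.refl) , conj-zero [] P.≈-refl
    go {zero}  (a ∷ p) p<m = [] , (λ _ _ → K.refl) , conj-zero (a ∷ p) (P.Below-0 p<m)
    go {suc m} (a ∷ p) p<m = let r , r<m , eq = go p (P.Below-∷⁻ p<m) ; b , eq′ = conj-const a in
      const b + r * const c * X ,
      P.Below-+ (const b) (r * const c * X)
        (P.Below-mono (const b) (s≤s z≤n) (P.Below-const b))
        (P.Below-cong (P.≈-sym (P.*-X (r * const c))) (P.Below-∷ (P.Below-*-const r c r<m))) ,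
      (begin
        g * (a ∷ p) * g′                                ≈⟨ *-congʳ g′ (*-congˡ g (≈⇒≋ (P.∷≈const+*X a p))) ⟩
        g * (const a + p * X) * g′                      ≈⟨ *-congʳ g′ (distribˡ g (const a) (p * X)) ⟩
        (g * const a + g * (p * X)) * g′                ≈⟨ distribʳ g′ (g * const a) (g * (p * X)) ⟩
        g * const a * g′ + g * (p * X) * g′             ≈⟨ +-cong eq′ (conj-* p X) ⟩
        const b + (g * p * g′) * (g * X * g′)           ≈⟨ +-congˡ (const b) (*-cong eq conj-X) ⟩
        const b + r * (const c * X)                     ≈⟨ +-congˡ (const b) (*-assoc r (const c) X) ⟨
        const b + r * const c * X                       ∎)

-- Automorphisms of the code

-- What the argument below uses of the quotient R_F and of the code: S is the
-- code 𝒮_k, consisting of the classes of the polynomials of degree < m.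
record SkewSystem {c ℓ} (A : CommutativeRing c ℓ)
  (σ : CommutativeRing.Carrier A → CommutativeRing.Carrier A) (n D m : ℕ) (c′ ℓ′ ℓₛ : Level) :
  Set (c ⊔ ℓ ⊔ Level.suc (c′ ⊔ ℓ′ ⊔ ℓₛ)) where

  private
    module K = CommutativeRing A

  field
    Q : Ring c′ ℓ′

  open Ring Q

  field
    1≉0           : ¬ (1# ≈ 0#)
    const         : K.Carrier → Carrier
    const-cong    : ∀ {a b} → a K.≈ b → const a ≈ const b
    const-0       : const K.0# ≈ 0#
    const-1       : const K.1# ≈ 1#
    const-*       : ∀ a b → const (a K.* b) ≈ const a * const b
    X X⁻¹         : Carrier
    XX⁻¹≈1        : X * X⁻¹ ≈ 1#
    X⁻¹X≈1        : X⁻¹ * X ≈ 1#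
    X-const       : ∀ a → X * const a ≈ const (σ a) * X
    X^            : ℕ → Carrier
    X^-zero       : X^ 0 ≈ 1#
    X^-suc        : ∀ i → X^ (suc i) ≈ X * X^ i
    generated     : ∀ z → (∀ a → z * const a ≈ const a * z) → z * X ≈ X * z → ∀ x → z * x ≈ x * z

    S             : Carrier → Set ℓₛ
    S-resp        : ∀ {x y} → x ≈ y → S x → S y
    S-const-*     : ∀ {x} a → S x → S (const a * x)
    S-*-const     : ∀ {x} a → S x → S (x * const a)
    S-X^          : ∀ i → i ℕ.< m → S (X^ i)
    S-conjugate   : ∀ g g′ → g′ * g ≈ 1# → (∀ a → ∃[ b ] (g * const a * g′ ≈ const b)) →
                    ∃[ c ] (g * X * g′ ≈ const c * X) → ∀ x → S x → S (g * x * g′)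
    idealizerˡ    : ∀ y → (∀ x → S x → S (y * x)) → ∃[ a ] (y ≈ const a)
    idealizerʳ    : ∀ y → (∀ x → S x → S (x * y)) → ∃[ a ] (y ≈ const a)

  Homogeneous : ℕ → Carrier → Set (c ⊔ ℓ′)
  Homogeneous i f = ∀ a → f * const a ≈ const ((σ ^∘ i) a) * f

  field
    homogeneity   : ∀ y → ¬ (y ≈ 0#) → (∀ a → ∃[ b ] (y * const a ≈ const b * y)) → ∃[ d ] Homogeneous d y
    monomial      : ∀ {i f} μ → i ℕ.< n → Homogeneous i f → ¬ (f ≈ 0#) → 1 ℕ.≤ μ →
                    (∀ j → j ℕ.< μ → S (f * X^ (j ℕ.* n))) → m ℕ.≤ i ℕ.+ μ ℕ.* n → i ℕ.+ μ ℕ.* n ℕ.< D →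
                    ∃[ a ] (¬ (a K.≈ K.0#) × f ≈ const a * X^ i)
    no-room       : ∀ {i f} b → i ℕ.< n → Homogeneous i f → ¬ (f ≈ 0#) →
                    (∀ j → j ℕ.< suc b → S (f * X^ (j ℕ.* n))) → m ℕ.≤ i ℕ.+ b ℕ.* n → i ℕ.+ b ℕ.* n ℕ.< D → ⊥
    eigenvector   : ∀ g c → ¬ (g ≈ 0#) → g * X ≈ const c * (X * g) →
                    ∃[ γ ] (¬ (γ K.≈ K.0#) × γ K.≈ c K.* σ γ)

module SkewSystemProperties {c ℓ c′ ℓ′ ℓₛ} (A : CommutativeRing c ℓ) (isField : IsDiscreteField A)
  (σ : CommutativeRing.Carrier A → CommutativeRing.Carrier A)
  (isHom : IsRingHomomorphism (CommutativeRing.rawRing A) (CommutativeRing.rawRing A) σ)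
  (n D m : ℕ) .{{_ : ℕ.NonZero n}}
  (σ-order : ∀ x → CommutativeRing._≈_ A ((σ ^∘ n) x) x)
  (Y : SkewSystem A σ n D m c′ ℓ′ ℓₛ) where

  module K where
    open CommutativeRing A public
    open DiscreteField A isField public using (inverse; *-cancelˡ-≉0; *-≉0; xy≈1⇒x≉0)
  module σ where
    open IsRingHomomorphism isHom public
    open RingEndomorphism A σ isHom public
    open CyclicPowers A σ isHom n σ-order public

  open SkewSystem Y public
  open Ring Q public hiding (zero; rawRing)
  open import Algebra.Solver.Monoid *-monoid public using (solve; _⊕_; _⊜_)
  open import Relation.Binary.Reasoning.Setoid setoid

  xy≈1⇒xyz≈z : ∀ {x y} z → x * y ≈ 1# → x * (y * z) ≈ z
  xy≈1⇒xyz≈z {x} {y} z xy≈1 = trans (sym (*-assoc x y z)) (trans (*-congʳ xy≈1) (*-identityˡ z))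

  xy≈1⇒zxy≈z : ∀ {x y} z → x * y ≈ 1# → z * x * y ≈ z
  xy≈1⇒zxy≈z {x} {y} z xy≈1 = trans (*-assoc z x y) (trans (*-congˡ xy≈1) (*-identityʳ z))

  const-unit : ∀ {a} b → a K.* b K.≈ K.1# → const a * const b ≈ 1#
  const-unit {a} b ab≈1 = trans (sym (const-* a b)) (trans (const-cong ab≈1) const-1)

  const-comm : ∀ a b → const a * const b ≈ const b * const a
  const-comm a b = trans (sym (const-* a b)) (trans (const-cong (K.*-comm a b)) (const-* b a))

  unit≉0 : ∀ {x y} → x * y ≈ 1# → ¬ (x ≈ 0#)
  unit≉0 {x} {y} xy≈1 x≈0 = 1≉0 (trans (sym xy≈1) (trans (*-congʳ x≈0) (zeroˡ y)))

  unit-* : ∀ {x x′ y y′} → x * x′ ≈ 1# → y * y′ ≈ 1# → (x * y) * (y′ * x′) ≈ 1#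
  unit-* {x} {x′} {y} {y′} xx′≈1 yy′≈1 = begin
    (x * y) * (y′ * x′)    ≈⟨ *-assoc x y (y′ * x′) ⟩
    x * (y * (y′ * x′))    ≈⟨ *-congˡ (xy≈1⇒xyz≈z x′ yy′≈1) ⟩
    x * x′                 ≈⟨ xx′≈1 ⟩
    1#                     ∎

  X^-+ : ∀ i j → X^ (i ℕ.+ j) ≈ X^ i * X^ j
  X^-+ zero    j = sym (trans (*-congʳ X^-zero) (*-identityˡ (X^ j)))
  X^-+ (suc i) j = begin
    X^ (suc (i ℕ.+ j))     ≈⟨ X^-suc (i ℕ.+ j) ⟩
    X * X^ (i ℕ.+ j)       ≈⟨ *-congˡ (X^-+ i j) ⟩
    X * (X^ i * X^ j)      ≈⟨ *-assoc X (X^ i) (X^ j) ⟨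
    X * X^ i * X^ j        ≈⟨ *-congʳ (X^-suc i) ⟨
    X^ (suc i) * X^ j      ∎

  X^-1 : X^ 1 ≈ X
  X^-1 = trans (X^-suc 0) (trans (*-congˡ X^-zero) (*-identityʳ X))

  X^-comm : ∀ i → X^ i * X ≈ X * X^ i
  X^-comm i = begin
    X^ i * X               ≈⟨ *-congˡ X^-1 ⟨
    X^ i * X^ 1            ≈⟨ X^-+ i 1 ⟨
    X^ (i ℕ.+ 1)           ≈⟨ reflexive (≡.cong X^ (ℕ.+-comm i 1)) ⟩
    X^ (suc i)             ≈⟨ X^-suc i ⟩
    X * X^ i               ∎

  X^-inverse : ∀ i → ∃[ y ] (X^ i * y ≈ 1# × y * X^ i ≈ 1#)
  X^-inverse zero    = 1# , trans (*-congʳ X^-zero) (*-identityˡ 1#) , trans (*-congˡ X^-zero) (*-identityˡ 1#)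
  X^-inverse (suc i) = let y , Xy , yX = X^-inverse i in
    y * X⁻¹ , trans (*-congʳ (X^-suc i)) (unit-* XX⁻¹≈1 Xy) , trans (*-congˡ (X^-suc i)) (unit-* yX X⁻¹X≈1)

  Homogeneous-resp : ∀ {i j f} → (∀ a → (σ ^∘ i) a K.≈ (σ ^∘ j) a) → Homogeneous i f → Homogeneous j f
  Homogeneous-resp eq hom a = trans (hom a) (*-congʳ (const-cong (eq a)))

  Homogeneous-≈ : ∀ {i f g} → f ≈ g → Homogeneous i f → Homogeneous i g
  Homogeneous-≈ eq hom a = trans (*-congʳ (sym eq)) (trans (hom a) (*-congˡ eq))

  Homogeneous-* : ∀ {i j f g} → Homogeneous i f → Homogeneous j g → Homogeneous (i ℕ.+ j) (f * g)
  Homogeneous-* {i} {j} {f} {g} hom-f hom-g a = begin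
    f * g * const a                                 ≈⟨ *-assoc f g (const a) ⟩
    f * (g * const a)                               ≈⟨ *-congˡ (hom-g a) ⟩
    f * (const ((σ ^∘ j) a) * g)                    ≈⟨ *-assoc f (const ((σ ^∘ j) a)) g ⟨
    f * const ((σ ^∘ j) a) * g                      ≈⟨ *-congʳ (hom-f ((σ ^∘ j) a)) ⟩
    const ((σ ^∘ i) ((σ ^∘ j) a)) * f * g           ≈⟨ *-assoc _ f g ⟩
    const ((σ ^∘ i) ((σ ^∘ j) a)) * (f * g)         ≈⟨ *-congʳ (const-cong (K.reflexive (≡.sym (^∘-+ σ i j a)))) ⟩
    const ((σ ^∘ (i ℕ.+ j)) a) * (f * g)            ∎

  X^-homogeneous : ∀ i → Homogeneous i (X^ i)
  X^-homogeneous zero    a = trans (*-congʳ X^-zero) (trans (*-identityˡ (const a)) (sym (trans (*-congˡ X^-zero) (*-identityʳ (const a)))))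
  X^-homogeneous (suc i) = Homogeneous-≈ {suc i} (sym (X^-suc i)) (Homogeneous-* {1} {i} X-const (X^-homogeneous i))

  X^-multiple-central : ∀ j x → X^ (j ℕ.* n) * x ≈ x * X^ (j ℕ.* n)
  X^-multiple-central j = generated (X^ (j ℕ.* n))
    (λ a → trans (X^-homogeneous (j ℕ.* n) a) (*-congʳ (const-cong (σ.σ^-multiple j a))))
    (X^-comm (j ℕ.* n))

  homogeneous-conjugate : ∀ {t g g′} → Homogeneous t g → g * g′ ≈ 1# → ∀ a → g * const a * g′ ≈ const ((σ ^∘ t) a)
  homogeneous-conjugate {t} {g} {g′} hom gg′≈1 a = trans (*-congʳ (hom a)) (xy≈1⇒zxy≈z _ gg′≈1)

  homogeneous-inverse : ∀ {t g g′} → t ℕ.≤ n → Homogeneous t g → g′ * g ≈ 1# →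
                        ∀ a → g′ * const a * g ≈ const ((σ ^∘ (n ℕ.∸ t)) a)
  homogeneous-inverse {t} {g} {g′} t≤n hom g′g≈1 a = begin
    g′ * const a * g                     ≈⟨ *-congʳ (*-congˡ (const-cong (σ.σ^-inverseʳ t t≤n a))) ⟨
    g′ * const ((σ ^∘ t) b) * g          ≈⟨ *-assoc g′ _ g ⟩
    g′ * (const ((σ ^∘ t) b) * g)        ≈⟨ *-congˡ (hom b) ⟨
    g′ * (g * const b)                   ≈⟨ xy≈1⇒xyz≈z (const b) g′g≈1 ⟩
    const b                              ∎
    where b = (σ ^∘ (n ℕ.∸ t)) a

  -- For a unit g this says that conjugation by g acts on K as σ^t and maps X into K X. The units
  -- with this property are the elements of 𝒢, here described without their central factor.
  record Monomial (t : ℕ) (g : Carrier) : Set (c ⊔ ℓ ⊔ ℓ′) where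
    field
      homogeneous : Homogeneous t g
      factor      : K.Carrier
      factor≉0    : ¬ (factor K.≈ K.0#)
      gX≈cXg      : g * X ≈ const factor * (X * g)

  module _ {t g g′} (t≤n : t ℕ.≤ n) (gg′≈1 : g * g′ ≈ 1#) (g′g≈1 : g′ * g ≈ 1#) (g-monomial : Monomial t g) where

    open Monomial g-monomial renaming (factor to κ)

    S-conjugate-by : ∀ x → S x → S (g * x * g′)
    S-conjugate-by = S-conjugate g g′ g′g≈1
      (λ a → (σ ^∘ t) a , homogeneous-conjugate {t} homogeneous gg′≈1 a)
      (κ , (begin
        g * X * g′               ≈⟨ *-congʳ gX≈cXg ⟩
        const κ * (X * g) * g′   ≈⟨ *-congʳ (*-assoc (const κ) X g) ⟨
        const κ * X * g * g′     ≈⟨ xy≈1⇒zxy≈z (const κ * X) gg′≈1 ⟩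
        const κ * X              ∎))

    S-conjugate-by⁻¹ : ∀ x → S x → S (g′ * x * g)
    S-conjugate-by⁻¹ = S-conjugate g′ g gg′≈1
      (λ a → (σ ^∘ (n ℕ.∸ t)) a , homogeneous-inverse t≤n homogeneous g′g≈1 a)
      -- As X g = κ⁻¹ g X, the conjugate g⁻¹ X g equals (g⁻¹ κ⁻¹ g) X, and conjugation by g⁻¹ acts
      -- on K as σ^{n-t}.
      ((σ ^∘ (n ℕ.∸ t)) κ⁻¹ , (begin
        g′ * X * g                                     ≈⟨ *-assoc g′ X g ⟩
        g′ * (X * g)                                   ≈⟨ *-congˡ (xy≈1⇒xyz≈z (X * g) (const-unit κ (K.trans (K.*-comm κ⁻¹ κ) κκ⁻¹))) ⟨
        g′ * (const κ⁻¹ * (const κ * (X * g)))         ≈⟨ *-congˡ (*-congˡ gX≈cXg) ⟨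
        g′ * (const κ⁻¹ * (g * X))                     ≈⟨ solve 4 (λ a b c d → (a ⊕ (b ⊕ (c ⊕ d))) ⊜ (((a ⊕ b) ⊕ c) ⊕ d)) refl g′ (const κ⁻¹) g X ⟩
        g′ * const κ⁻¹ * g * X                         ≈⟨ *-congʳ (homogeneous-inverse t≤n homogeneous g′g≈1 κ⁻¹) ⟩
        const ((σ ^∘ (n ℕ.∸ t)) κ⁻¹) * X               ∎))
      where
      κ⁻¹ = proj₁ (K.inverse κ factor≉0)
      κκ⁻¹ = proj₂ (K.inverse κ factor≉0)

  open UnitsAndCenter (Ring.rawRing Q) using (CenterUnit)

  InG : Carrier → Set (c ⊔ ℓ ⊔ c′ ⊔ ℓ′)
  InG g = ∃[ z ] ∃[ γ ] ∃[ t ] (CenterUnit z × ¬ (γ K.≈ K.0#) × t ℕ.< n × g ≈ z * const γ * X^ t)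

  InG⇒Monomial : ∀ {g} ((_ , _ , t , _) : InG g) → Monomial t g
  InG⇒Monomial {g} (z , γ , t , (z-central , _) , γ≉0 , t<n , g≈) = record
    { homogeneous = Homogeneous-≈ {t} (sym g≈) λ a → begin
        z * const γ * X^ t * const a                    ≈⟨ *-assoc _ (X^ t) (const a) ⟩
        z * const γ * (X^ t * const a)                  ≈⟨ *-congˡ (X^-homogeneous t a) ⟩
        z * const γ * (const ((σ ^∘ t) a) * X^ t)       ≈⟨ *-congʳ (z-central (const γ)) ⟩
        const γ * z * (const ((σ ^∘ t) a) * X^ t)       ≈⟨ solve 4 (λ a b c d → ((a ⊕ b) ⊕ (c ⊕ d)) ⊜ (a ⊕ ((b ⊕ c) ⊕ d))) refl (const γ) z (const ((σ ^∘ t) a)) (X^ t) ⟩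
        const γ * (z * const ((σ ^∘ t) a) * X^ t)       ≈⟨ *-congˡ (*-congʳ (z-central _)) ⟩
        const γ * (const ((σ ^∘ t) a) * z * X^ t)       ≈⟨ solve 4 (λ a b c d → (a ⊕ ((c ⊕ b) ⊕ d)) ⊜ ((a ⊕ c) ⊕ (b ⊕ d))) refl (const γ) z (const ((σ ^∘ t) a)) (X^ t) ⟩
        const γ * const ((σ ^∘ t) a) * (z * X^ t)       ≈⟨ *-congʳ (const-comm γ ((σ ^∘ t) a)) ⟩
        const ((σ ^∘ t) a) * const γ * (z * X^ t)       ≈⟨ solve 4 (λ a b c d → ((c ⊕ a) ⊕ (b ⊕ d)) ⊜ (c ⊕ ((a ⊕ b) ⊕ d))) refl (const γ) z (const ((σ ^∘ t) a)) (X^ t) ⟩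
        const ((σ ^∘ t) a) * (const γ * z * X^ t)       ≈⟨ *-congˡ (*-congʳ (z-central (const γ))) ⟨
        const ((σ ^∘ t) a) * (z * const γ * X^ t)       ∎
    -- Chosen so that γ X = γ σ(γ)⁻¹ σ(γ) X = γ σ(γ)⁻¹ X γ.
    ; factor = γ K.* σ γ⁻¹
    ; factor≉0 = K.*-≉0 γ≉0 (K.xy≈1⇒x≉0 (K.trans (K.*-comm _ _) σγσγ⁻¹))
    ; gX≈cXg = begin
        g * X                                           ≈⟨ *-congʳ g≈ ⟩
        z * const γ * X^ t * X                          ≈⟨ *-assoc _ (X^ t) X ⟩
        z * const γ * (X^ t * X)                        ≈⟨ *-congˡ (X^-comm t) ⟩
        z * const γ * (X * X^ t)                        ≈⟨ *-congʳ (*-congˡ (const-cong κσγ≈γ)) ⟨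
        z * const (κ K.* σ γ) * (X * X^ t)             ≈⟨ *-congʳ (*-congˡ (const-* κ (σ γ))) ⟩
        z * (const κ * const (σ γ)) * (X * X^ t)       ≈⟨ solve 5 (λ z a b x y → ((z ⊕ (a ⊕ b)) ⊕ (x ⊕ y)) ⊜ (((z ⊕ a) ⊕ (b ⊕ x)) ⊕ y)) refl z (const κ) (const (σ γ)) X (X^ t) ⟩
        z * const κ * (const (σ γ) * X) * X^ t         ≈⟨ *-congʳ (*-cong (z-central (const κ)) (sym (X-const γ))) ⟩
        const κ * z * (X * const γ) * X^ t             ≈⟨ solve 5 (λ z a b x y → (((a ⊕ z) ⊕ (x ⊕ b)) ⊕ y) ⊜ (a ⊕ ((z ⊕ x) ⊕ (b ⊕ y)))) refl z (const κ) (const γ) X (X^ t) ⟩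
        const κ * (z * X * (const γ * X^ t))           ≈⟨ *-congˡ (*-congʳ (z-central X)) ⟩
        const κ * (X * z * (const γ * X^ t))           ≈⟨ *-congˡ (solve 4 (λ z b x y → ((x ⊕ z) ⊕ (b ⊕ y)) ⊜ (x ⊕ ((z ⊕ b) ⊕ y))) refl z (const γ) X (X^ t)) ⟩
        const κ * (X * (z * const γ * X^ t))           ≈⟨ *-congˡ (*-congˡ g≈) ⟨
        const κ * (X * g)                              ∎
    }
    where
    γ⁻¹ = proj₁ (K.inverse γ γ≉0)
    σγσγ⁻¹ : σ γ K.* σ γ⁻¹ K.≈ K.1#
    σγσγ⁻¹ = K.trans (K.sym (σ.*-homo γ γ⁻¹)) (K.trans (σ.⟦⟧-cong (proj₂ (K.inverse γ γ≉0))) σ.1#-homo)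
    κ = γ K.* σ γ⁻¹
    κσγ≈γ : κ K.* σ γ K.≈ γ
    κσγ≈γ = K.trans (K.*-assoc γ (σ γ⁻¹) (σ γ)) (K.trans (K.*-congˡ (K.trans (K.*-comm _ _) σγσγ⁻¹)) (K.*-identityʳ γ))

  inverse-central : ∀ {z w} → z * w ≈ 1# → w * z ≈ 1# → (∀ x → z * x ≈ x * z) → ∀ x → w * x ≈ x * w
  inverse-central {z} {w} zw≈1 wz≈1 z-central x = begin
    w * x                  ≈⟨ xy≈1⇒zxy≈z (w * x) zw≈1 ⟨
    w * x * z * w          ≈⟨ *-congʳ (*-assoc w x z) ⟩
    w * (x * z) * w        ≈⟨ *-congʳ (*-congˡ (z-central x)) ⟨
    w * (z * x) * w        ≈⟨ *-congʳ (xy≈1⇒xyz≈z x wz≈1) ⟩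
    x * w                  ∎

  -- With γ = c σ(γ), the element z = γ⁻¹ g X⁻ᵗ commutes with K and with X.
  Monomial⇒InG : ∀ {t g g′} → t ℕ.< n → g * g′ ≈ 1# → g′ * g ≈ 1# → Monomial t g → InG g
  Monomial⇒InG {t} {g} {g′} t<n gg′≈1 g′g≈1 g-monomial =
    z , γ , t , (z-central , w , inverse-central zw≈1 wz≈1 z-central , zw≈1) , γ≉0 , t<n , g≈
    where
    open Monomial g-monomial renaming (factor to κ)
    eigen = eigenvector g κ (unit≉0 gg′≈1) gX≈cXg
    γ = proj₁ eigen
    γ≉0 = proj₁ (proj₂ eigen)
    γ≈κσγ = proj₂ (proj₂ eigen)
    γ⁻¹ = proj₁ (K.inverse γ γ≉0)
    γγ⁻¹ = proj₂ (K.inverse γ γ≉0)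
    γ⁻¹γ = K.trans (K.*-comm γ⁻¹ γ) γγ⁻¹
    y = proj₁ (X^-inverse t)
    Xy≈1 = proj₁ (proj₂ (X^-inverse t))
    yX≈1 = proj₂ (proj₂ (X^-inverse t))

    -- The eigenvector equation γ = κ σ(γ), rewritten in the form in which X can be moved to the
    -- left of γ⁻¹ in `z-X`.
    γ⁻¹κ≈σγ⁻¹ : γ⁻¹ K.* κ K.≈ σ γ⁻¹
    γ⁻¹κ≈σγ⁻¹ = K.*-cancelˡ-≉0 γ≉0 (K.trans (K.sym (K.*-assoc γ γ⁻¹ κ)) (K.trans (K.*-congʳ γγ⁻¹) (K.trans (K.*-comm K.1# κ)
      (K.sym (K.trans (K.*-congʳ γ≈κσγ) (K.trans (K.*-assoc κ (σ γ) (σ γ⁻¹))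
        (K.*-congˡ (K.trans (K.sym (σ.*-homo γ γ⁻¹)) (K.trans (σ.⟦⟧-cong γγ⁻¹) σ.1#-homo)))))))))

    z = const γ⁻¹ * g * y
    w = X^ t * (g′ * const γ)

    zw≈1 : z * w ≈ 1#
    zw≈1 = unit-* (unit-* (const-unit γ γ⁻¹γ) gg′≈1) yX≈1

    wz≈1 : w * z ≈ 1#
    wz≈1 = trans (*-congˡ (*-assoc (const γ⁻¹) g y)) (begin
      X^ t * (g′ * const γ) * (const γ⁻¹ * (g * y))   ≈⟨ *-congˡ (*-assoc (const γ⁻¹) g y) ⟨
      X^ t * (g′ * const γ) * (const γ⁻¹ * g * y)     ≈⟨ solve 4 (λ p q r s → ((p ⊕ q) ⊕ (r ⊕ s)) ⊜ (p ⊕ ((q ⊕ r) ⊕ s))) refl (X^ t) (g′ * const γ) (const γ⁻¹ * g) y ⟩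
      X^ t * ((g′ * const γ) * (const γ⁻¹ * g) * y)   ≈⟨ *-congˡ (*-congʳ (unit-* g′g≈1 (const-unit γ⁻¹ γγ⁻¹))) ⟩
      X^ t * (1# * y)                                 ≈⟨ *-congˡ (*-identityˡ y) ⟩
      X^ t * y                                        ≈⟨ Xy≈1 ⟩
      1#                                              ∎)

    yX≈Xy : y * X ≈ X * y
    yX≈Xy = begin
      y * X                  ≈⟨ xy≈1⇒zxy≈z (y * X) Xy≈1 ⟨
      y * X * X^ t * y       ≈⟨ *-congʳ (*-assoc y X (X^ t)) ⟩
      y * (X * X^ t) * y     ≈⟨ *-congʳ (*-congˡ (X^-comm t)) ⟨
      y * (X^ t * X) * y     ≈⟨ *-congʳ (xy≈1⇒xyz≈z X yX≈1) ⟩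
      X * y                  ∎

    z-X : z * X ≈ X * z
    z-X = begin
      const γ⁻¹ * g * y * X                       ≈⟨ *-assoc (const γ⁻¹ * g) y X ⟩
      const γ⁻¹ * g * (y * X)                     ≈⟨ *-congˡ yX≈Xy ⟩
      const γ⁻¹ * g * (X * y)                     ≈⟨ solve 4 (λ p q r s → ((p ⊕ q) ⊕ (r ⊕ s)) ⊜ (p ⊕ ((q ⊕ r) ⊕ s))) refl (const γ⁻¹) g X y ⟩
      const γ⁻¹ * (g * X * y)                     ≈⟨ *-congˡ (*-congʳ gX≈cXg) ⟩
      const γ⁻¹ * (const κ * (X * g) * y)         ≈⟨ solve 5 (λ p q r s u → (p ⊕ ((q ⊕ (r ⊕ s)) ⊕ u)) ⊜ (((p ⊕ q) ⊕ r) ⊕ (s ⊕ u))) refl (const γ⁻¹) (const κ) X g y ⟩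
      const γ⁻¹ * const κ * X * (g * y)           ≈⟨ *-congʳ (*-congʳ (trans (sym (const-* γ⁻¹ κ)) (const-cong γ⁻¹κ≈σγ⁻¹))) ⟩
      const (σ γ⁻¹) * X * (g * y)                 ≈⟨ *-congʳ (X-const γ⁻¹) ⟨
      X * const γ⁻¹ * (g * y)                     ≈⟨ solve 4 (λ p q r s → ((r ⊕ p) ⊕ (q ⊕ s)) ⊜ (r ⊕ ((p ⊕ q) ⊕ s))) refl (const γ⁻¹) g X y ⟩
      X * (const γ⁻¹ * g * y)                     ∎

    -- With a = σ^t(b), one has X⁻ᵗ a = b X⁻ᵗ and g b = a g: the two twists cancel.
    z-const : ∀ a → z * const a ≈ const a * z
    z-const a = begin
      const γ⁻¹ * g * y * const a                 ≈⟨ *-congˡ (const-cong (σ.σ^-inverseʳ t (ℕ.<⇒≤ t<n) a)) ⟨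
      const γ⁻¹ * g * y * const ((σ ^∘ t) b)      ≈⟨ xy≈1⇒zxy≈z _ Xy≈1 ⟨
      const γ⁻¹ * g * y * const ((σ ^∘ t) b) * X^ t * y
                                                  ≈⟨ *-congʳ (*-assoc _ (const ((σ ^∘ t) b)) (X^ t)) ⟩
      const γ⁻¹ * g * y * (const ((σ ^∘ t) b) * X^ t) * y
                                                  ≈⟨ *-congʳ (*-congˡ (X^-homogeneous t b)) ⟨
      const γ⁻¹ * g * y * (X^ t * const b) * y    ≈⟨ solve 6 (λ p q r s u v → ((((p ⊕ q) ⊕ r) ⊕ (s ⊕ u)) ⊕ v) ⊜ ((p ⊕ (((q ⊕ r) ⊕ s) ⊕ u)) ⊕ v)) refl (const γ⁻¹) g y (X^ t) (const b) y ⟩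
      const γ⁻¹ * (g * y * X^ t * const b) * y    ≈⟨ *-congʳ (*-congˡ (*-congʳ (xy≈1⇒zxy≈z g yX≈1))) ⟩
      const γ⁻¹ * (g * const b) * y               ≈⟨ *-congʳ (*-congˡ (homogeneous b)) ⟩
      const γ⁻¹ * (const ((σ ^∘ t) b) * g) * y    ≈⟨ *-congʳ (*-congˡ (*-congʳ (const-cong (σ.σ^-inverseʳ t (ℕ.<⇒≤ t<n) a)))) ⟩
      const γ⁻¹ * (const a * g) * y               ≈⟨ *-congʳ (*-assoc (const γ⁻¹) (const a) g) ⟨
      const γ⁻¹ * const a * g * y                 ≈⟨ *-congʳ (*-congʳ (const-comm γ⁻¹ a)) ⟩
      const a * const γ⁻¹ * g * y                 ≈⟨ solve 4 (λ p q r s → (((p ⊕ q) ⊕ r) ⊕ s) ⊜ (p ⊕ ((q ⊕ r) ⊕ s))) refl (const a) (const γ⁻¹) g y ⟩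
      const a * z                                 ∎
      where b = (σ ^∘ (n ℕ.∸ t)) a

    z-central : ∀ x → z * x ≈ x * z
    z-central = generated z z-const z-X

    g≈ : g ≈ z * const γ * X^ t
    g≈ = sym (begin
      z * const γ * X^ t                          ≈⟨ *-congʳ (z-const γ) ⟩
      const γ * z * X^ t                          ≈⟨ solve 5 (λ p q r s u → ((p ⊕ ((q ⊕ r) ⊕ s)) ⊕ u) ⊜ (((p ⊕ (q ⊕ r)) ⊕ s) ⊕ u)) refl (const γ) (const γ⁻¹) g y (X^ t) ⟩
      const γ * (const γ⁻¹ * g) * y * X^ t        ≈⟨ xy≈1⇒zxy≈z _ yX≈1 ⟩
      const γ * (const γ⁻¹ * g)                   ≈⟨ xy≈1⇒xyz≈z g (const-unit γ⁻¹ γγ⁻¹) ⟩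
      g                                           ∎)

-- The degree count that forces monomials

module Rigidity {c ℓ c′ ℓ′ ℓₛ} (A : CommutativeRing c ℓ) (isField : IsDiscreteField A)
  (σ : CommutativeRing.Carrier A → CommutativeRing.Carrier A)
  (isHom : IsRingHomomorphism (CommutativeRing.rawRing A) (CommutativeRing.rawRing A) σ)
  (n s m : ℕ) .{{_ : ℕ.NonZero n}}
  (2≤n : 2 ℕ.≤ n) (2≤s : 2 ℕ.≤ s) (2≤m : 2 ℕ.≤ m) (m+2≤sn : m ℕ.+ 2 ℕ.≤ s ℕ.* n)
  (σ-order : ∀ x → CommutativeRing._≈_ A ((σ ^∘ n) x) x)
  (Y : SkewSystem A σ n (s ℕ.* n) m c′ ℓ′ ℓₛ) where

  open SkewSystemProperties A isField σ isHom n (s ℕ.* n) m σ-order Y public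
  open import Relation.Binary.Reasoning.Setoid setoid

  private
    a b : ℕ
    a = m ℕ./ n
    b = m ℕ.% n

    m≡b+an : m ≡ b ℕ.+ a ℕ.* n
    m≡b+an = ℕ.m≡m%n+[m/n]*n m n

    b<n : b ℕ.< n
    b<n = ℕ.m%n<n m n

    a<s : a ℕ.< s
    a<s = ℕ.*-cancelʳ-< n a s (ℕ.≤-<-trans (ℕ.m≤n+m (a ℕ.* n) b)
      (≡.subst (ℕ._< s ℕ.* n) m≡b+an (ℕ.<-≤-trans (ℕ.m<m+n m (s≤s z≤n)) m+2≤sn)))

    i+en<sn : ∀ {i e} → i ℕ.< n → suc e ℕ.≤ s → i ℕ.+ e ℕ.* n ℕ.< s ℕ.* n
    i+en<sn {i} {e} i<n e<s = ℕ.<-≤-trans (ℕ.+-monoˡ-< (e ℕ.* n) i<n) (ℕ.*-monoˡ-≤ n e<s)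

    b≤i⇒m≤i+an : ∀ {i} → b ℕ.≤ i → m ℕ.≤ i ℕ.+ a ℕ.* n
    b≤i⇒m≤i+an {i} b≤i = ≡.subst (ℕ._≤ i ℕ.+ a ℕ.* n) (≡.sym m≡b+an) (ℕ.+-monoˡ-≤ (a ℕ.* n) b≤i)

    i<b⇒i+jn<m : ∀ {i} → i ℕ.< b → ∀ j → j ℕ.< suc a → i ℕ.+ j ℕ.* n ℕ.< m
    i<b⇒i+jn<m {i} i<b j (s≤s j≤a) = ≡.subst (i ℕ.+ j ℕ.* n ℕ.<_) (≡.sym m≡b+an) (ℕ.+-mono-<-≤ i<b (ℕ.*-monoˡ-≤ n j≤a))

    i<n⇒i+jn<m : ∀ {i} → i ℕ.< n → ∀ j → j ℕ.< a → i ℕ.+ j ℕ.* n ℕ.< m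
    i<n⇒i+jn<m {i} i<n j j<a = ℕ.<-≤-trans (ℕ.+-monoˡ-< (j ℕ.* n) i<n)
      (ℕ.≤-trans (ℕ.*-monoˡ-≤ n j<a) (ℕ.≤-trans (ℕ.m≤n+m (a ℕ.* n) b) (ℕ.≤-reflexive (≡.sym m≡b+an))))

    b≤1⇒1≤a : b ℕ.≤ 1 → 1 ℕ.≤ a
    b≤1⇒1≤a b≤1 = ℕ.n≢0⇒n>0 λ a≡0 → ℕ.<⇒≱ (s≤s b≤1)
      (≡.subst (2 ℕ.≤_) (≡.trans m≡b+an (≡.trans (≡.cong (λ e → b ℕ.+ e ℕ.* n) a≡0) (ℕ.+-identityʳ b))) 2≤m)

  module Automorphism {g g′ h h′} (gg′≈1 : g * g′ ≈ 1#) (g′g≈1 : g′ * g ≈ 1#) (hh′≈1 : h * h′ ≈ 1#) (h′h≈1 : h′ * h ≈ 1#)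
    (forward : ∀ x → S x → S (g * x * h)) (backward : ∀ x → S x → S (g′ * x * h′)) where

    private
      g-normalizes : ∀ α → ∃[ β ] (g * const α ≈ const β * g)
      g-normalizes α = β , (begin
        g * const α                ≈⟨ xy≈1⇒zxy≈z (g * const α) g′g≈1 ⟨
        g * const α * g′ * g       ≈⟨ *-congʳ eq ⟩
        const β * g                ∎)
        where
        -- An element of S is carried back by the inverse automorphism, multiplied by α, and carried
        -- forward again; this amounts to left multiplication by g α g⁻¹.
        idealizer = idealizerˡ (g * const α * g′) λ x x∈S → S-resp (begin
          g * (const α * (g′ * x * h′)) * h        ≈⟨ solve 6 (λ g a g′ x h′ h → ((g ⊕ (a ⊕ ((g′ ⊕ x) ⊕ h′))) ⊕ h) ⊜ (((((g ⊕ a) ⊕ g′) ⊕ x) ⊕ h′) ⊕ h)) refl g (const α) g′ x h′ h ⟩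
          g * const α * g′ * x * h′ * h            ≈⟨ xy≈1⇒zxy≈z _ h′h≈1 ⟩
          g * const α * g′ * x                     ∎)
          (forward _ (S-const-* α (backward x x∈S)))
        β = proj₁ idealizer
        eq = proj₂ idealizer

      h-normalizes : ∀ α → ∃[ β ] (h * const α ≈ const β * h)
      h-normalizes α = β , (begin
        h * const α                ≈⟨ xy≈1⇒zxy≈z (h * const α) h′h≈1 ⟨
        h * const α * h′ * h       ≈⟨ *-congʳ eq ⟩
        const β * h                ∎)
        where
        idealizer = idealizerʳ (h * const α * h′) λ x x∈S → S-resp (begin
          g′ * (g * x * h * const α) * h′          ≈⟨ solve 6 (λ g a g′ x h′ h → ((g′ ⊕ (((g ⊕ x) ⊕ h) ⊕ a)) ⊕ h′) ⊜ (g′ ⊕ (g ⊕ (x ⊕ ((h ⊕ a) ⊕ h′))))) refl g (const α) g′ x h′ h ⟩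
          g′ * (g * (x * (h * const α * h′)))      ≈⟨ xy≈1⇒xyz≈z _ g′g≈1 ⟩
          x * (h * const α * h′)                   ∎)
          (backward _ (S-*-const α (forward x x∈S)))
        β = proj₁ idealizer
        eq = proj₂ idealizer

      -- Modulo n, the map sending x to g x h raises degrees by r.
      t₁ t₂ r : ℕ
      t₁ = proj₁ (homogeneity g (unit≉0 gg′≈1) g-normalizes)
      t₂ = proj₁ (homogeneity h (unit≉0 hh′≈1) h-normalizes)
      r = (t₁ ℕ.+ t₂) ℕ.% n

      g-homogeneous : Homogeneous t₁ g
      g-homogeneous = proj₂ (homogeneity g (unit≉0 gg′≈1) g-normalizes)

      h-homogeneous : Homogeneous t₂ h
      h-homogeneous = proj₂ (homogeneity h (unit≉0 hh′≈1) h-normalizes)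

      r<n : r ℕ.< n
      r<n = ℕ.m%n<n (t₁ ℕ.+ t₂) n

      f : ℕ → Carrier
      f i = g * X^ i * h

      f-homogeneous : ∀ i → Homogeneous (i ℕ.+ r) (f i)
      f-homogeneous i = Homogeneous-resp {t₁ ℕ.+ i ℕ.+ t₂} {i ℕ.+ r}
        (λ x → K.trans (K.reflexive (≡.cong (λ N → (σ ^∘ N) x)
                 (≡.trans (≡.cong (ℕ._+ t₂) (ℕ.+-comm t₁ i)) (ℕ.+-assoc i t₁ t₂))))
               (K.trans (K.reflexive (^∘-+ σ i (t₁ ℕ.+ t₂) x))
               (K.trans (σ.^∘-cong i (σ.σ^-mod (t₁ ℕ.+ t₂) x)) (K.reflexive (≡.sym (^∘-+ σ i r x))))))
        (Homogeneous-* {t₁ ℕ.+ i} {t₂} (Homogeneous-* {t₁} {i} g-homogeneous (X^-homogeneous i)) h-homogeneous)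

      f-homogeneous-wrap : ∀ i i′ → i ℕ.+ r ≡ i′ ℕ.+ n → Homogeneous i′ (f i)
      f-homogeneous-wrap i i′ eq = Homogeneous-resp {i ℕ.+ r} {i′}
        (λ x → K.trans (K.reflexive (≡.trans (≡.cong (λ N → (σ ^∘ N) x) eq) (^∘-+ σ i′ n x))) (σ.^∘-cong i′ (σ-order x)))
        (f-homogeneous i)

      f≉0 : ∀ i → ¬ (f i ≈ 0#)
      f≉0 i = unit≉0 (unit-* (unit-* gg′≈1 (proj₁ (proj₂ (X^-inverse i)))) hh′≈1)

      -- X^{jn} is central, so f_i X^{jn} is the image g X^{i+jn} h of a monomial of S.
      f∈S : ∀ i j → i ℕ.+ j ℕ.* n ℕ.< m → S (f i * X^ (j ℕ.* n))
      f∈S i j lt = S-resp (begin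
        g * X^ (i ℕ.+ j ℕ.* n) * h           ≈⟨ *-congʳ (*-congˡ (X^-+ i (j ℕ.* n))) ⟩
        g * (X^ i * X^ (j ℕ.* n)) * h        ≈⟨ solve 4 (λ g x y h → ((g ⊕ (x ⊕ y)) ⊕ h) ⊜ ((g ⊕ x) ⊕ (y ⊕ h))) refl g (X^ i) (X^ (j ℕ.* n)) h ⟩
        g * X^ i * (X^ (j ℕ.* n) * h)        ≈⟨ *-congˡ (X^-multiple-central j h) ⟩
        g * X^ i * (h * X^ (j ℕ.* n))        ≈⟨ *-assoc (g * X^ i) h (X^ (j ℕ.* n)) ⟨
        g * X^ i * h * X^ (j ℕ.* n)          ∎)
        (forward _ (S-X^ (i ℕ.+ j ℕ.* n) lt))

      IsMonomial : Carrier → ℕ → Set _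
      IsMonomial x i = ∃[ α ] (¬ (α K.≈ K.0#) × x ≈ const α * X^ i)

      -- The class i of exponents modulo n contains a or a + 1 exponents below m,
      -- according to whether b ≤ i or i < b.
      monomial-short : ∀ i i′ → Homogeneous i′ (f i) → i ℕ.< n → i′ ℕ.< n → b ℕ.≤ i′ → 1 ℕ.≤ a → IsMonomial (f i) i′
      monomial-short i i′ hom i<n i′<n b≤i′ 1≤a = monomial a i′<n hom (f≉0 i) 1≤a
        (λ j j<a → f∈S i j (i<n⇒i+jn<m i<n j j<a)) (b≤i⇒m≤i+an b≤i′) (i+en<sn i′<n a<s)

      -- With a + 1 multiples the comparison takes place in degree i + (a + 1)n, which must stay
      -- below sn; hence a + 1 < s.
      monomial-long : ∀ i → Homogeneous i (f i) → i ℕ.< b → suc a ℕ.< s → IsMonomial (f i) i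
      monomial-long i hom i<b a+1<s = monomial (suc a) i<n hom (f≉0 i) (s≤s z≤n)
        (λ j j≤a → f∈S i j (i<b⇒i+jn<m i<b j j≤a))
        (ℕ.≤-trans (ℕ.≤-reflexive m≡b+an) (ℕ.≤-trans (ℕ.+-monoˡ-≤ (a ℕ.* n) (ℕ.<⇒≤ b<n)) (ℕ.m≤n+m (suc a ℕ.* n) i)))
        (i+en<sn i<n a+1<s)
        where i<n = ℕ.<-trans i<b b<n

      -- The a + 1 elements f_i X^{jn} of S would have to fit into a class with only a exponents
      -- below m.
      long-to-short : ∀ i → i ℕ.< b → b ℕ.≤ i ℕ.+ r → i ℕ.+ r ℕ.< n → ⊥
      long-to-short i i<b b≤i+r i+r<n = no-room a i+r<n (f-homogeneous i) (f≉0 i)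
        (λ j j≤a → f∈S i j (i<b⇒i+jn<m i<b j j≤a)) (b≤i⇒m≤i+an b≤i+r) (i+en<sn i+r<n a<s)

      Consecutive : Set _
      Consecutive = ∃[ i ] ∃[ j ] (IsMonomial (f i) j × IsMonomial (f (suc i)) (suc j))

      Exceptional : Set _
      Exceptional = n ≡ 2 × IsMonomial (f 0) 1 × IsMonomial (f 1) 0

      f-homogeneous₀ : r ≡ 0 → ∀ i → Homogeneous i (f i)
      f-homogeneous₀ r≡0 i = ≡.subst (λ j → Homogeneous j (f i)) (≡.trans (≡.cong (i ℕ.+_) r≡0) (ℕ.+-identityʳ i)) (f-homogeneous i)

      consecutive-a+1<s : r ≡ 0 → suc a ℕ.< s → Consecutive
      consecutive-a+1<s r≡0 a+1<s = 0 , 0 , small 0 z≤n (0 ℕ.<? b) , small 1 (s≤s z≤n) (1 ℕ.<? b)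
        where
        small : ∀ i → i ℕ.≤ 1 → Dec (i ℕ.< b) → IsMonomial (f i) i
        small i i≤1 (yes i<b) = monomial-long i (f-homogeneous₀ r≡0 i) i<b a+1<s
        -- Here b ≤ 1, and m ≥ 2 makes a positive, so a short class still has a member.
        small i i≤1 (no  i≮b) = monomial-short i i (f-homogeneous₀ r≡0 i) i<n i<n b≤i (b≤1⇒1≤a (ℕ.≤-trans b≤i i≤1))
          where
          b≤i = ℕ.≮⇒≥ i≮b
          i<n = ℕ.≤-<-trans i≤1 2≤n

      -- Long classes leave no room below sn now. But b + an + 2 = m + 2 ≤ sn ≤ (a + 1)n gives b ≤ n
      -- - 2, so the classes n - 2 and n - 1 are short.
      consecutive-s≤a+1 : r ≡ 0 → s ℕ.≤ suc a → Consecutive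
      consecutive-s≤a+1 r≡0 s≤a+1 = n ℕ.∸ 2 , n ℕ.∸ 2 , large (n ℕ.∸ 2) (ℕ.<⇒≤ n-1<n) b≤n-2 ,
                                    large (suc (n ℕ.∸ 2)) n-1<n (ℕ.m≤n⇒m≤1+n b≤n-2)
        where
        n-1<n : suc (n ℕ.∸ 2) ℕ.< n
        n-1<n = ℕ.≤-reflexive (ℕ.m+[n∸m]≡n 2≤n)
        b+2≤n : b ℕ.+ 2 ℕ.≤ n
        b+2≤n = ℕ.+-cancelʳ-≤ (a ℕ.* n) (b ℕ.+ 2) n (ℕ.≤-trans (ℕ.≤-reflexive
          (≡.trans (ℕ.+-assoc b 2 (a ℕ.* n)) (≡.trans (≡.cong (b ℕ.+_) (ℕ.+-comm 2 (a ℕ.* n)))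
            (≡.trans (≡.sym (ℕ.+-assoc b (a ℕ.* n) 2)) (≡.cong (ℕ._+ 2) (≡.sym m≡b+an))))))
          (ℕ.≤-trans m+2≤sn (ℕ.*-monoˡ-≤ n s≤a+1)))
        b≤n-2 : b ℕ.≤ n ℕ.∸ 2
        b≤n-2 = ℕ.≤-trans (ℕ.≤-reflexive (≡.sym (ℕ.m+n∸n≡m b 2))) (ℕ.∸-monoˡ-≤ 2 b+2≤n)
        large : ∀ i → i ℕ.< n → b ℕ.≤ i → IsMonomial (f i) i
        large i i<n b≤i = monomial-short i i (f-homogeneous₀ r≡0 i) i<n i<n b≤i (ℕ.s≤s⁻¹ (ℕ.≤-trans 2≤s s≤a+1))

      -- All classes are short, so it remains to find i such that i + r and i + 1 + r do not
      -- straddle a multiple of n. This is i = 0 if r + 1 < n; for r = n - 1 it is i = 1, provided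
      -- that 2 < n.
      consecutive-b≡0 : b ≡ 0 → Dec (suc r ℕ.< n) → Dec (n ≡ 2) → Consecutive ⊎ Exceptional
      consecutive-b≡0 b≡0 = cases
        where
        0<n = ℕ.≤-trans (s≤s z≤n) 2≤n
        short : ∀ i i′ → Homogeneous i′ (f i) → i ℕ.< n → i′ ℕ.< n → IsMonomial (f i) i′
        short i i′ hom i<n i′<n = monomial-short i i′ hom i<n i′<n (≡.subst (ℕ._≤ i′) (≡.sym b≡0) z≤n)
          (b≤1⇒1≤a (≡.subst (ℕ._≤ 1) (≡.sym b≡0) z≤n))
        cases : Dec (suc r ℕ.< n) → Dec (n ≡ 2) → Consecutive ⊎ Exceptional
        cases (yes r+1<n) _ = inj₁ (0 , r , short 0 r (f-homogeneous 0) 0<n r<n , short 1 (suc r) (f-homogeneous 1) 2≤n r+1<n)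
        cases (no r+1≮n) (yes n≡2) = inj₂ (n≡2 ,
          short 0 1 (≡.subst (λ e → Homogeneous e (f 0)) (ℕ.suc-injective (≡.trans r+1≡n n≡2)) (f-homogeneous 0)) 0<n 2≤n ,
          short 1 0 (f-homogeneous-wrap 1 0 r+1≡n) 2≤n 0<n)
          where
          r+1≡n : suc r ≡ n
          r+1≡n = ℕ.≤-antisym r<n (ℕ.≮⇒≥ r+1≮n)
        cases (no r+1≮n) (no n≢2) = inj₁ (1 , 0 , short 1 0 (f-homogeneous-wrap 1 0 r+1≡n) 2≤n 0<n ,
          short 2 1 (f-homogeneous-wrap 2 1 (≡.cong suc r+1≡n)) (ℕ.≤∧≢⇒< 2≤n (n≢2 ∘ ≡.sym)) 2≤n)
          where
          r+1≡n : suc r ≡ n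
          r+1≡n = ℕ.≤-antisym r<n (ℕ.≮⇒≥ r+1≮n)

      -- Some i < b has b ≤ i + r < n: take i = b - r if r ≤ b, and i = 0 otherwise.
      impossible : ¬ (r ≡ 0) → ¬ (b ≡ 0) → Dec (r ℕ.≤ b) → ⊥
      impossible r≢0 b≢0 (yes r≤b) = long-to-short (b ℕ.∸ r) (ℕ.∸-monoʳ-< (ℕ.n≢0⇒n>0 r≢0) r≤b)
        (ℕ.≤-reflexive (≡.sym b-r+r≡b)) (ℕ.≤-<-trans (ℕ.≤-reflexive b-r+r≡b) b<n)
        where b-r+r≡b = ℕ.m∸n+n≡m r≤b
      impossible r≢0 b≢0 (no r≰b) = long-to-short 0 (ℕ.n≢0⇒n>0 b≢0) (ℕ.<⇒≤ (ℕ.≰⇒> r≰b)) r<n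

      dichotomy : Dec (r ≡ 0) → Dec (suc a ℕ.< s) → Dec (b ≡ 0) → Consecutive ⊎ Exceptional
      dichotomy (yes r≡0) (yes a+1<s) _         = inj₁ (consecutive-a+1<s r≡0 a+1<s)
      dichotomy (yes r≡0) (no  a+1≮s) _         = inj₁ (consecutive-s≤a+1 r≡0 (ℕ.≮⇒≥ a+1≮s))
      dichotomy (no  r≢0) _           (yes b≡0) = consecutive-b≡0 b≡0 (suc r ℕ.<? n) (n ℕ.≟ 2)
      dichotomy (no  r≢0) _           (no  b≢0) = ⊥-elim (impossible r≢0 b≢0 (r ℕ.≤? b))

      consecutive⇒monomial : Consecutive → Monomial t₁ g
      consecutive⇒monomial (i , j , (α , α≉0 , fᵢ≈) , (β , β≉0 , fᵢ₊₁≈)) = record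
        { homogeneous = g-homogeneous
        -- Read off from g X g⁻¹ = β X α⁻¹ = β σ(α⁻¹) X.
        ; factor = β K.* σ α⁻¹
        ; factor≉0 = K.*-≉0 β≉0 (K.xy≈1⇒x≉0 (K.trans (K.sym (σ.*-homo α⁻¹ α)) (K.trans (σ.⟦⟧-cong (K.trans (K.*-comm α⁻¹ α) αα⁻¹)) σ.1#-homo)))
        ; gX≈cXg = begin
            g * X                                          ≈⟨ xy≈1⇒zxy≈z (g * X) uv≈1 ⟨
            g * X * u * v                                  ≈⟨ *-congʳ (begin
              g * X * (X^ i * h)                             ≈⟨ solve 4 (λ g x y h → ((g ⊕ x) ⊕ (y ⊕ h)) ⊜ ((g ⊕ (x ⊕ y)) ⊕ h)) refl g X (X^ i) h ⟩
              g * (X * X^ i) * h                             ≈⟨ *-congʳ (*-congˡ (X^-suc i)) ⟨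
              f (suc i)                                      ≈⟨ fᵢ₊₁≈ ⟩
              const β * X^ (suc j)                           ≈⟨ *-congˡ (X^-suc j) ⟩
              const β * (X * X^ j)                           ≈⟨ *-congˡ (*-congˡ Xʲ≈) ⟩
              const β * (X * (const α⁻¹ * (g * u)))          ≈⟨ solve 5 (λ b x a g u → (b ⊕ (x ⊕ (a ⊕ (g ⊕ u)))) ⊜ ((b ⊕ ((x ⊕ a) ⊕ g)) ⊕ u)) refl (const β) X (const α⁻¹) g u ⟩
              const β * (X * const α⁻¹ * g) * u              ∎) ⟩
            const β * (X * const α⁻¹ * g) * u * v          ≈⟨ xy≈1⇒zxy≈z _ uv≈1 ⟩
            const β * (X * const α⁻¹ * g)                  ≈⟨ *-congˡ (*-congʳ (X-const α⁻¹)) ⟩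
            const β * (const (σ α⁻¹) * X * g)              ≈⟨ solve 4 (λ b a x g → (b ⊕ ((a ⊕ x) ⊕ g)) ⊜ ((b ⊕ a) ⊕ (x ⊕ g))) refl (const β) (const (σ α⁻¹)) X g ⟩
            const β * const (σ α⁻¹) * (X * g)              ≈⟨ *-congʳ (const-* β (σ α⁻¹)) ⟨
            const (β K.* σ α⁻¹) * (X * g)                  ∎
        }
        where
        α⁻¹ = proj₁ (K.inverse α α≉0)
        αα⁻¹ = proj₂ (K.inverse α α≉0)
        u = X^ i * h
        v = h′ * proj₁ (X^-inverse i)
        uv≈1 : u * v ≈ 1#
        uv≈1 = unit-* (proj₁ (proj₂ (X^-inverse i))) hh′≈1
        Xʲ≈ : X^ j ≈ const α⁻¹ * (g * u)
        Xʲ≈ = sym (begin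
          const α⁻¹ * (g * (X^ i * h))     ≈⟨ *-congˡ (*-assoc g (X^ i) h) ⟨
          const α⁻¹ * f i                  ≈⟨ *-congˡ fᵢ≈ ⟩
          const α⁻¹ * (const α * X^ j)     ≈⟨ xy≈1⇒xyz≈z (X^ j) (const-unit α (K.trans (K.*-comm α⁻¹ α) αα⁻¹)) ⟩
          X^ j                             ∎)

      -- With P = g X g⁻¹, both P X = ρ ∈ K and P² = X², the latter being central.
      exceptional⇒X⁴∈K : Exceptional → n ≡ 2 × ∃[ ρ ] (X^ 4 ≈ const ρ)
      exceptional⇒X⁴∈K (n≡2 , (κ₀ , κ₀≉0 , f₀≈) , (κ₁ , κ₁≉0 , f₁≈)) = n≡2 , ρ K.* σ ρ , (begin
        X^ 4                               ≈⟨ trans (X^-suc 3) (trans (*-congˡ (trans (X^-suc 2) (*-congˡ (trans (X^-suc 1) (*-congˡ X^-1))))) (sym (*-assoc X X (X * X)))) ⟩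
        X * X * (X * X)                    ≈⟨ xy≈1⇒xyz≈z (X * X * (X * X)) gg′≈1 ⟨
        g * (g′ * (X * X * (X * X)))       ≈⟨ *-congˡ (*-assoc g′ (X * X) (X * X)) ⟨
        g * (g′ * (X * X) * (X * X))       ≈⟨ *-congˡ (*-congʳ (X²-central g′)) ⟨
        g * (X * X * g′ * (X * X))         ≈⟨ solve 3 (λ g x g′ → (g ⊕ (((x ⊕ x) ⊕ g′) ⊕ (x ⊕ x))) ⊜ (((g ⊕ x) ⊕ (x ⊕ (g′ ⊕ x))) ⊕ x)) refl g X g′ ⟩
        g * X * (X * (g′ * X)) * X         ≈⟨ *-congʳ (*-congʳ (xy≈1⇒zxy≈z (g * X) g′g≈1)) ⟨
        g * X * g′ * g * (X * (g′ * X)) * X ≈⟨ solve 3 (λ g x g′ → (((((g ⊕ x) ⊕ g′) ⊕ g) ⊕ (x ⊕ (g′ ⊕ x))) ⊕ x) ⊜ ((((g ⊕ x) ⊕ g′) ⊕ (((g ⊕ x) ⊕ g′) ⊕ x)) ⊕ x)) refl g X g′ ⟩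
        P * (P * X) * X                    ≈⟨ *-congʳ (*-congˡ PX≈ρ) ⟩
        P * const ρ * X                    ≈⟨ *-assoc P (const ρ) X ⟩
        P * (const ρ * X)                  ≈⟨ *-congˡ (ρX≈Xσρ ρ) ⟩
        P * (X * const (σ ρ))              ≈⟨ *-assoc P X (const (σ ρ)) ⟨
        P * X * const (σ ρ)                ≈⟨ *-congʳ PX≈ρ ⟩
        const ρ * const (σ ρ)              ≈⟨ const-* ρ (σ ρ) ⟨
        const (ρ K.* σ ρ)                  ∎)
        where
        P = g * X * g′
        σσ≈id : ∀ x → σ (σ x) K.≈ x
        σσ≈id x = K.trans (K.reflexive (≡.cong (λ N → (σ ^∘ N) x) (≡.sym n≡2))) (σ-order x)
        ρX≈Xσρ : ∀ ρ → const ρ * X ≈ X * const (σ ρ)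
        ρX≈Xσρ ρ = sym (trans (X-const (σ ρ)) (*-congʳ (const-cong (σσ≈id ρ))))
        X²-central : ∀ x → X * X * x ≈ x * (X * X)
        X²-central = generated (X * X)
          (λ α → trans (*-assoc X X (const α)) (trans (*-congˡ (X-const α)) (trans (sym (*-assoc X (const (σ α)) X))
            (trans (*-congʳ (trans (X-const (σ α)) (*-congʳ (const-cong (σσ≈id α))))) (*-assoc (const α) X X)))))
          (*-assoc X X X)
        τ = σ κ₀
        τ≉0 : ¬ (τ K.≈ K.0#)
        τ≉0 τ≈0 = κ₀≉0 (K.trans (K.sym (σσ≈id κ₀)) (K.trans (σ.⟦⟧-cong τ≈0) σ.0#-homo))
        τ⁻¹ = proj₁ (K.inverse τ τ≉0)
        ρ = κ₁ K.* τ⁻¹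
        gh≈Xτ : g * h ≈ X * const τ
        gh≈Xτ = begin
          g * h                  ≈⟨ *-congʳ (trans (*-congˡ X^-zero) (*-identityʳ g)) ⟨
          f 0                    ≈⟨ f₀≈ ⟩
          const κ₀ * X^ 1        ≈⟨ *-congˡ X^-1 ⟩
          const κ₀ * X           ≈⟨ ρX≈Xσρ κ₀ ⟩
          X * const τ            ∎
        -- From g h = X τ follows P X τ = P g h = g X h = f 1, which is the constant κ₁.
        PX≈ρ : P * X ≈ const ρ
        PX≈ρ = begin
          P * X                              ≈⟨ xy≈1⇒zxy≈z (P * X) (const-unit τ⁻¹ (proj₂ (K.inverse τ τ≉0))) ⟨
          P * X * const τ * const τ⁻¹        ≈⟨ *-congʳ (*-assoc P X (const τ)) ⟩
          P * (X * const τ) * const τ⁻¹      ≈⟨ *-congʳ (*-congˡ gh≈Xτ) ⟨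
          P * (g * h) * const τ⁻¹            ≈⟨ *-congʳ (*-assoc P g h) ⟨
          P * g * h * const τ⁻¹              ≈⟨ *-congʳ (*-congʳ (xy≈1⇒zxy≈z (g * X) g′g≈1)) ⟩
          g * X * h * const τ⁻¹              ≈⟨ *-congʳ (*-congʳ (*-congˡ X^-1)) ⟨
          f 1 * const τ⁻¹                    ≈⟨ *-congʳ (trans f₁≈ (trans (*-congˡ X^-zero) (*-identityʳ (const κ₁)))) ⟩
          const κ₁ * const τ⁻¹               ≈⟨ const-* κ₁ τ⁻¹ ⟨
          const (κ₁ K.* τ⁻¹)                 ∎

      Monomial-mod : ∀ {t} → Monomial t g → Monomial (t ℕ.% n) g
      Monomial-mod {t} g-monomial = record
        { homogeneous = Homogeneous-resp {t} {t ℕ.% n} (σ.σ^-mod t) homogeneous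
        ; factor = factor ; factor≉0 = factor≉0 ; gX≈cXg = gX≈cXg }
        where open Monomial g-monomial

    module _ (unexceptional : n ≡ 2 → ∀ ρ → ¬ (X^ 4 ≈ const ρ)) where

      private
        g-monomial : Monomial (t₁ ℕ.% n) g
        g-monomial = cases (dichotomy (r ℕ.≟ 0) (suc a ℕ.<? s) (b ℕ.≟ 0))
          where
          cases : Consecutive ⊎ Exceptional → Monomial (t₁ ℕ.% n) g
          cases (inj₁ consecutive) = Monomial-mod (consecutive⇒monomial consecutive)
          cases (inj₂ exceptional) = let n≡2 , ρ , eq = exceptional⇒X⁴∈K exceptional in ⊥-elim (unexceptional n≡2 ρ eq)

        t<n = ℕ.m%n<n t₁ n

      g∈G : InG g
      g∈G = Monomial⇒InG t<n gg′≈1 g′g≈1 g-monomial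

      h≈g⁻¹λ : ∃[ μ ] (¬ (μ K.≈ K.0#) × h ≈ g′ * const μ)
      h≈g⁻¹λ = μ , (λ μ≈0 → unit≉0 (unit-* gg′≈1 hh′≈1) (trans eq (trans (const-cong μ≈0) const-0))) ,
        trans (sym (xy≈1⇒xyz≈z h g′g≈1)) (*-congˡ eq)
        where
        -- x g h = g (g⁻¹ x g) h, where g⁻¹ x g is in S because g is already known to satisfy
        -- `Monomial`.
        idealizer = idealizerʳ (g * h) λ x x∈S → S-resp (begin
          g * (g′ * x * g) * h     ≈⟨ *-congʳ (trans (*-congˡ (*-assoc g′ x g)) (xy≈1⇒xyz≈z (x * g) gg′≈1)) ⟩
          x * g * h                ≈⟨ *-assoc x g h ⟩
          x * (g * h)              ∎)
          (forward _ (S-conjugate-by⁻¹ (ℕ.<⇒≤ t<n) gg′≈1 g′g≈1 g-monomial x x∈S))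
        μ = proj₁ idealizer
        eq = proj₂ idealizer

  module Converse {g g′ h μ μ⁻¹} (g∈G : InG g) (gg′≈1 : g * g′ ≈ 1#) (g′g≈1 : g′ * g ≈ 1#)
    (μμ⁻¹≈1 : μ K.* μ⁻¹ K.≈ K.1#) (h≈ : h ≈ g′ * const μ) where

    private
      t≤n : proj₁ (proj₂ (proj₂ g∈G)) ℕ.≤ n
      t≤n = ℕ.<⇒≤ (proj₁ (proj₂ (proj₂ (proj₂ (proj₂ (proj₂ g∈G))))))
      μ⁻¹μ≈1 = K.trans (K.*-comm μ⁻¹ μ) μμ⁻¹≈1

    h⁻¹ : Carrier
    h⁻¹ = const μ⁻¹ * g

    hh⁻¹≈1 : h * h⁻¹ ≈ 1#
    hh⁻¹≈1 = trans (*-congʳ h≈) (unit-* g′g≈1 (const-unit μ⁻¹ μμ⁻¹≈1))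

    h⁻¹h≈1 : h⁻¹ * h ≈ 1#
    h⁻¹h≈1 = trans (*-congˡ h≈) (unit-* (const-unit μ μ⁻¹μ≈1) gg′≈1)

    -- g x h = (g x g⁻¹) μ, and both conjugation by g and right multiplication by K preserve S.
    forward : ∀ x → S x → S (g * x * h)
    forward x x∈S = S-resp
      (sym (trans (*-congˡ h≈) (sym (*-assoc (g * x) g′ (const μ)))))
      (S-*-const μ (S-conjugate-by t≤n gg′≈1 g′g≈1 (InG⇒Monomial g∈G) x x∈S))

    backward : ∀ x → S x → S (g′ * x * h⁻¹)
    backward x x∈S = S-resp
      (solve 4 (λ a x b g → ((a ⊕ (x ⊕ b)) ⊕ g) ⊜ ((a ⊕ x) ⊕ (b ⊕ g))) refl g′ x (const μ⁻¹) g)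
      (S-conjugate-by⁻¹ t≤n gg′≈1 g′g≈1 (InG⇒Monomial g∈G) (x * const μ⁻¹) (S-*-const μ⁻¹ x∈S))

-- The quotient by F(Xⁿ) and the equality of the two groups

module AutomorphismGroup {c₁ ℓ₁ a₁ c₂ ℓ₂ a₂}
  (q n s k : ℕ) (q-primePower : PrimePower q)
  (2≤n : 2 ℕ.≤ n) (2≤s : 2 ℕ.≤ s) (1≤k : 1 ℕ.≤ k) (k≤n-1 : k ℕ.≤ n ℕ.∸ 1)
  (𝔽q : HeytingField c₁ ℓ₁ a₁) (𝔽qⁿ : HeytingField c₂ ℓ₂ a₂)
  (card-q : HasCardinality 𝔽q q) (card-qⁿ : HasCardinality 𝔽qⁿ (q ℕ.^ n))
  (ι : HeytingField.Carrier 𝔽q → HeytingField.Carrier 𝔽qⁿ)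
  (isExtension : Galois.IsFieldExtension 𝔽q 𝔽qⁿ ι)
  (σ : HeytingField.Carrier 𝔽qⁿ → HeytingField.Carrier 𝔽qⁿ)
  (isGenerator : Galois.IsGaloisGenerator 𝔽q 𝔽qⁿ ι σ)
  (F : Polynomial.Poly 𝔽q) (F-monic : Polynomial.IsMonicOfDegree 𝔽q F s)
  (F-irreducible : Irreducible (RawRing.rawSemiring (Polynomial.ring 𝔽q)) F)
  (F-generic : ∀ ν → ¬ (HeytingField._≈_ 𝔽q ν (HeytingField.0# 𝔽q)) →
    ¬ (n ≡ 2 × s ≡ 2 × Polynomial._≈_ 𝔽q F
      (HeytingField.-_ 𝔽q ν ∷ HeytingField.0# 𝔽q ∷ HeytingField.1# 𝔽q ∷ [])))
  where

  private
    A = HeytingFieldProperties.commutativeRing 𝔽qⁿ (q ℕ.^ n) card-qⁿ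
    A-isField = HeytingFieldProperties.isDiscreteField 𝔽qⁿ (q ℕ.^ n) card-qⁿ
    B = HeytingFieldProperties.commutativeRing 𝔽q q card-q
    B-isField = HeytingFieldProperties.isDiscreteField 𝔽q q card-q

    0<n : 0 ℕ.< n
    0<n = ℕ.≤-trans (s≤s z≤n) 2≤n

    instance
      n≢0 : ℕ.NonZero n
      n≢0 = ℕ.>-nonZero 0<n

  open GaloisGroup q n q-primePower 0<n 𝔽q 𝔽qⁿ card-q card-qⁿ ι isExtension σ isGenerator
    using (isHomomorphism; σ-order; σ-faithful)

  private
    module A where
      open CommutativeRing A public
      open IsDiscreteField A-isField public
    module B where
      open CommutativeRing B public
      open DiscreteField B B-isField public using (1≉0; inverse)
    module ι = IsRingMonomorphism isExtension
    module P = SkewPolynomialRing A σ isHomomorphism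
    module PB = SkewPolynomialRing B id (Identity.isRingHomomorphism B.rawRing B.refl)
    module 𝒞 = Code 𝔽q 𝔽qⁿ ι σ n s F
    open P using (Poly; coeff; const; X; Below; _^_)

    σι≈ι : ∀ x → σ (ι x) A.≈ ι x
    σι≈ι = Galois.IsGaloisAutomorphism.fixes (Galois.IsGaloisGenerator.isGaloisAutomorphism isGenerator)

    Central : Poly → Set _
    Central z = ∀ p → z P.* p P.≈ p P.* z

    const-ι-central : ∀ x → Central (const (ι x))
    const-ι-central x p = P.≈-trans (P.const-* (ι x) p) (P.coefficientwise λ i → A.trans (P.coeff-• (ι x) p i)
      (A.trans (A.*-comm _ _) (A.sym (A.trans (P.coeff-*-const p (ι x) i) (A.*-congˡ (fixed i))))))
      where
      fixed : ∀ i → (σ ^∘ i) (ι x) A.≈ ι x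
      fixed zero    = A.refl
      fixed (suc i) = A.trans (IsRingHomomorphism.⟦⟧-cong isHomomorphism (fixed i)) (σι≈ι x)

    -- Both products shift the coefficients of p by n places; the left one also applies σⁿ to them,
    -- which is the identity.
    Xⁿ-central : Central (X ^ n)
    Xⁿ-central p = P.coefficientwise λ i → go i (i ℕ.<? n)
      where
      go : ∀ i → Dec (i ℕ.< n) → coeff (X ^ n P.* p) i A.≈ coeff (p P.* X ^ n) i
      go i (yes i<n) = A.trans (P.coeff-X^-*-low p n i i<n) (A.sym (P.coeff-*-X^-low p n i i<n))
      go i (no  i≮n) = ≡.subst (λ i → coeff (X ^ n P.* p) i A.≈ coeff (p P.* X ^ n) i) (ℕ.m+[n∸m]≡n (ℕ.≮⇒≥ i≮n))
        (A.trans (P.coeff-X^-* p n (i ℕ.∸ n)) (A.trans (σ-order _) (A.sym (P.coeff-*-X^ p n (i ℕ.∸ n)))))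

    evaluate : Polynomial.Poly 𝔽q → Poly
    evaluate G = 𝒞.evaluate G (X ^ n)

    evaluate-central : ∀ G → Central (evaluate G)
    evaluate-central []      p = P.≈-sym (p*0 p)
      where
      p*0 : ∀ p → p P.* [] P.≈ []
      p*0 p = Ring.zeroʳ P.ring p
    evaluate-central (f ∷ G) p = begin
      (const (ι f) P.+ e P.* X ^ n) P.* p           ≈⟨ P.*-distribʳ-+ p (const (ι f)) (e P.* X ^ n) ⟩
      const (ι f) P.* p P.+ e P.* X ^ n P.* p       ≈⟨ P.+-cong (const-ι-central f p) (begin
        e P.* X ^ n P.* p                             ≈⟨ P.*-assoc e (X ^ n) p ⟩
        e P.* (X ^ n P.* p)                           ≈⟨ P.*-congˡ e (Xⁿ-central p) ⟩
        e P.* (p P.* X ^ n)                           ≈⟨ P.*-assoc e p (X ^ n) ⟨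
        e P.* p P.* X ^ n                             ≈⟨ P.*-congʳ (e P.* p) (p P.* e) (X ^ n) (evaluate-central G p) ⟩
        p P.* e P.* X ^ n                             ≈⟨ P.*-assoc p e (X ^ n) ⟩
        p P.* (e P.* X ^ n)                           ∎) ⟩
      p P.* const (ι f) P.+ p P.* (e P.* X ^ n)     ≈⟨ P.*-distribˡ-+ p (const (ι f)) (e P.* X ^ n) ⟨
      p P.* (const (ι f) P.+ e P.* X ^ n)           ∎
      where
      e = evaluate G
      open import Relation.Binary.Reasoning.Setoid (Ring.setoid P.ring)

    coeff-evaluate : ∀ G i → coeff (evaluate G) (i ℕ.* n) A.≈ ι (PB.coeff G i)
    coeff-evaluate []      i       = A.sym ι.0#-homo
    coeff-evaluate (f ∷ G) zero    = A.trans (P.coeff-+ (const (ι f)) (evaluate G P.* X ^ n) 0)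
      (A.trans (A.+-congˡ (P.coeff-*-X^-low (evaluate G) n 0 0<n)) (A.+-identityʳ (ι f)))
    coeff-evaluate (f ∷ G) (suc i) = A.trans (P.coeff-+ (const (ι f)) (evaluate G P.* X ^ n) (n ℕ.+ i ℕ.* n))
      (A.trans (A.+-cong (P.Below-const (ι f) (n ℕ.+ i ℕ.* n) (ℕ.≤-trans 0<n (ℕ.m≤m+n n (i ℕ.* n))))
        (A.trans (P.coeff-*-X^ (evaluate G) n (i ℕ.* n)) (coeff-evaluate G i))) (A.+-identityˡ _))

    evaluate-zero : ∀ G → PB.Below 0 G → evaluate G P.≈ []
    evaluate-zero []      G<0 = P.≈-refl
    evaluate-zero (f ∷ G) G<0 = P.≈-trans (P.+-cong {r = evaluate G P.* X ^ n} {r′ = []}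
      (P.≈-trans (P.const-cong (A.trans (ι.⟦⟧-cong (G<0 0 z≤n)) ι.0#-homo)) P.0∷[])
      (P.*-zeroˡ (evaluate G) (X ^ n) (evaluate-zero G (λ i _ → G<0 (suc i) z≤n)))) P.≈-refl

    evaluate-below : ∀ G d → PB.Below (suc d) G → Below (suc (d ℕ.* n)) (evaluate G)
    evaluate-below []      d       G≤d = λ _ _ → A.refl
    evaluate-below (f ∷ G) zero    G≤d = P.Below-+ (const (ι f)) (evaluate G P.* X ^ n) (P.Below-const (ι f))
      (λ i _ → P.coeff-≈ (P.*-zeroˡ (evaluate G) (X ^ n) (evaluate-zero G (PB.Below-∷⁻ G≤d))) i)
    evaluate-below (f ∷ G) (suc d) G≤d = P.Below-+ (const (ι f)) (evaluate G P.* X ^ n)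
      (P.Below-mono (const (ι f)) (s≤s z≤n) (P.Below-const (ι f)))
      (P.Below-mono (evaluate G P.* X ^ n) (ℕ.≤-reflexive (ℕ.+-suc n (d ℕ.* n)))
        (P.Below-*-X^ (evaluate G) n (evaluate-below G d (PB.Below-∷⁻ G≤d))))

    M = evaluate F

    M-monic : coeff M (s ℕ.* n) A.≈ A.1#
    M-monic = A.trans (coeff-evaluate F s) (A.trans (ι.⟦⟧-cong (proj₁ F-monic)) ι.1#-homo)

    -- Otherwise Y is a proper factor of F, because s ≥ 2.
    irreducible⇒F₀≉0 : ∀ t → 2 ℕ.≤ t → ∀ G → Polynomial.IsMonicOfDegree 𝔽q G t →
                       Irreducible (RawRing.rawSemiring (Polynomial.ring 𝔽q)) G → ¬ (PB.coeff G 0 B.≈ B.0#)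
    irreducible⇒F₀≉0 t             _             []      (1≈ , _) _ _ = B.1≉0 (B.sym 1≈)
    irreducible⇒F₀≉0 (suc (suc t)) (s≤s (s≤s _)) (f ∷ G) (G-monic , G-bounded) irr f≈0 =
      case (Irreducible.split-∣1 irr (PB.≈-trans (PB.∷-cong f≈0 PB.≈-refl) (PB.≈-sym (PB.*-X G))))
      where
      case : _ → ⊥
      -- The cofactor G = F/Y has degree s - 1 ≥ 1, while h G = 1 has smaller degree; so h would be
      -- 0.
      case (inj₁ G∣1) = B.1≉0 (B.sym (PB.coeff-≈ []≈1 0))
        where
        h = Algebra.Definitions.RawMagma._∣ʳ_.quotient G∣1
        hG≈1 = Algebra.Definitions.RawMagma._∣ʳ_.equality G∣1
        h≈0 : h PB.≈ []
        h≈0 = PB.monic-multiple-small B-isField {suc t} h G G-monic (λ i t<i → G-bounded (suc i) (s≤s t<i))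
          (PB.Below-cong (PB.≈-sym hG≈1) (PB.Below-mono (PB.const B.1#) (s≤s z≤n) (PB.Below-const B.1#)))
        []≈1 : [] PB.≈ PB.const B.1#
        []≈1 = PB.≈-trans (PB.≈-sym (PB.*-zeroˡ h G h≈0)) hG≈1
      case (inj₂ X∣1) = B.1≉0 (B.trans (B.sym (PB.coeff-≈ hX≈1 0)) (PB.coeff-≈ (PB.*-X h) 0))
        where
        h = Algebra.Definitions.RawMagma._∣ʳ_.quotient X∣1
        hX≈1 = Algebra.Definitions.RawMagma._∣ʳ_.equality X∣1

    F₀ = PB.coeff F 0

    F₀≉0 : ¬ (F₀ B.≈ B.0#)
    F₀≉0 = irreducible⇒F₀≉0 s 2≤s F F-monic F-irreducible

    module C = CyclicQuotient A A-isField σ isHomomorphism n s σ-order σ-faithful M (evaluate-central F) M-monic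
      (evaluate-below F s (proj₂ F-monic))
    open C using (Q; S; unique; X^≉0; *-congˡ; *-congʳ)
    open C.P using (≈⇒≋)
    open Ring Q hiding (zero; rawRing; +-congˡ; +-congʳ; *-congˡ; *-congʳ)
    open import Algebra.Properties.Ring Q using (+-inverseʳ-unique)
    open import Relation.Binary.Reasoning.Setoid setoid

    M≈0 : M ≈ 0#
    M≈0 = Quotient.congruent (const A.1#)
      (P.≈-trans (P.+-identityʳ M) (P.≈-sym (P.≈-trans (P.const-* A.1# M) (P.1•p≈p M))))

    -- F(Xⁿ) = ι(f) + G(Xⁿ) Xⁿ for F = f + G Y, so that Xⁿ⁻¹ G(Xⁿ) = − ι(f) X⁻¹ in the quotient.
    X-invertible : ∀ G → evaluate G ≈ 0# → ¬ (PB.coeff G 0 B.≈ B.0#) → ∃[ y ] (X * y ≈ 1# × y * X ≈ 1#)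
    X-invertible []      _   F₀≉0 = ⊥-elim (F₀≉0 B.refl)
    X-invertible (f ∷ G) M≈0 f≉0 = const c * (e * X ^ n-1) , (begin
      X * (const c * (e * X ^ n-1))          ≈⟨ ≈⇒≋ (P.≈-trans (P.≈-sym (P.*-assoc X (const c) (e * X ^ n-1)))
                                                  (P.≈-trans (P.*-congʳ (X * const c) (const c * X) (e * X ^ n-1) (P.≈-sym (const-ι-central b X)))
                                                    (P.*-assoc (const c) X (e * X ^ n-1)))) ⟩
      const c * (X * (e * X ^ n-1))          ≈⟨ ≈⇒≋ (P.*-congˡ (const c) (P.≈-trans (P.≈-sym (P.*-assoc X e (X ^ n-1)))
                                                  (P.≈-trans (P.*-congʳ (X * e) (e * X) (X ^ n-1) (P.≈-sym (evaluate-central G X)))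
                                                    (P.*-assoc e X (X ^ n-1))))) ⟩
      const c * (e * X ^ suc n-1)            ≈⟨ ceXⁿ≈1 ⟩
      1#                                     ∎) , (begin
      const c * (e * X ^ n-1) * X            ≈⟨ *-assoc (const c) (e * X ^ n-1) X ⟩
      const c * (e * X ^ n-1 * X)            ≈⟨ *-congˡ (const c) (*-assoc e (X ^ n-1) X) ⟩
      const c * (e * (X ^ n-1 * X))          ≈⟨ *-congˡ (const c) (*-congˡ e (≈⇒≋ (P.X^-comm n-1))) ⟩
      const c * (e * X ^ suc n-1)            ≈⟨ ceXⁿ≈1 ⟩
      1#                                     ∎)
      where
      n-1 = ℕ.pred n
      e = evaluate G
      -f≉0 : ¬ (B.- f B.≈ B.0#)
      -f≉0 -f≈0 = f≉0 (B.trans (B.sym (B.+-identityʳ f)) (B.trans (B.+-congˡ (B.sym -f≈0)) (B.-‿inverseʳ f)))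
      b = proj₁ (B.inverse (B.- f) -f≉0)
      c = ι b
      eXⁿ≈-f : e * X ^ n ≈ const (A.- ι f)
      eXⁿ≈-f = +-inverseʳ-unique (const (ι f)) (e * X ^ n) M≈0
      ceXⁿ≈1 : const c * (e * X ^ suc n-1) ≈ 1#
      ceXⁿ≈1 = begin
        const c * (e * X ^ suc n-1)          ≈⟨ *-congˡ (const c) (*-congˡ e (≈⇒≋ (P.^-congʳ X (ℕ.suc-pred n)))) ⟩
        const c * (e * X ^ n)                ≈⟨ *-congˡ (const c) eXⁿ≈-f ⟩
        const c * const (A.- ι f)            ≈⟨ C.const-*-const c (A.- ι f) ⟨
        const (c A.* A.- ι f)                ≈⟨ C.const-cong (A.trans (A.*-comm c _) (A.trans (A.*-congʳ (A.sym (ι.-‿homo f)))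
                                                  (A.trans (A.sym (ι.*-homo (B.- f) b)) (A.trans (ι.⟦⟧-cong (proj₂ (B.inverse (B.- f) -f≉0))) ι.1#-homo)))) ⟩
        1#                                   ∎

    m = s ℕ.* k

    2≤m : 2 ℕ.≤ m
    2≤m = ℕ.*-mono-≤ 2≤s 1≤k

    -- From k + 1 ≤ n follows sk + s ≤ sn, and s ≥ 2. The slack 2 is what makes the two highest
    -- classes short when a + 1 = s.
    m+2≤sn : m ℕ.+ 2 ℕ.≤ s ℕ.* n
    m+2≤sn = ℕ.≤-trans (ℕ.+-monoʳ-≤ m 2≤s) (ℕ.≤-trans (ℕ.≤-reflexive (≡.trans (ℕ.+-comm m s) (≡.sym (ℕ.*-suc s k))))
      (ℕ.*-monoʳ-≤ s (ℕ.≤-trans (s≤s k≤n-1) (ℕ.≤-reflexive (ℕ.m+[n∸m]≡n 0<n)))))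

    m<sn : m ℕ.< s ℕ.* n
    m<sn = ℕ.<-≤-trans (ℕ.m<m+n m (s≤s z≤n)) m+2≤sn

    X⁻¹ = proj₁ (X-invertible F M≈0 F₀≉0)
    XX⁻¹≈1 = proj₁ (proj₂ (X-invertible F M≈0 F₀≉0))
    X⁻¹X≈1 = proj₂ (proj₂ (X-invertible F M≈0 F₀≉0))

    system : SkewSystem A σ n (s ℕ.* n) m _ _ _
    system = record
      { Q = Q
      ; 1≉0 = X^≉0 0 (ℕ.≤-<-trans z≤n m<sn)
      ; const = const
      ; const-cong = C.const-cong
      ; const-0 = ≈⇒≋ P.0∷[]
      ; const-1 = refl
      ; const-* = C.const-*-const
      ; X = X
      ; X⁻¹ = X⁻¹
      ; XX⁻¹≈1 = XX⁻¹≈1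
      ; X⁻¹X≈1 = X⁻¹X≈1
      ; X-const = C.X-homogeneous
      ; X^ = X ^_
      ; X^-zero = refl
      ; X^-suc = λ i → refl
      ; generated = C.commutesWithGenerators⇒central
      ; S = S m
      ; S-resp = C.S-resp
      ; S-const-* = C.S-const-*
      ; S-*-const = C.S-*-const
      ; S-X^ = C.S-X^
      ; S-conjugate = C.S-conjugate
      ; idealizerˡ = C.idealizerˡ (ℕ.<⇒≤ 2≤m) m<sn
      ; idealizerʳ = C.idealizerʳ (ℕ.<⇒≤ 2≤m) m<sn
      ; homogeneity = C.normalizes⇒homogeneous
      ; monomial = λ {i} {f} → C.homogeneous-monomial {m} {i} {f}
      ; no-room = λ {i} {f} → C.homogeneous-no-room {m} {i} {f}
      ; eigenvector = C.eigenvector X⁻¹ XX⁻¹≈1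
      }

    open Rigidity A A-isField σ isHomomorphism n s m 2≤n 2≤s 2≤m m+2≤sn σ-order system
      using (InG; module Automorphism; module Converse)

    𝒮⇒S : ∀ {x} → 𝒞.𝒮 k x → S m x
    𝒮⇒S (α , x≈) = P.sum {m} (λ i → const (α i) * X ^ toℕ i) , P.monomials-below {m} α , x≈

    S⇒𝒮 : ∀ {x} → S m x → 𝒞.𝒮 k x
    S⇒𝒮 (p , p<m , x≈p) = (λ i → coeff p (toℕ i)) , trans x≈p (≈⇒≋ (P.monomial-expansion m p p<m))

    InG⇒𝒢 : ∀ {g} → InG g → 𝒞.𝒢 g
    InG⇒𝒢 (z , γ , t , z-central , γ≉0 , t<n , g≈) = z , γ , Fin.fromℕ< t<n , z-central , γ≉0 ,
      trans g≈ (*-congˡ (z * const γ) (≈⇒≋ (P.^-congʳ X (≡.sym (Fin.toℕ-fromℕ< t<n)))))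

    𝒢⇒InG : ∀ {g} → 𝒞.𝒢 g → InG g
    𝒢⇒InG (z , γ , t , z-central , γ≉0 , g≈) = z , γ , toℕ t , z-central , γ≉0 , Fin.toℕ<n t , g≈

    ι≈0⇒≈0 : ∀ {x} → ι x A.≈ A.0# → x B.≈ B.0#
    ι≈0⇒≈0 eq = ι.injective (A.trans eq (A.sym ι.0#-homo))

    coeff-X^ : ∀ i → coeff (const A.1# * X ^ i) i A.≈ A.1#
    coeff-X^ i = A.trans (A.reflexive (≡.cong (coeff (const A.1# * X ^ i)) (≡.sym (ℕ.+-identityʳ i)))) (P.coeff-*-X^ (const A.1#) i 0)

    X^-below : ∀ i → Below (suc i) (const A.1# * X ^ i)
    X^-below i = P.Below-mono (const A.1# * X ^ i) (ℕ.≤-reflexive (ℕ.+-comm i 1)) (P.Below-*-X^ (const A.1#) i (P.Below-const A.1#))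

    -- If X⁴ were constant, then deg F(X²) = 2s would be 4 and F(X²) = X⁴ − ν.
    unexceptional : n ≡ 2 → ∀ ρ → ¬ (X ^ 4 ≈ const ρ)
    unexceptional n≡2 ρ X⁴≈ρ = case (4 ℕ.<? s ℕ.* n)
      where
      X⁴ = const A.1# * X ^ 4
      case : Dec (4 ℕ.< s ℕ.* n) → ⊥
      -- Both X⁴ and ρ are reduced here, so their coefficients at X⁴ would agree.
      case (yes 4<sn) = A.1≉0 (A.trans (A.sym (coeff-X^ 4)) (P.coeff-≈ (unique X⁴ (const ρ)
        (P.Below-mono X⁴ 4<sn (X^-below 4)) (P.Below-mono (const ρ) (ℕ.≤-trans (s≤s z≤n) 4<sn) (P.Below-const ρ))
        (trans (*-identityˡ (X ^ 4)) X⁴≈ρ)) 4))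
      case (no 4≮sn) = F-generic (B.- F₀) (λ -F₀≈0 → F₀≉0 (B.trans (B.sym (B.+-identityʳ F₀)) (B.trans (B.+-congˡ (B.sym -F₀≈0)) (B.-‿inverseʳ F₀))))
        (n≡2 , s≡2 , PB.coefficientwise λ
          { 0 → B.sym (-‿involutive F₀)
          ; 1 → ι≈0⇒≈0 (A.trans (A.sym (coeff-evaluate F 1)) (A.trans (A.reflexive (≡.cong (λ N → coeff M (1 ℕ.* N)) n≡2)) M₂≈0))
          ; 2 → B.trans (B.reflexive (≡.cong (PB.coeff F) (≡.sym s≡2))) (proj₁ F-monic)
          ; (suc (suc (suc i))) → proj₂ F-monic _ (≡.subst (ℕ._< 3 ℕ.+ i) (≡.sym s≡2) (s≤s (s≤s (s≤s z≤n)))) })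
        where
        open import Algebra.Properties.Ring B.ring using (-‿involutive)
        s≡2 : s ≡ 2
        s≡2 = ℕ.≤-antisym (ℕ.*-cancelʳ-≤ s 2 2 (≡.subst (λ N → s ℕ.* N ℕ.≤ 4) n≡2 (ℕ.≮⇒≥ 4≮sn))) 2≤s
        sn≡4 : s ℕ.* n ≡ 4
        sn≡4 = ≡.cong₂ ℕ._*_ s≡2 n≡2
        -- Now M has degree 4, so X⁴ - M is the reduced representative of X⁴ and equals ρ. Its
        -- coefficient at X² is, up to sign, the linear coefficient of F, which therefore vanishes.
        p = X⁴ P.+ P.- M
        M≤4 : Below 5 M
        M≤4 = ≡.subst (λ N → Below (suc N) M) sn≡4 (evaluate-below F s (proj₂ F-monic))
        coeff-p : ∀ i → coeff p i A.≈ coeff X⁴ i A.- coeff M i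
        coeff-p i = A.trans (P.coeff-+ X⁴ (P.- M) i) (A.+-congˡ (P.coeff-neg M i))
        p<4 : Below 4 p
        p<4 i 4≤i = go i 4≤i (ℕ.m≤n⇒m<n∨m≡n 4≤i)
          where
          go : ∀ i → 4 ℕ.≤ i → 4 ℕ.< i ⊎ 4 ≡ i → coeff p i A.≈ A.0#
          go i _ (inj₁ 4<i)    = P.Below-+ X⁴ (P.- M) (X^-below 4) (P.Below-neg M M≤4) i 4<i
          go i _ (inj₂ ≡.refl) = A.trans (coeff-p 4) (A.trans (A.+-cong (coeff-X^ 4) (A.-‿cong
            (A.trans (A.reflexive (≡.cong (coeff M) (≡.sym sn≡4))) M-monic))) (A.-‿inverseʳ A.1#))
        p≈ρ : p P.≈ const ρ
        p≈ρ = unique p (const ρ) (≡.subst (λ N → Below N p) (≡.sym sn≡4) p<4)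
          (≡.subst (λ N → Below N (const ρ)) (≡.sym sn≡4) (P.Below-mono (const ρ) (s≤s z≤n) (P.Below-const ρ)))
          (trans (+-cong {X⁴} {const ρ} (trans (*-identityˡ (X ^ 4)) X⁴≈ρ) (trans (-‿cong M≈0) (≈⇒≋ P.≈-refl))) (+-identityʳ (const ρ)))
        M₂≈0 : coeff M 2 A.≈ A.0#
        M₂≈0 = A.trans (A.sym (A.+-identityˡ _)) (A.trans (A.+-congʳ (A.sym X⁴₂-M₂≈0))
          (A.trans (A.+-assoc _ _ _) (A.trans (A.+-cong (P.coeff-*-X^-low (const A.1#) 4 2 (s≤s (s≤s (s≤s z≤n)))) (A.-‿inverseˡ _)) (A.+-identityʳ _))))
          where
          X⁴₂-M₂≈0 : coeff X⁴ 2 A.- coeff M 2 A.≈ A.0#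
          X⁴₂-M₂≈0 = A.trans (A.sym (coeff-p 2)) (P.coeff-≈ p≈ρ 2)

  Aut⊆𝒜 : ∀ {gh} → 𝒞.Aut k gh → 𝒞.𝒜 gh
  Aut⊆𝒜 {g , h} ((g′ , g′g≈1 , gg′≈1) , (h′ , h′h≈1 , hh′≈1) , gSh⊆S , S⊆gSh) =
    InG⇒𝒢 (g∈G unexceptional) , g′ , μ , g′g≈1 , gg′≈1 , μ≉0 , h≈
    where
    forward : ∀ x → S m x → S m (g * x * h)
    forward x x∈S = 𝒮⇒S (gSh⊆S (x , S⇒𝒮 x∈S , refl))
    backward : ∀ x → S m x → S m (g′ * x * h′)
    backward x x∈S = let y , y∈𝒮 , x≈gyh = S⊆gSh (S⇒𝒮 x∈S) in C.S-resp {x = y} (sym (begin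
      g′ * x * h′                  ≈⟨ *-congʳ h′ (*-congˡ g′ x≈gyh) ⟩
      g′ * (g * y * h) * h′        ≈⟨ *-congʳ h′ (*-congˡ g′ (*-assoc g y h)) ⟩
      g′ * (g * (y * h)) * h′      ≈⟨ *-congʳ h′ (*-assoc g′ g (y * h)) ⟨
      g′ * g * (y * h) * h′        ≈⟨ *-congʳ h′ (*-congʳ (y * h) g′g≈1) ⟩
      1# * (y * h) * h′            ≈⟨ *-congʳ h′ (*-identityˡ (y * h)) ⟩
      y * h * h′                   ≈⟨ *-assoc y h h′ ⟩
      y * (h * h′)                 ≈⟨ *-congˡ y hh′≈1 ⟩
      y * 1#                       ≈⟨ *-identityʳ y ⟩
      y                            ∎)) (𝒮⇒S y∈𝒮)
    open Automorphism {g} {g′} {h} {h′} gg′≈1 g′g≈1 hh′≈1 h′h≈1 forward backward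
    μ = proj₁ (h≈g⁻¹λ unexceptional)
    μ≉0 = proj₁ (proj₂ (h≈g⁻¹λ unexceptional))
    h≈ = proj₂ (proj₂ (h≈g⁻¹λ unexceptional))

  𝒜⊆Aut : ∀ {gh} → 𝒞.𝒜 gh → 𝒞.Aut k gh
  𝒜⊆Aut {g , h} (g∈𝒢 , g′ , μ , g′g≈1 , gg′≈1 , μ≉0 , h≈) =
    (g′ , g′g≈1 , gg′≈1) , (h⁻¹ , h⁻¹h≈1 , hh⁻¹≈1) ,
    (λ (y , y∈𝒮 , x≈gyh) → S⇒𝒮 (C.S-resp {x = g * y * h} (sym x≈gyh) (forward y (𝒮⇒S y∈𝒮)))) ,
    (λ {x} x∈𝒮 → g′ * x * h⁻¹ , S⇒𝒮 (backward x (𝒮⇒S x∈𝒮)) , sym (begin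
      g * (g′ * x * h⁻¹) * h       ≈⟨ *-congʳ h (*-congˡ g (*-assoc g′ x h⁻¹)) ⟩
      g * (g′ * (x * h⁻¹)) * h     ≈⟨ *-congʳ h (*-assoc g g′ (x * h⁻¹)) ⟨
      g * g′ * (x * h⁻¹) * h       ≈⟨ *-congʳ h (*-congʳ (x * h⁻¹) gg′≈1) ⟩
      1# * (x * h⁻¹) * h           ≈⟨ *-congʳ h (*-identityˡ (x * h⁻¹)) ⟩
      x * h⁻¹ * h                  ≈⟨ *-assoc x h⁻¹ h ⟩
      x * (h⁻¹ * h)                ≈⟨ *-congˡ x h⁻¹h≈1 ⟩
      x * 1#                       ≈⟨ *-identityʳ x ⟩
      x                            ∎))
    where
    μ⁻¹ = proj₁ (A.inverse μ μ≉0)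
    open Converse {g} {g′} {h} {μ} {μ⁻¹} (𝒢⇒InG g∈𝒢) gg′≈1 g′g≈1 (proj₂ (A.inverse μ μ≉0)) h≈

open import Data.Nat.Base using (_≤_; _∸_; _^_)
open import Relation.Unary using (_≐_)

theorem6p5 : ∀ {c₁ ℓ₁ a₁ c₂ ℓ₂ a₂ : Level} (q n s k : ℕ) →
  PrimePower q → 2 ≤ n → 2 ≤ s → 1 ≤ k → k ≤ n ∸ 1 →
  (𝔽q : HeytingField c₁ ℓ₁ a₁) (𝔽qⁿ : HeytingField c₂ ℓ₂ a₂) →
  HasCardinality 𝔽q q → HasCardinality 𝔽qⁿ (q ^ n) →
  let module 𝔽q = HeytingField 𝔽q
      module 𝔽qⁿ = HeytingField 𝔽qⁿ
      module 𝔽q[Y] = Polynomial 𝔽q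
  in
  (ι : 𝔽q.Carrier → 𝔽qⁿ.Carrier) → Galois.IsFieldExtension 𝔽q 𝔽qⁿ ι →
  (σ : 𝔽qⁿ.Carrier → 𝔽qⁿ.Carrier) → Galois.IsGaloisGenerator 𝔽q 𝔽qⁿ ι σ →
  (F : 𝔽q[Y].Poly) → 𝔽q[Y].IsMonicOfDegree F s →
  Irreducible (RawRing.rawSemiring 𝔽q[Y].ring) F →
  (∀ ν → ¬ (ν 𝔽q.≈ 𝔽q.0#) →
    ¬ (n ≡ 2 × s ≡ 2 × F 𝔽q[Y].≈ (𝔽q.- ν ∷ 𝔽q.0# ∷ 𝔽q.1# ∷ []))) →
  Code.Aut 𝔽q 𝔽qⁿ ι σ n s F k ≐ Code.𝒜 𝔽q 𝔽qⁿ ι σ n s F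
theorem6p5 q n s k q-primePower 2≤n 2≤s 1≤k k≤n-1 𝔽q 𝔽qⁿ card-q card-qⁿ ι isExtension σ isGenerator F F-monic F-irreducible F-generic =
  Aut⊆𝒜 , 𝒜⊆Aut
  where
  open AutomorphismGroup q n s k q-primePower 2≤n 2≤s 1≤k k≤n-1 𝔽q 𝔽qⁿ card-q card-qⁿ ι isExtension σ isGenerator
    F F-monic F-irreducible F-generic
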